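{- $\mathrm{MC}(\cup,\cap,+,\times,/)\in\mathrm{NEXP}$.
   Context: Natural numbers include $0$. For $A,B\subseteq\mathbb N$: $A\cup B$, $A\cap B$ are the usual operations, $\overline{A}=\mathbb N\setminus A$, $A+B=\{a+b: a\in A, b\in B\}$, $A\times B=\{a\cdot b: a\in A, b\in B\}$, and $A/B=\{c\in\mathbb N:\exists a\in A\ \exists b\in B\setminus\{0\}: a=c\cdot b\}$ (exact integer division without remainder or rounding). For $\emptyset\ne\mathcal O\subseteq\{\cup,\cap,\overline{\phantom{c}},+,\times,/\}$, an $\mathcal O$-circuit $C=(V,E,g_C,\alpha)$ is a finite acyclic directed multigraph with gate set $V\subseteq\mathbb N$, every gate having indegree $0$, $1$ or $2$, a designated output gate $g_C\in V$, and a labeling $\alpha$: gates of indegree $0$ (input gates) are labeled by natural numbers, gates of indegree $1$ are labeled $\overline{\phantom{c}}$ (allowed only if $\overline{\phantom{c}}\in\mathcal O$), and gates of indegree $2$ are labeled by an operation in $\mathcal O\setminus\{\overline{\phantom{c}}\}$. The result set $I(g)\subseteq\mathbb N$ is defined inductively: $I(g)=\{\alpha(g)\}$ for an input gate; $I(g)=\mathbb N\setminus I(p)$ for a complement gate with predecessor $p$; $I(g)=I(g_1)\,\sigma\,I(g_2)$ for a gate labeled $\sigma$ with predecessors $g_1\le g_2$ (a double edge from one gate gives $g_1=g_2$). $I(C)=I(g_C)$. A circuit is encoded as a bit string listing its gates in reverse topological order, each gate as the triple (gate name, label, list of predecessors), with all numbers (including input labels) in binary; $|C|$ denotes the length of this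 encoding. The membership problem is $\mathrm{MC}(\mathcal O)=\{(C,b): C \text{ is an } \mathcal O\text{ -circuit},\ b\in\mathbb N,\ b\in I(C)\}$, with $b$ given in binary; $\mathrm{MC}(\sigma_1,\dots,\sigma_n)$ abbreviates $\mathrm{MC}(\{\sigma_1,\dots,\sigma_n\})$. -}

module Defs where

open import Data.Bool using (Bool; true; false; T)
open import Data.Fin using (Fin)
open import Data.Fin.Induction using (spo-wellFounded)
open import Data.List as List using (List; []; _∷_; _++_; length; concatMap)
open import Data.List.Membership.Propositional using () renaming (_∈_ to _∈ˡ_)
open import Data.List.Relation.Binary.Permutation.Propositional using (_↭_)
open import Data.List.Relation.Unary.AllPairs using (AllPairs)
open import Data.List.Relation.Unary.Any using (here; there; index)
open import Data.List.Relation.Unary.Any.Properties using (lookup-index)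
open import Data.List.Relation.Unary.Unique.Propositional using (Unique)
open import Data.Nat using (ℕ; zero; suc; _+_; _*_; _^_; _≤_)
open import Data.Product using (Σ; ∃; ∃-syntax; ∃₂; _×_; _,_)
open import Data.Unit using (⊤)
open import Data.Vec as Vec using (Vec; _∷_)
open import Function.Bundles using (_⇔_; _↔_)
open import Induction.WellFounded using (Acc; acc; WellFounded)
open import Level using (0ℓ) renaming (suc to lsuc)
open import Relation.Binary using (Rel; IsStrictPartialOrder)
open import Relation.Binary.Construct.Closure.Transitive using (TransClosure; [_]; _∷_; transitive)
open import Relation.Binary.PropositionalEquality
  using (_≡_; _≢_; refl; sym; subst; isEquivalence; resp₂)
open import Relation.Nullary using (¬_)
open import Relation.Unary using (Pred; ｛_｝; ∁; _∪_; _∩_; _∈_)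

Language : Set₁
Language = Pred (List Bool) 0ℓ

------------------------------------------------------------------------
-- Nondeterministic multitape Turing machines

data Move : Set where
  left stay right : Move

IsFinite : Set → Set
IsFinite A = ∃[ n ] (A ↔ Fin n)

-- There is one input tape and any number of work tapes.  All tapes are
-- two-way infinite and may be written to.
record NTM : Set₁ where
  field
    workTapes    : ℕ
    State        : Set
    Symbol       : Set
    finiteState  : IsFinite State
    finiteSymbol : IsFinite Symbol
    blank        : Symbol
    bit          : Bool → Symbol
    bit-distinct : bit false ≢ bit true
    bit-nonblank : ∀ b → bit b ≢ blank
    start        : State
    accepting    : State → Bool
    δ            : State → Vec Symbol (suc workTapes) →
                   List (State × Vec (Symbol × Move) (suc workTapes))

module Computation (M : NTM) where
  open NTM M

  -- `before` is stored nearest cell first; cells beyond either list are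
  -- blank.
  record Tape : Set where
    constructor tape
    field
      before : List Symbol
      head   : Symbol
      after  : List Symbol

  open Tape

  load : List Symbol → Tape
  load []       = tape [] blank []
  load (s ∷ ss) = tape [] s ss

  move : Move → Tape → Tape
  move stay  t                    = t
  move left  (tape []       s rs) = tape [] blank (s ∷ rs)
  move left  (tape (l ∷ ls) s rs) = tape ls l (s ∷ rs)
  move right (tape ls s [])       = tape (s ∷ ls) blank []
  move right (tape ls s (r ∷ rs)) = tape (s ∷ ls) r rs

  act : Symbol × Move → Tape → Tape
  act (s , m) t = move m (record t { head = s })

  record Config : Set where
    constructor config
    field
      state : State
      tapes : Vec Tape (suc workTapes)

  open Config

  initial : List Bool → Config
  initial w =
    config start (load (List.map bit w) ∷ Vec.replicate workTapes (load []))

  options : Config → List (State × Vec (Symbol × Move) (suc workTapes))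
  options c = δ (state c) (Vec.map head (tapes c))

  infix 4 _⟶_ _⟶[_]_

  data _⟶_ (c : Config) : Config → Set where
    step : ∀ {q as} → (q , as) ∈ˡ options c →
           c ⟶ config q (Vec.zipWith act as (tapes c))

  data _⟶[_]_ : Config → ℕ → Config → Set where
    done : ∀ {c} → c ⟶[ 0 ] c
    _∷_  : ∀ {c d e n} → c ⟶ d → d ⟶[ n ] e → c ⟶[ suc n ] e

  Accepting : Config → Set
  Accepting c = options c ≡ [] × T (accepting (state c))

  Accepts : Language
  Accepts w = ∃₂ λ n c → initial w ⟶[ n ] c × Accepting c

  -- All computation paths on w, accepting or not, have at most t steps.
  HaltsWithin : List Bool → ℕ → Set
  HaltsWithin w t = ∀ {n c} → initial w ⟶[ n ] c → n ≤ t

open Computation using (Accepts; HaltsWithin)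

-- NTIME(O(t))
NTIME : (ℕ → ℕ) → Pred Language (lsuc 0ℓ)
NTIME t L = Σ NTM λ M →
  (∀ w → w ∈ L ⇔ w ∈ Accepts M) ×
  ∃[ c ] (∀ w → HaltsWithin M w (c * t (length w)))

NEXP : Pred Language (lsuc 0ℓ)
NEXP L = ∃[ k ] (L ∈ NTIME (λ n → 2 ^ (n ^ k)))

------------------------------------------------------------------------
-- Circuits

data BinaryOp : Set where
  union intersection sum product quotient : BinaryOp

data Operation : Set where
  complement : Operation
  binary     : BinaryOp → Operation

-- The label of a gate together with its predecessors.  As the edges of
-- the multigraph are determined by the predecessors of each gate, they
-- are not recorded separately; a double edge is a repeated predecessor.
data Gate : Set where
  input      : (value : ℕ) → Gate
  complement : (g : ℕ) → Gate
  binary     : BinaryOp → (g₁ g₂ : ℕ) → Gate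

predecessors : Gate → List ℕ
predecessors (input _)        = []
predecessors (complement g)   = g ∷ []
predecessors (binary _ g₁ g₂) = g₁ ∷ g₂ ∷ []

-- The condition g₁ ≤ g₂ makes the gate names determine which
-- predecessor is the left operand (the dividend, for a quotient).
Admissible : List Operation → Gate → Set
Admissible 𝒪 (input _)        = ⊤
Admissible 𝒪 (complement _)   = complement ∈ˡ 𝒪
Admissible 𝒪 (binary σ g₁ g₂) = binary σ ∈ˡ 𝒪 × g₁ ≤ g₂

record Circuit (𝒪 : List Operation) : Set where
  field
    V          : List ℕ
    V-unique   : Unique V
    gate       : ℕ → Gate            -- irrelevant outside V
    output     : ℕ
    output∈V   : output ∈ˡ V
    admissible : ∀ {g} → g ∈ˡ V → Admissible 𝒪 (gate g)
    closed     : ∀ {p g} → g ∈ˡ V → p ∈ˡ predecessors (gate g) → p ∈ˡ V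

  Edge : Rel ℕ 0ℓ
  Edge p g = g ∈ˡ V × p ∈ˡ predecessors (gate g)

  field
    acyclic : ∀ g → ¬ TransClosure Edge g g

  Edge-wellFounded : WellFounded Edge
  Edge-wellFounded g = acc λ (g∈V , p∈) → onV (closed g∈V p∈)
    where
    name : Fin (length V) → ℕ
    name = List.lookup V

    _⊏_ : Rel (Fin (length V)) 0ℓ
    i ⊏ j = TransClosure Edge (name i) (name j)

    isSPO : IsStrictPartialOrder _≡_ _⊏_
    isSPO = record
      { isEquivalence = isEquivalence
      ; irrefl        = λ { refl → acyclic _ }
      ; trans         = transitive Edge
      ; <-resp-≈      = resp₂ _⊏_
      }

    lift : ∀ {i} → Acc _⊏_ i → Acc Edge (name i)
    lift {i} (acc rs) = acc λ { {p} e@(i∈V , p∈) →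
      let p∈V = closed i∈V p∈
          eq  = lookup-index p∈V
      in subst (Acc Edge) (sym eq)
           (lift (rs {index p∈V} [ subst (λ x → Edge x (name i)) eq e ])) }

    onV : ∀ {p} → p ∈ˡ V → Acc Edge p
    onV p∈V = subst (Acc Edge) (sym (lookup-index p∈V))
                (lift (spo-wellFounded isSPO (index p∈V)))

------------------------------------------------------------------------
-- Result sets

apply : BinaryOp → Pred ℕ 0ℓ → Pred ℕ 0ℓ → Pred ℕ 0ℓ
apply union        A B = A ∪ B
apply intersection A B = A ∩ B
apply sum          A B = λ c → ∃₂ λ a b → a ∈ A × b ∈ B × c ≡ a + b
apply product      A B = λ c → ∃₂ λ a b → a ∈ A × b ∈ B × c ≡ a * b
apply quotient     A B = λ c → ∃₂ λ a b → a ∈ A × b ∈ B × b ≢ 0 × a ≡ c * b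

evaluate : (γ : Gate) → (∀ p → p ∈ˡ predecessors γ → Pred ℕ 0ℓ) → Pred ℕ 0ℓ
evaluate (input n)        I = ｛ n ｝
evaluate (complement g)   I = ∁ (I g (here refl))
evaluate (binary σ g₁ g₂) I = apply σ (I g₁ (here refl)) (I g₂ (there (here refl)))

module _ {𝒪 : List Operation} (C : Circuit 𝒪) where
  open Circuit C

  resultAcc : ∀ {g} → Acc Edge g → g ∈ˡ V → Pred ℕ 0ℓ
  resultAcc {g} (acc rs) g∈V = evaluate (gate g) λ p p∈ →
    resultAcc (rs (g∈V , p∈)) (closed g∈V p∈)

  gateResult : ∀ {g} → g ∈ˡ V → Pred ℕ 0ℓ
  gateResult {g} = resultAcc (Edge-wellFounded g)

  result : Pred ℕ 0ℓ
  result = gateResult output∈V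

------------------------------------------------------------------------
-- Encoding of circuits as bit strings

increment : List Bool → List Bool
increment []           = true ∷ []
increment (false ∷ bs) = true ∷ bs
increment (true  ∷ bs) = false ∷ increment bs

-- Binary representation without leading zeros, least significant digit
-- first; 0 is represented by the empty string.
digits : ℕ → List Bool
digits zero    = []
digits (suc n) = increment (digits n)

-- Each element is announced by a 1 and the end of the list by a 0, so
-- the code is prefix-free if that of the elements is.
encodeList : ∀ {A : Set} → (A → List Bool) → List A → List Bool
encodeList f xs = concatMap (λ x → true ∷ f x) xs ++ false ∷ []

encodeℕ : ℕ → List Bool
encodeℕ n = encodeList (λ d → d ∷ []) (digits n)

encodeOp : BinaryOp → List Bool
encodeOp union        = false ∷ false ∷ true  ∷ []
encodeOp intersection = false ∷ true  ∷ false ∷ []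
encodeOp sum          = false ∷ true  ∷ true  ∷ []
encodeOp product      = true  ∷ false ∷ false ∷ []
encodeOp quotient     = true  ∷ false ∷ true  ∷ []

encodeLabel : Gate → List Bool
encodeLabel (input n)      = false ∷ encodeℕ n
encodeLabel (complement _) = true ∷ false ∷ false ∷ false ∷ []
encodeLabel (binary σ _ _) = true ∷ encodeOp σ

encodeGate : ℕ × Gate → List Bool
encodeGate (g , γ) =
  encodeℕ g ++ encodeLabel γ ++ encodeList encodeℕ (predecessors γ)

-- No edge leads from a gate to a later one.
ReverseTopological : ∀ {𝒪} → Circuit 𝒪 → List ℕ → Set
ReverseTopological C = AllPairs (λ g h → ¬ Circuit.Edge C g h)

-- A circuit has one encoding for each reverse topological order of its
-- gates.  The output gate is given by its name, in front of the gates.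
data EncodesCircuit {𝒪} (C : Circuit 𝒪) : List Bool → Set where
  encoding : ∀ {order} → order ↭ Circuit.V C → ReverseTopological C order →
    EncodesCircuit C
      (encodeℕ (Circuit.output C) ++
       encodeList encodeGate (List.map (λ g → g , Circuit.gate C g) order))

------------------------------------------------------------------------
-- The membership problem

MC : List Operation → Language
MC 𝒪 w = Σ (Circuit 𝒪) λ C → ∃₂ λ u b →
  EncodesCircuit C u × w ≡ u ++ encodeℕ b × b ∈ result C

{-# OPTIONS --safe #-}
module Submission where

-- Without complement every result set is finite, and since an arithmetic gate
-- at most doubles the number of digits, all values are below 2 ^ 2 ^ |C|.
-- A circuit that is listed in reverse topological order is evaluated in one
-- pass over its gates, which transforms a list of obligations "v belongs to
-- I(g)".  Each gate replaces the obligations on itself by guessed ones on its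
-- predecessors, and the guesses are verified by tests x * y + z = t.  Two more
-- kinds of obligations, "g occurs later" and "g does not occur later", make
-- sure that the list describes a circuit.  As a gate at most doubles the number
-- of obligations, there is an accepting run of exponential length whenever
-- there is an accepting run at all; all longer runs are stopped by a clock
-- which the machine moves along with every step.

open import Defs
open import Algebra.Properties.CommutativeSemigroup using (interchange)
open import Data.Bool as Bool using (Bool; true; false; _∧_; _xor_)
open import Data.Empty using (⊥; ⊥-elim)
open import Data.Fin as Fin using (Fin; zero; suc; fromℕ; inject₁; toℕ; #_)
open import Data.Fin.Properties using (toℕ-fromℕ; toℕ-inject₁; 1↔⊤; +↔⊎)
open import Data.List as List using (List; []; _∷_; _++_; length; replicate; mapMaybe; concatMap; reverse; _ʳ++_)
open import Data.List.Membership.Propositional using (_∉_) renaming (_∈_ to _∈ˡ_)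
open import Data.List.Membership.Propositional.Properties using (∈-map⁺; ∈-map⁻)
open import Data.List.Properties using (length-++; length-replicate; ++-assoc; ++-identityʳ; ʳ++-ʳ++; length-ʳ++;
    reverse-involutive; unfold-reverse; ++-ʳ++; length-reverse; ∷-injective; map-cong-local; map-∘; map-id)
open import Data.List.Relation.Binary.Permutation.Propositional using (↭-refl; ↭-sym; ↭⇒↭ₛ)
open import Data.List.Relation.Binary.Permutation.Propositional.Properties using (∈-resp-↭)
open import Data.List.Relation.Unary.All as All using (All; []; _∷_)
open import Data.List.Relation.Unary.All.Properties using (¬Any⇒All¬; All¬⇒¬Any; ++⁺)
open import Data.List.Relation.Unary.AllPairs as AllPairs using (AllPairs; []; _∷_)
open import Data.List.Relation.Unary.Any using (here; there)
open import Data.List.Relation.Unary.Unique.Propositional using (Unique)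
open import Data.Maybe as Maybe using (Maybe; just; nothing)
open import Data.Nat
open import Data.Nat.Properties
open import Data.Nat.Solver using (module +-*-Solver)
open import Data.Product using (∃-syntax; ∃₂; _×_; _,_; proj₁; proj₂; map₂)
open import Data.Sum using (_⊎_; inj₁; inj₂)
open import Data.Sum.Function.Propositional using (_⊎-↔_)
open import Data.Unit using (⊤; tt)
open import Data.Vec as Vec using (Vec; []; _∷_; lookup; _[_]≔_)
open import Data.Vec.Properties using (lookup-map; map-[]≔; map-replicate; lookup-replicate; lookup∘update;
    lookup∘update′; []≔-lookup; []≔-commutes; []≔-idempotent)
open import Function.Base using (_∘_)
open import Function.Bundles using (mk⇔; _↔_; mk↔ₛ′)
open import Function.Construct.Composition using (_↔-∘_)
open import Function.Construct.Identity using (↔-id)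
open import Function.Construct.Symmetry using (↔-sym)
open import Induction.WellFounded using (Acc; acc)
open import Relation.Binary.Construct.Closure.Transitive using (TransClosure; [_]; _∷_)
open import Relation.Binary.Definitions using (tri<; tri≈; tri>)
open import Relation.Binary.PropositionalEquality
open import Relation.Nullary using (¬_; yes; no)
open import Relation.Unary using (Pred; _∈_)
open import Data.List.Relation.Binary.Permutation.Setoid.Properties (setoid ℕ) using (Unique-resp-↭)
open +-*-Solver using (solve; con; _:+_; _:*_; _:=_)

-- Binary numerals

-- Without complement, membership is a purely existential statement. Every obligation can therefore
-- be verified with guesses of its own: two obligations on one gate need not share operands, and the
-- gate is simply treated once for each of them. A transition table for this cannot be verified by
-- hand. The algorithm is a regular program over commands on numbers, refined first to stack
-- operations and then to tape actions; Thompson's construction turns the result into the control of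
-- a machine. Soundness is proved for runs of any length and numbers of any size. Sizes and costs
-- enter only into completeness, where a single good run has to be short. The clock may thus be
-- crude: it has to outlast that run and to stop in time itself. For input length `N` put
-- `L = 2 ^ N`. Numbers have at most `L` digits, there are at most `4 * L` items and `66 * L`
-- command-level transitions, and a command costs at most `568 * L * L` transitions on stacks. All
-- of this is of the form `c ^ N`; the exponent 2 in `2 ^ (n ^ 2)` only absorbs the constant base.

n<2^n : ∀ n → n < 2 ^ n
n<2^n zero    = s≤s z≤n
n<2^n (suc n) = begin
  suc (suc n)       ≤⟨ s≤s (n<2^n n) ⟩
  suc (2 ^ n)       ≤⟨ +-monoˡ-≤ (2 ^ n) (m^n>0 2 n) ⟩
  2 ^ n + 2 ^ n     ≡⟨ cong (2 ^ n +_) (+-identityʳ (2 ^ n)) ⟨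
  2 ^ suc n         ∎
  where open ≤-Reasoning

bitℕ : Bool → ℕ
bitℕ false = 0
bitℕ true  = 1

val : List Bool → ℕ
val []       = 0
val (b ∷ bs) = bitℕ b + 2 * val bs

zeros : ℕ → List Bool
zeros k = replicate k false

bitℕ-injective : ∀ b c {m n} → bitℕ b + 2 * m ≡ bitℕ c + 2 * n → b ≡ c × m ≡ n
bitℕ-injective false false {m} {n} eq = refl , *-cancelˡ-≡ m n 2 eq
bitℕ-injective true  true  {m} {n} eq = refl , *-cancelˡ-≡ m n 2 (suc-injective eq)
bitℕ-injective false true  {m} {n} eq = ⊥-elim (even≢odd m n eq)
bitℕ-injective true  false {m} {n} eq = ⊥-elim (even≢odd n m (sym eq))

-- Leading zeros do not change a value, so the lengths have to agree.
val-injective : ∀ bs cs → length bs ≡ length cs → val bs ≡ val cs → bs ≡ cs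
val-injective []       []       _  _  = refl
val-injective (b ∷ bs) (c ∷ cs) l eq with bitℕ-injective b c eq
... | refl , eq′ = cong (b ∷_) (val-injective bs cs (suc-injective l) eq′)

val-zeros : ∀ bs k → val (bs ++ zeros k) ≡ val bs
val-zeros (b ∷ bs) k       = cong (λ n → bitℕ b + 2 * n) (val-zeros bs k)
val-zeros []       zero    = refl
val-zeros []       (suc k) = cong (2 *_) (val-zeros [] k)

val<2^length : ∀ bs → val bs < 2 ^ length bs
val<2^length []       = s≤s z≤n
val<2^length (b ∷ bs) = begin
  suc (bitℕ b + 2 * val bs) ≤⟨ s≤s (+-monoˡ-≤ _ (bit≤1 b)) ⟩
  2 + 2 * val bs            ≡⟨ *-suc 2 (val bs) ⟨
  2 * suc (val bs)          ≤⟨ *-monoʳ-≤ 2 (val<2^length bs) ⟩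
  2 ^ length (b ∷ bs)       ∎
  where
  open ≤-Reasoning
  bit≤1 : ∀ b → bitℕ b ≤ 1
  bit≤1 false = z≤n
  bit≤1 true  = ≤-refl

val-increment : ∀ bs → val (increment bs) ≡ suc (val bs)
val-increment []           = refl
val-increment (false ∷ bs) = refl
val-increment (true ∷ bs)  = trans (cong (2 *_) (val-increment bs)) (*-suc 2 (val bs))

val-digits : ∀ n → val (digits n) ≡ n
val-digits zero    = refl
val-digits (suc n) = trans (val-increment (digits n)) (cong suc (val-digits n))

-- The successor excludes 0, whose double must not acquire a leading zero.
digits-double : ∀ n → digits (2 * suc n) ≡ false ∷ digits (suc n)
digits-double zero    = refl
digits-double (suc n) rewrite +-suc n (suc (n + 0)) | digits-double n = refl

digits-double+1 : ∀ n → digits (1 + 2 * n) ≡ true ∷ digits n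
digits-double+1 zero    = refl
digits-double+1 (suc n) = cong increment (digits-double n)

-- The most significant digit comes last, so a numeral without leading zeros is empty or ends in
-- `true`. A machine can test this by looking at one digit, and it characterises the range of
-- `digits`.
data Canonical : List Bool → Set where
  none : Canonical []
  ends : ∀ bs → Canonical (bs ++ true ∷ [])

canonical-increment : ∀ bs → ∃[ cs ] increment (bs ++ true ∷ []) ≡ cs ++ true ∷ []
canonical-increment []           = false ∷ [] , refl
canonical-increment (false ∷ bs) = true ∷ bs , refl
canonical-increment (true ∷ bs) with canonical-increment bs
... | cs , eq = false ∷ cs , cong (false ∷_) eq

digits-canonical : ∀ n → Canonical (digits n)
digits-canonical zero = none
digits-canonical (suc n) with digits n | digits-canonical n
... | _ | none = ends []
... | _ | ends bs with canonical-increment bs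
...   | cs , eq rewrite eq = ends cs

val-ends : ∀ bs → ∃[ n ] val (bs ++ true ∷ []) ≡ suc n
val-ends []           = 0 , refl
val-ends (true ∷ bs)  = _ , refl
val-ends (false ∷ bs) with val-ends bs
... | n , eq rewrite eq = _ , refl

digits-val : ∀ {bs} → Canonical bs → digits (val bs) ≡ bs
digits-val none      = refl
digits-val (ends bs) = digits-ends bs
  where
  digits-ends : ∀ bs → digits (val (bs ++ true ∷ [])) ≡ bs ++ true ∷ []
  digits-ends []           = refl
  digits-ends (true ∷ bs)  = trans (digits-double+1 (val (bs ++ true ∷ []))) (cong (true ∷_) (digits-ends bs))
  digits-ends (false ∷ bs) with val-ends bs | digits-ends bs
  ... | n , eq | ih rewrite eq = trans (digits-double n) (cong (false ∷_) ih)

digits-injective : ∀ {m n} → digits m ≡ digits n → m ≡ n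
digits-injective {m} {n} eq = trans (sym (val-digits m)) (trans (cong val eq) (val-digits n))

2^length≤val : ∀ bs → 2 ^ length bs ≤ val (bs ++ true ∷ [])
2^length≤val []       = ≤-refl
2^length≤val (b ∷ bs) = ≤-trans (*-monoʳ-≤ 2 (2^length≤val bs)) (m≤n+m _ (bitℕ b))

-- A numeral with more than `k` digits has its leading 1 at weight `2 ^ k` or above.
length-digits : ∀ n k → n < 2 ^ k → length (digits n) ≤ k
length-digits n k n< with digits n | digits-canonical n | val-digits n
... | _ | none    | _    = z≤n
... | _ | ends bs | refl with length bs <? k
...   | yes p = ≤-trans (≤-reflexive (trans (length-++ bs) (+-comm _ 1))) p
...   | no ¬p = ⊥-elim (<⇒≱ n< (≤-trans (^-monoʳ-≤ 2 (≮⇒≥ ¬p)) (2^length≤val bs)))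

<2^length-digits : ∀ n → n < 2 ^ length (digits n)
<2^length-digits n = subst (_< 2 ^ length (digits n)) (val-digits n) (val<2^length (digits n))

maj : Bool → Bool → Bool → Bool
maj false y z = y ∧ z
maj true  y z = y Bool.∨ z

-- Only meaningful for numerals of the same length.
add : Bool → Bool → List Bool → List Bool → List Bool
add d c (y ∷ ys) (z ∷ zs) = (c xor ((d ∧ y) xor z)) ∷ add d (maj c (d ∧ y) z) ys zs
add d c _        _        = c ∷ []

full-adder : ∀ c y z → bitℕ (c xor (y xor z)) + 2 * bitℕ (maj c y z) ≡ bitℕ y + bitℕ z + bitℕ c
full-adder false false false = refl
full-adder false false true  = refl
full-adder false true  false = refl
full-adder false true  true  = refl
full-adder true  false false = refl
full-adder true  false true  = refl
full-adder true  true  false = refl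
full-adder true  true  true  = refl

bitℕ-∧ : ∀ b c → bitℕ (b ∧ c) ≡ bitℕ b * bitℕ c
bitℕ-∧ false _ = refl
bitℕ-∧ true  c = sym (+-identityʳ (bitℕ c))

-- The multiplier is a single digit, so the product `d * ys` can be formed bitwise in the same pass
-- as the addition: one row of schoolbook multiplication. The last carry is kept as an additional
-- digit, so nothing overflows.
val-add : ∀ d c ys zs → length ys ≡ length zs → val (add d c ys zs) ≡ bitℕ d * val ys + val zs + bitℕ c
val-add d c [] [] _ rewrite *-zeroʳ (bitℕ d) = +-identityʳ (bitℕ c)
val-add d c (y ∷ ys) (z ∷ zs) eq = begin
  bitℕ s + 2 * val (add d c′ ys zs)               ≡⟨ cong (λ n → bitℕ s + 2 * n)
      (val-add d c′ ys zs (suc-injective eq)) ⟩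
  bitℕ s + 2 * (D * Y + Z + bitℕ c′)              ≡⟨ solve 5
      (λ s D Y Z c′ → s :+ con 2 :* (D :* Y :+ Z :+ c′) := (s :+ con 2 :* c′) :+ con 2 :* (D :* Y :+ Z)) refl
      (bitℕ s) D Y Z (bitℕ c′) ⟩
  bitℕ s + 2 * bitℕ c′ + 2 * (D * Y + Z)          ≡⟨ cong (_+ 2 * (D * Y + Z)) (full-adder c (d ∧ y) z) ⟩
  bitℕ (d ∧ y) + bitℕ z + bitℕ c + 2 * (D * Y + Z)
      ≡⟨ cong (λ n → n + bitℕ z + bitℕ c + 2 * (D * Y + Z)) (bitℕ-∧ d y) ⟩
  D * bitℕ y + bitℕ z + bitℕ c + 2 * (D * Y + Z)
      ≡⟨ solve 6 (λ D y z c Y Z → D :* y :+ z :+ c :+ con 2 :* (D :* Y :+ Z) := D :* (y :+ con 2 :* Y) :+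
      (z :+ con 2 :* Z) :+ c) refl D (bitℕ y) (bitℕ z) (bitℕ c) Y Z ⟩
  D * (bitℕ y + 2 * Y) + (bitℕ z + 2 * Z) + bitℕ c ∎
  where
  open ≡-Reasoning
  D = bitℕ d
  Y = val ys
  Z = val zs
  s = c xor ((d ∧ y) xor z)
  c′ = maj c (d ∧ y) z

length-add : ∀ d c ys zs → length ys ≡ length zs → length (add d c ys zs) ≡ suc (length zs)
length-add d c []       []       _  = refl
length-add d c (y ∷ ys) (z ∷ zs) eq = cong suc (length-add d _ ys zs (suc-injective eq))

frame : List Bool → List Bool
frame = encodeList (_∷ [])

-- The flags form a prefix code and fix where a numeral ends. Hence an item on a stack can be
-- decoded in one way only.
frame-injective : ∀ bs cs {l m} → frame bs ++ l ≡ frame cs ++ m → bs ≡ cs × l ≡ m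
frame-injective []       []       refl = refl , refl
frame-injective (b ∷ bs) (c ∷ cs) eq with ∷-injective eq
... | _ , eq′ with ∷-injective eq′
... | refl , eq″ with frame-injective bs cs eq″
... | refl , refl = refl , refl

length-frame : ∀ bs → length (frame bs) ≡ 1 + length bs * 2
length-frame []       = refl
length-frame (b ∷ bs) = cong (2 +_) (length-frame bs)

-- Gate lists

Gates : Set
Gates = List (ℕ × Gate)

names : Gates → List ℕ
names = List.map proj₁

-- Evaluation by recursion on the list instead of on accessibility: a gate refers only to the
-- entries after it, which are exactly what a one-pass reader still has ahead. The disequality makes
-- the first entry of a name the decisive one.
Den : Gates → ℕ → ℕ → Set
Den []             g v = ⊥
Den ((h , γ) ∷ gs) g v = (g ≡ h × evaluate γ (λ p _ → Den gs p) v) ⊎ (g ≢ h × Den gs g v)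

Den⇒∈ : ∀ gs {g v} → Den gs g v → g ∈ˡ names gs
Den⇒∈ (_ ∷ gs) (inj₁ (refl , _)) = here refl
Den⇒∈ (_ ∷ gs) (inj₂ (_ , d))    = there (Den⇒∈ gs d)

-- The conditions on a circuit, each judged against the later entries alone. Acyclicity and the
-- reverse topological order are implied, as predecessors lie in the tail.
data Valid (𝒪 : List Operation) : Gates → Set where
  []  : Valid 𝒪 []
  cons : ∀ {g γ gs} → g ∉ names gs → (∀ {p} → p ∈ˡ predecessors γ → p ∈ˡ names gs) →
        Admissible 𝒪 γ → Valid 𝒪 gs → Valid 𝒪 ((g , γ) ∷ gs)

-- A complement gate uses its operand contravariantly, hence the equivalence in the hypothesis.
evaluate-map : ∀ γ {I J : ∀ p → p ∈ˡ predecessors γ → Pred ℕ _} →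
               (∀ p p∈ v → (I p p∈ v → J p p∈ v) × (J p p∈ v → I p p∈ v)) →
               ∀ {v} → evaluate γ I v → evaluate γ J v
evaluate-map (input n)               f e = e
evaluate-map (complement g)          f e = λ j → e (proj₂ (f _ _ _) j)
evaluate-map (binary union _ _)        f (inj₁ x) = inj₁ (proj₁ (f _ _ _) x)
evaluate-map (binary union _ _)        f (inj₂ y) = inj₂ (proj₁ (f _ _ _) y)
evaluate-map (binary intersection _ _) f (x , y) = proj₁ (f _ _ _) x , proj₁ (f _ _ _) y
evaluate-map (binary sum _ _)          f (a , b , x , y , e) = a , b , proj₁ (f _ _ _) x , proj₁ (f _ _ _) y , e
evaluate-map (binary product _ _)      f (a , b , x , y , e) = a , b , proj₁ (f _ _ _) x , proj₁ (f _ _ _) y , e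
evaluate-map (binary quotient _ _)     f (a , b , x , y , e) = a , b , proj₁ (f _ _ _) x , proj₁ (f _ _ _) y , e

module _ {𝒪 : List Operation} (C : Circuit 𝒪) where
  open Circuit C

  describe : List ℕ → Gates
  describe = List.map λ g → g , gate g

  names-describe : ∀ order → names (describe order) ≡ order
  names-describe order = trans (sym (map-∘ order)) (map-id order)

  -- Validity places the predecessors of the first gate in the tail of the list, where the induction
  -- hypothesis applies to them with their smaller accessibility proofs.
  Den⇔result : ∀ order → Valid 𝒪 (describe order) → ∀ {g} (a : Acc Edge g) (g∈V : g ∈ˡ V) → g ∈ˡ order → ∀ v →
               (Den (describe order) g v → resultAcc C a g∈V v) × (resultAcc C a g∈V v → Den (describe order) g v)
  Den⇔result (h ∷ order) (cons h∉ closed′ _ valid) {g} (acc rs) g∈V g∈ v with g ≟ h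
  ... | yes refl = (λ { (inj₁ (_ , e)) → evaluate-map (gate g) rec e ; (inj₂ (g≢g , _)) → ⊥-elim (g≢g refl) }) ,
                   (λ e → inj₁ (refl , evaluate-map (gate g) (λ p p∈ v → proj₂ (rec p p∈ v) , proj₁ (rec p p∈ v))
                       e))
    where
    rec : ∀ p p∈ v → (Den (describe order) p v → resultAcc C (rs (g∈V , p∈)) (closed g∈V p∈) v) ×
                     (resultAcc C (rs (g∈V , p∈)) (closed g∈V p∈) v → Den (describe order) p v)
    rec p p∈ = Den⇔result order valid (rs (g∈V , p∈)) (closed g∈V p∈)
        (subst (p ∈ˡ_) (names-describe order) (closed′ p∈))
  Den⇔result (h ∷ order) (cons h∉ closed′ _ valid) {g} a g∈V (here g≡h) v | no g≢h = ⊥-elim (g≢h g≡h)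
  Den⇔result (h ∷ order) (cons h∉ closed′ _ valid) {g} a@(acc _) g∈V (there g∈) v | no g≢h with Den⇔result order
      valid a g∈V g∈ v
  ... | f , f⁻¹ = (λ { (inj₁ (g≡h , _)) → ⊥-elim (g≢h g≡h) ; (inj₂ (_ , d)) → f d }) , λ r → inj₂ (g≢h , f⁻¹ r)

  -- The first gate is not its own predecessor, by acyclicity, and it precedes no later gate, by the
  -- order of the list. So its predecessors are in the tail, and the tail is again closed.
  describe-valid : ∀ order → Unique order → AllPairs (λ g h → ¬ Edge g h) order → (∀ {g} → g ∈ˡ order → g ∈ˡ V) →
                   (∀ {g p} → g ∈ˡ order → Edge p g → p ∈ˡ order) → Valid 𝒪 (describe order)
  describe-valid [] _ _ _ _ = []
  describe-valid (h ∷ order) (h≢ ∷ unique) (later ∷ top) sub cl = cons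
    (λ h∈ → All¬⇒¬Any h≢ (subst (h ∈ˡ_) (names-describe order) h∈))
    (λ {p} p∈ → subst (p ∈ˡ_) (sym (names-describe order)) (head-closed (cl (here refl) (sub (here refl) , p∈)) p∈))
    (admissible (sub (here refl)))
    (describe-valid order unique top (sub ∘ there) tail-closed)
    where
    head-closed : ∀ {p} → p ∈ˡ h ∷ order → p ∈ˡ predecessors (gate h) → p ∈ˡ order
    head-closed (here refl) p∈ = ⊥-elim (acyclic h [ sub (here refl) , p∈ ])
    head-closed (there p∈)  _  = p∈
    tail-closed : ∀ {g p} → g ∈ˡ order → Edge p g → p ∈ˡ order
    tail-closed g∈ e with cl (there g∈) e
    ... | here refl = ⊥-elim (All.lookup later g∈ e)
    ... | there p∈  = p∈

-- Circuits built from valid gate lists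

gateOf : Gates → ℕ → Gate
gateOf []             g = input 0
gateOf ((h , γ) ∷ gs) g with g ≟ h
... | yes _ = γ
... | no _  = gateOf gs g

-- The number of entries from the gate to the end of the list. It drops from a gate to its
-- predecessors, which excludes cycles and shows that the list is in reverse topological order.
rank : Gates → ℕ → ℕ
rank []             g = 0
rank ((h , γ) ∷ gs) g with g ≟ h
... | yes _ = suc (length gs)
... | no _  = rank gs g

rank≤ : ∀ gs g → rank gs g ≤ length gs
rank≤ []             g = z≤n
rank≤ ((h , γ) ∷ gs) g with g ≟ h
... | yes _ = ≤-refl
... | no _  = m≤n⇒m≤1+n (rank≤ gs g)

gateOf-head : ∀ h γ gs → gateOf ((h , γ) ∷ gs) h ≡ γ
gateOf-head h γ gs with h ≟ h
... | yes _  = refl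
... | no h≢h = ⊥-elim (h≢h refl)

rank-head : ∀ h γ gs → rank ((h , γ) ∷ gs) h ≡ suc (length gs)
rank-head h γ gs with h ≟ h
... | yes _  = refl
... | no h≢h = ⊥-elim (h≢h refl)

gateOf-tail : ∀ {g h γ} gs → g ≢ h → gateOf ((h , γ) ∷ gs) g ≡ gateOf gs g
gateOf-tail {g} {h} gs g≢h with g ≟ h
... | yes g≡h = ⊥-elim (g≢h g≡h)
... | no _    = refl

rank-tail : ∀ {g h} γ gs → g ≢ h → rank ((h , γ) ∷ gs) g ≡ rank gs g
rank-tail {g} {h} γ gs g≢h with g ≟ h
... | yes g≡h = ⊥-elim (g≢h g≡h)
... | no _    = refl

module _ {𝒪 : List Operation} where

  edge : ∀ {gs} → Valid 𝒪 gs → ∀ {g p} → g ∈ˡ names gs → p ∈ˡ predecessors (gateOf gs g) →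
         p ∈ˡ names gs × rank gs p < rank gs g
  edge {(h , γ) ∷ gs} (cons h∉ cl _ valid) {g} {p} g∈ p∈ with g ≟ h
  ... | yes refl = there (cl p∈) , s≤s (≤-trans (≤-reflexive (rank-tail γ gs λ { refl → h∉ (cl p∈) })) (rank≤ gs p))
  edge {(h , γ) ∷ gs} (cons h∉ cl _ valid) {g} {p} (here g≡h) p∈ | no g≢h = ⊥-elim (g≢h g≡h)
  edge {(h , γ) ∷ gs} (cons h∉ cl _ valid) {g} {p} (there g∈) p∈ | no g≢h with edge valid g∈ p∈
  ... | p∈′ , p< = there p∈′ , ≤-trans (≤-reflexive (cong suc (rank-tail γ gs λ { refl → h∉ p∈′ }))) p<

  valid-unique : ∀ {gs} → Valid 𝒪 gs → Unique (names gs)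
  valid-unique []                 = []
  valid-unique (cons h∉ _ _ valid) = ¬Any⇒All¬ _ h∉ ∷ valid-unique valid

  valid-admissible : ∀ {gs} → Valid 𝒪 gs → ∀ {g} → g ∈ˡ names gs → Admissible 𝒪 (gateOf gs g)
  valid-admissible {(h , γ) ∷ gs} (cons _ _ adm valid) {g} g∈ with g ≟ h
  ... | yes _ = adm
  valid-admissible {(h , γ) ∷ gs} (cons _ _ adm valid) {g} (here g≡h) | no g≢h = ⊥-elim (g≢h g≡h)
  valid-admissible {(h , γ) ∷ gs} (cons _ _ adm valid) {g} (there g∈) | no _   = valid-admissible valid g∈

  Before : Gates → ℕ → ℕ → Set
  Before gs g h = g ∈ˡ names gs × h ∈ˡ names gs × rank gs h < rank gs g

  decreasing : ∀ {gs} → Valid 𝒪 gs → AllPairs (Before gs) (names gs)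
  decreasing [] = []
  decreasing {(h , γ) ∷ gs} (cons h∉ _ _ valid) =
    All.tabulate (λ {g} g∈ → here refl , there g∈ ,
      ≤-trans (s≤s (≤-trans (≤-reflexive (rank-tail γ gs λ { refl → h∉ g∈ })) (rank≤ gs g)))
          (≤-reflexive (sym (rank-head h γ gs)))) ∷
    AllPairs.map (λ { (x∈ , y∈ , lt) → there x∈ , there y∈ ,
        subst₂ _<_ (sym (rank-tail γ gs λ { refl → h∉ y∈ })) (sym (rank-tail γ gs λ { refl → h∉ x∈ })) lt })
      (decreasing valid)

  describe-gateOf : ∀ {gs} → Valid 𝒪 gs → List.map (λ g → g , gateOf gs g) (names gs) ≡ gs
  describe-gateOf [] = refl
  describe-gateOf {(h , γ) ∷ gs} (cons h∉ _ _ valid) = cong₂ _∷_ (cong (h ,_) (gateOf-head h γ gs))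
    (trans (map-cong-local (All.tabulate λ {g} g∈ → cong (g ,_) (gateOf-tail gs λ { refl → h∉ g∈ })))
        (describe-gateOf valid))

  module _ {gs : Gates} (valid : Valid 𝒪 gs) {out : ℕ} (out∈ : out ∈ˡ names gs) where

    private
      E : ℕ → ℕ → Set
      E p g = g ∈ˡ names gs × p ∈ˡ predecessors (gateOf gs g)

      E⇒< : ∀ {p g} → TransClosure E p g → rank gs p < rank gs g
      E⇒< [ g∈ , p∈ ]     = proj₂ (edge valid g∈ p∈)
      E⇒< ((g∈ , p∈) ∷ c) = <-trans (proj₂ (edge valid g∈ p∈)) (E⇒< c)

    circuit : Circuit 𝒪
    circuit = record
      { V          = names gs
      ; V-unique   = valid-unique valid
      ; gate       = gateOf gs
      ; output     = out
      ; output∈V   = out∈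
      ; admissible = valid-admissible valid
      ; closed     = λ g∈ p∈ → proj₁ (edge valid g∈ p∈)
      ; acyclic    = λ g c → <-irrefl refl (E⇒< c)
      }

    circuit-encoding : EncodesCircuit circuit (encodeℕ out ++ encodeList encodeGate gs)
    circuit-encoding = subst (λ gs′ → EncodesCircuit circuit (encodeℕ out ++ encodeList encodeGate gs′))
        (describe-gateOf valid)
      (encoding ↭-refl (AllPairs.map (λ { (_ , _ , lt) (h∈ , p∈) → <-asym lt (proj₂ (edge valid h∈ p∈)) })
          (decreasing valid)))

    circuit-result : ∀ {v} → Den gs out v → result circuit v
    circuit-result {v} d = proj₁ (Den⇔result circuit (names gs)
        (subst (Valid 𝒪) (sym (describe-gateOf valid)) valid)
        (Circuit.Edge-wellFounded circuit out) out∈ out∈ v)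
      (subst (λ gs′ → Den gs′ out v) (sym (describe-gateOf valid)) d)

  -- `MC` without accessibility and permutations, in a form that a single reading from left to right
  -- can verify.
  GateListCode : List Bool → Set
  GateListCode w = ∃[ gs ] ∃₂ λ out b → Valid 𝒪 gs × Den gs out b ×
                   w ≡ encodeℕ out ++ encodeList encodeGate gs ++ encodeℕ b

  code⇒MC : ∀ {w} → GateListCode w → MC 𝒪 w
  code⇒MC (gs , out , b , valid , d , refl) = circuit valid (Den⇒∈ gs d) , _ , b ,
      circuit-encoding valid (Den⇒∈ gs d) ,
    sym (++-assoc (encodeℕ out) (encodeList encodeGate gs) (encodeℕ b)) , circuit-result valid (Den⇒∈ gs d) d

  MC⇒code : ∀ {w} → MC 𝒪 w → GateListCode w
  MC⇒code (C , _ , b , encoding {order} perm top , refl , r) = describe C order , output , b , valid ,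
    proj₂ (Den⇔result C order valid (Edge-wellFounded output) output∈V (∈-resp-↭ (↭-sym perm) output∈V) b) r ,
    ++-assoc (encodeℕ output) (encodeList encodeGate (describe C order)) (encodeℕ b)
    where
    open Circuit C
    valid : Valid 𝒪 (describe C order)
    valid = describe-valid C order (Unique-resp-↭ (↭⇒↭ₛ (↭-sym perm)) V-unique) top (∈-resp-↭ perm)
      λ { g∈ (g∈V , p∈) → ∈-resp-↭ (↭-sym perm) (closed g∈V p∈) }

-- All values of a gate are below 2 ^ depth: an arithmetic gate at most
-- doubles the lengths.
depth : Gates → ℕ
depth []                        = 1
depth ((_ , input n) ∷ gs)      = length (digits n) + depth gs
depth ((_ , complement _) ∷ gs) = depth gs
depth ((_ , binary _ _ _) ∷ gs) = 2 * depth gs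

1≤depth : ∀ gs → 1 ≤ depth gs
1≤depth []                        = ≤-refl
1≤depth ((_ , input n) ∷ gs)      = ≤-trans (1≤depth gs) (m≤n+m _ (length (digits n)))
1≤depth ((_ , complement _) ∷ gs) = 1≤depth gs
1≤depth ((_ , binary _ _ _) ∷ gs) = ≤-trans (1≤depth gs) (m≤m+n _ _)

private
  2^2d : ∀ d → 2 ^ (2 * d) ≡ 2 ^ d * 2 ^ d
  2^2d d = trans (cong (λ e → 2 ^ (d + e)) (+-identityʳ d)) (^-distribˡ-+-* 2 d d)

  ≤2^2d : ∀ d {v} → v < 2 ^ d → v < 2 ^ (2 * d)
  ≤2^2d d v< = ≤-trans v< (^-monoʳ-≤ 2 (m≤m+n d _))

  apply-bound : ∀ σ {d A B} → 1 ≤ d → (∀ {v} → A v → v < 2 ^ d) → (∀ {v} → B v → v < 2 ^ d) →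
                ∀ {v} → apply σ A B v → v < 2 ^ (2 * d)
  apply-bound union {d} _ f g (inj₁ a) = ≤2^2d d (f a)
  apply-bound union {d} _ f g (inj₂ b) = ≤2^2d d (g b)
  apply-bound intersection {d} _ f g (a , _) = ≤2^2d d (f a)
  apply-bound sum {d} 1≤d f g (a , b , Aa , Bb , refl) = begin
    suc (a + b)       <⟨ s≤s (≤-reflexive (sym (+-suc a b))) ⟩
    suc a + suc b     ≤⟨ +-mono-≤ (f Aa) (g Bb) ⟩
    2 ^ d + 2 ^ d     ≡⟨ cong (2 ^ d +_) (+-identityʳ (2 ^ d)) ⟨
    -- A sum needs one more digit, and `1 ≤ d` lets the doubling cover it. This is why `depth` is 1
    -- for the empty list.
    2 ^ suc d         ≤⟨ ^-monoʳ-≤ 2 (+-mono-≤ 1≤d (≤-reflexive (sym (+-identityʳ d)))) ⟩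
    2 ^ (2 * d)       ∎
    where open ≤-Reasoning
  apply-bound product {d} _ f g (a , b , Aa , Bb , refl) =
    subst (a * b <_) (sym (2^2d d)) (*-mono-< (f Aa) (g Bb))
  apply-bound quotient {d} _ f g {v} (a , zero , Aa , Bb , b≢0 , refl) = ⊥-elim (b≢0 refl)
  apply-bound quotient {d} _ f g {v} (a , suc b , Aa , Bb , _ , refl) =
    ≤2^2d d (≤-<-trans (m≤m*n v (suc b)) (f Aa))

Den-bound : ∀ {𝒪} → complement ∉ 𝒪 → ∀ {gs} → Valid 𝒪 gs → ∀ {g v} → Den gs g v → v < 2 ^ depth gs
Den-bound c∉ {(_ , input n) ∷ gs} _ (inj₁ (_ , refl)) =
  ≤-trans (<2^length-digits n) (^-monoʳ-≤ 2 (m≤m+n (length (digits n)) (depth gs)))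
Den-bound c∉ {(_ , complement _) ∷ gs} (cons _ _ c∈ _) (inj₁ _) = ⊥-elim (c∉ c∈)
Den-bound c∉ {(_ , binary σ p q) ∷ gs} (cons _ _ _ valid) (inj₁ (_ , e)) =
  apply-bound σ (1≤depth gs) (Den-bound c∉ valid) (Den-bound c∉ valid) e
Den-bound c∉ {(_ , input n) ∷ gs} (cons _ _ _ valid) (inj₂ (_ , d)) =
  ≤-trans (Den-bound c∉ valid d) (^-monoʳ-≤ 2 (m≤n+m (depth gs) (length (digits n))))
Den-bound c∉ {(_ , complement _) ∷ gs} (cons _ _ c∈ _) (inj₂ _) = ⊥-elim (c∉ c∈)
Den-bound c∉ {(_ , binary _ _ _) ∷ gs} (cons _ _ _ valid) (inj₂ (_ , d)) = ≤2^2d (depth gs) (Den-bound c∉ valid d)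

code : Gates → List Bool
code = concatMap λ g → true ∷ encodeGate g

length-digits≤encodeℕ : ∀ n → length (digits n) ≤ length (encodeℕ n)
length-digits≤encodeℕ n = begin
  length (digits n)         ≤⟨ m≤m*n (length (digits n)) 2 ⟩
  length (digits n) * 2     ≤⟨ n≤1+n _ ⟩
  1 + length (digits n) * 2 ≡⟨ length-frame (digits n) ⟨
  length (encodeℕ n)        ∎
  where open ≤-Reasoning

input≤code : ∀ g n → length (digits n) ≤ length (encodeGate (g , input n))
input≤code g n = begin
  length (digits n)                                              ≤⟨ length-digits≤encodeℕ n ⟩
  length (encodeℕ n)                                             ≤⟨ m≤m+n _ 1 ⟩
  length (encodeℕ n) + 1                                         ≡⟨ length-++ (encodeℕ n) ⟨
  length (encodeℕ n ++ false ∷ [])                               ≤⟨ n≤1+n _ ⟩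
  length (encodeLabel (input n) ++ false ∷ [])                   ≤⟨ m≤n+m _ (length (encodeℕ g)) ⟩
  length (encodeℕ g) + length (encodeLabel (input n) ++ false ∷ []) ≡⟨ length-++ (encodeℕ g) ⟨
  length (encodeGate (g , input n))                              ∎
  where open ≤-Reasoning

name≤code : ∀ g γ → length (digits g) ≤ length (encodeGate (g , γ))
name≤code g γ = ≤-trans (length-digits≤encodeℕ g) (≤-trans (m≤m+n _ _) (≤-reflexive (sym (length-++ (encodeℕ g)))))

code-∷ : ∀ g gs → length (code (g ∷ gs)) ≡ suc (length (encodeGate g) + length (code gs))
code-∷ g gs = cong suc (length-++ (encodeGate g))

length≤code : ∀ gs → length gs ≤ length (code gs)
length≤code []       = z≤n
length≤code (g ∷ gs) = ≤-trans (s≤s (≤-trans (length≤code gs) (m≤n+m _ _))) (≤-reflexive (sym (code-∷ g gs)))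

-- The bit that announces a gate pays for one doubling. An input constant is no longer than its
-- code, and its length and the depth of the tail are each at most the same power of 2, so their sum
-- also costs one doubling.
depth≤ : ∀ gs → depth gs ≤ 2 ^ length (code gs)
depth≤ [] = ≤-refl
depth≤ ((g , γ) ∷ gs) = subst (λ n → depth ((g , γ) ∷ gs) ≤ 2 ^ n) (sym (code-∷ (g , γ) gs)) (bound γ)
  where
  open ≤-Reasoning
  double : ∀ k l → 2 * 2 ^ l ≤ 2 ^ suc (k + l)
  double k l = ^-monoʳ-≤ 2 (s≤s (m≤n+m l k))
  bound : ∀ γ → depth ((g , γ) ∷ gs) ≤ 2 ^ suc (length (encodeGate (g , γ)) + length (code gs))
  bound (input n) = begin
    length (digits n) + depth gs        ≤⟨ +-mono-≤
        (<⇒≤ (≤-trans (n<2^n _) (^-monoʳ-≤ 2 (≤-trans (input≤code g n) (m≤m+n e l)))))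
        (≤-trans (depth≤ gs) (^-monoʳ-≤ 2 (m≤n+m l e))) ⟩
    2 ^ (e + l) + 2 ^ (e + l)           ≡⟨ cong (2 ^ (e + l) +_) (+-identityʳ _) ⟨
    2 ^ suc (e + l)                     ∎
    where
    e = length (encodeGate (g , input n))
    l = length (code gs)
  bound (complement p) = ≤-trans (depth≤ gs) (^-monoʳ-≤ 2
      (≤-trans (m≤n+m _ (length (encodeGate (g , complement p)))) (n≤1+n _)))
  bound (binary σ p q) = ≤-trans (*-monoʳ-≤ 2 (depth≤ gs)) (double (length (encodeGate (g , binary σ p q))) _)

-- Regular programs

module Programs where

  infix  9 ‵_
  infixr 6 _∙_
  infixr 5 _∪_
  infix  8 _*

  -- Regular expressions over atoms, read as nondeterministic programs. Choice is a family indexed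
  -- by a bit, so that a branch can mention the bit: this is how an unknown bit is popped and then
  -- reused.
  data Prog (A : Set) : Set where
    ‵_      : A → Prog A
    ε       : Prog A
    _∙_     : Prog A → Prog A → Prog A
    ⋃       : (Bool → Prog A) → Prog A
    _*      : Prog A → Prog A

  either : ∀ {A} → Prog A → Prog A → Bool → Prog A
  either P Q false = P
  either P Q true  = Q

  _∪_ : ∀ {A} → Prog A → Prog A → Prog A
  P ∪ Q = ⋃ (either P Q)

  private variable
    A B S T : Set
    P Q     : Prog A
    s t u   : S
    m n k   : ℕ

  Semantics : Set → Set → Set₁
  Semantics A S = A → S → S → Set

  -- The index counts the transitions of the automaton constructed below.
  data Run {A S : Set} (⟦_⟧ : Semantics A S) : Prog A → S → S → ℕ → Set where
    atom : ∀ {a s t} → ⟦ a ⟧ s t → Run ⟦_⟧ (‵ a) s t 1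
    skip : ∀ {s} → Run ⟦_⟧ ε s s 1
    seq  : ∀ {P Q s t u m n} → Run ⟦_⟧ P s t m → Run ⟦_⟧ Q t u n → Run ⟦_⟧ (P ∙ Q) s u (m + n)
    alt  : ∀ {P s t n} b → Run ⟦_⟧ (P b) s t n → Run ⟦_⟧ (⋃ P) s t (suc n)
    stop : ∀ {P s} → Run ⟦_⟧ (P *) s s 1
    iter : ∀ {P s t u m n} → Run ⟦_⟧ P s t m → Run ⟦_⟧ (P *) t u n → Run ⟦_⟧ (P *) s u (suc (m + n))

  Run≤ : Semantics A S → Prog A → S → S → ℕ → Set
  Run≤ ⟦_⟧ P s t n = ∃[ m ] Run ⟦_⟧ P s t m × m ≤ n

  module _ {⟦_⟧ : Semantics A S} where

    atom≤ : ∀ {a} → ⟦ a ⟧ s t → Run≤ ⟦_⟧ (‵ a) s t 1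
    atom≤ r = _ , atom r , ≤-refl

    skip≤ : Run≤ ⟦_⟧ ε s s 1
    skip≤ = _ , skip , ≤-refl

    infixr 6 _⨾_
    _⨾_ : Run≤ ⟦_⟧ P s t m → Run≤ ⟦_⟧ Q t u n → Run≤ ⟦_⟧ (P ∙ Q) s u (m + n)
    (_ , r , p) ⨾ (_ , r′ , p′) = _ , seq r r′ , +-mono-≤ p p′

    alt≤ : ∀ {P : Bool → Prog A} b → Run≤ ⟦_⟧ (P b) s t n → Run≤ ⟦_⟧ (⋃ P) s t (suc n)
    alt≤ b (_ , r , p) = _ , alt b r , s≤s p

    stop≤ : Run≤ ⟦_⟧ (P *) s s 1
    stop≤ = _ , stop , ≤-refl

    iter≤ : Run≤ ⟦_⟧ P s t m → Run≤ ⟦_⟧ (P *) t u n → Run≤ ⟦_⟧ (P *) s u (suc (m + n))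
    iter≤ (_ , r , p) (_ , r′ , p′) = _ , iter r r′ , s≤s (+-mono-≤ p p′)

    weaken : m ≤ n → Run≤ ⟦_⟧ P s t m → Run≤ ⟦_⟧ P s t n
    weaken m≤n (_ , r , p) = _ , r , ≤-trans p m≤n

  -- Refinement of atoms by programs

  refine : (A → Prog B) → Prog A → Prog B
  refine f (‵ a)   = f a
  refine f ε       = ε
  refine f (P ∙ Q) = refine f P ∙ refine f Q
  refine f (⋃ P)   = ⋃ λ b → refine f (P b)
  refine f (P *)   = refine f P *

  module _ {⟦_⟧ᵃ : Semantics A S} {⟦_⟧ᵇ : Semantics B T}
           (f : A → Prog B) (R : S → T → Set) where

    module _ (sound : ∀ a {s t t′ n} → R s t → Run ⟦_⟧ᵇ (f a) t t′ n →
                      ∃[ s′ ] ⟦ a ⟧ᵃ s s′ × R s′ t′) where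

      -- No relation between the lengths is claimed: acceptance depends only on what can be reached,
      -- and the clock bounds all runs.
      refine-sound : ∀ P {s t t′ n} → R s t → Run ⟦_⟧ᵇ (refine f P) t t′ n →
                     ∃₂ λ s′ m → Run ⟦_⟧ᵃ P s s′ m × R s′ t′
      refine-sound* : ∀ P {s t t′ n} → R s t → Run ⟦_⟧ᵇ (refine f P *) t t′ n →
                      ∃₂ λ s′ m → Run ⟦_⟧ᵃ (P *) s s′ m × R s′ t′

      refine-sound (‵ a) r x with sound a r x
      ... | _ , y , r′ = _ , _ , atom y , r′
      refine-sound ε r skip = _ , _ , skip , r
      refine-sound (P ∙ Q) r (seq x y) with refine-sound P r x
      ... | _ , _ , x′ , r′ with refine-sound Q r′ y
      ... | _ , _ , y′ , r″ = _ , _ , seq x′ y′ , r″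
      refine-sound (⋃ P) r (alt b x) with refine-sound (P b) r x
      ... | _ , _ , x′ , r′ = _ , _ , alt b x′ , r′
      refine-sound (P *) r x = refine-sound* P r x

      refine-sound* P r stop = _ , _ , stop , r
      refine-sound* P r (iter x y) with refine-sound P r x
      ... | _ , _ , x′ , r′ with refine-sound* P r′ y
      ... | _ , _ , y′ , r″ = _ , _ , iter x′ y′ , r″

    module _ (F : ℕ) (1≤F : 1 ≤ F)
             (complete : ∀ a {s s′ t} → R s t → ⟦ a ⟧ᵃ s s′ →
                         ∃[ t′ ] Run≤ ⟦_⟧ᵇ (f a) t t′ F × R s′ t′) where

      private
        step : ∀ {k} n → k ≤ n * F → suc k ≤ suc n * F
        step n p = +-mono-≤ 1≤F p

        join : ∀ {j k} m n → j ≤ m * F → k ≤ n * F → j + k ≤ (m + n) * F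
        join m n p q = ≤-trans (+-mono-≤ p q) (≤-reflexive (sym (*-distribʳ-+ F m n)))

      -- An atom costs at most `F`, and every other transition remains a single one, which `1 ≤ F`
      -- allows to be charged as `F`.
      refine-complete : ∀ {P s s′ t n} → R s t → Run ⟦_⟧ᵃ P s s′ n →
                        ∃[ t′ ] Run≤ ⟦_⟧ᵇ (refine f P) t t′ (n * F) × R s′ t′
      refine-complete r (atom x) with complete _ r x
      ... | _ , (_ , y , p) , r′ = _ , (_ , y , ≤-trans p (≤-reflexive (sym (+-identityʳ F)))) , r′
      refine-complete r skip = _ , (_ , skip , step 0 z≤n) , r
      refine-complete r (seq {m = m} {n} x y) with refine-complete r x
      ... | _ , (_ , x′ , p) , r′ with refine-complete r′ y
      ... | _ , (_ , y′ , q) , r″ = _ , (_ , seq x′ y′ , join m n p q) , r″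
      refine-complete r (alt {n = n} b x) with refine-complete r x
      ... | _ , (_ , x′ , p) , r′ = _ , (_ , alt b x′ , step n p) , r′
      refine-complete r stop = _ , (_ , stop , step 0 z≤n) , r
      refine-complete r (iter {m = m} {n} x y) with refine-complete r x
      ... | _ , (_ , x′ , p) , r′ with refine-complete r′ y
      ... | _ , (_ , y′ , q) , r″ = _ , (_ , iter x′ y′ , step (m + n) (join m n p q)) , r″

  -- Thompson's construction.  Positions are the states other than the exit,
  -- which is represented by nothing; a transition without an atom is silent.
  Pos : Prog A → Set
  Pos (‵ a)   = ⊤
  Pos ε       = ⊤
  Pos (P ∙ Q) = Pos P ⊎ Pos Q
  Pos (⋃ P)   = Maybe (Pos (P false) ⊎ Pos (P true))
  Pos (P *)   = Maybe (Pos P)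

  entry : (P : Prog A) → Pos P
  entry (‵ a)   = tt
  entry ε       = tt
  entry (P ∙ Q) = inj₁ (entry P)
  entry (⋃ P)   = nothing
  entry (P *)   = nothing

  along : (Q : Prog A) → Maybe (Pos P) → Maybe (Pos P ⊎ Pos Q)
  along Q (just p) = just (inj₁ p)
  along Q nothing  = just (inj₂ (entry Q))

  next : (P : Prog A) → Pos P → List (Maybe A × Maybe (Pos P))
  next (‵ a)   _               = (just a , nothing) ∷ []
  next ε       _               = (nothing , nothing) ∷ []
  next (P ∙ Q) (inj₁ p)        = List.map (map₂ (along Q)) (next P p)
  next (P ∙ Q) (inj₂ q)        = List.map (map₂ (Maybe.map inj₂)) (next Q q)
  next (⋃ P)   nothing         = (nothing , just (just (inj₁ (entry (P false))))) ∷
                                 (nothing , just (just (inj₂ (entry (P true))))) ∷ []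
  next (⋃ P)   (just (inj₁ p)) = List.map (map₂ (Maybe.map λ p′ → just (inj₁ p′))) (next (P false) p)
  next (⋃ P)   (just (inj₂ p)) = List.map (map₂ (Maybe.map λ p′ → just (inj₂ p′))) (next (P true) p)
  next (P *)   nothing         = (nothing , just (just (entry P))) ∷ (nothing , nothing) ∷ []
  -- Leaving P means returning to the head of the loop.
  next (P *)   (just p)        = List.map (map₂ just) (next P p)

  module _ {A S : Set} (⟦_⟧ : Semantics A S) where

    Label : Maybe A → S → S → Set
    Label nothing  s t = s ≡ t
    Label (just a) s t = ⟦ a ⟧ s t

    infixr 5 _∷_
    data Path (P : Prog A) : Maybe (Pos P) → S → S → ℕ → Set where
      exit : ∀ {s} → Path P nothing s s 0
      _∷_  : ∀ {p a x s t u n} → (a , x) ∈ˡ next P p × Label a s t →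
             Path P x t u n → Path P (just p) s u (suc n)

    module _ {P′ : Prog A} where

      -- The automaton of a compound contains those of its parts up to renaming `f`. A path through
      -- a part continues in the whole at the place to which `f` sends the exit.
      embed : {P : Prog A} (f : Maybe (Pos P) → Maybe (Pos P′)) →
              (∀ p → ∃[ p′ ] f (just p) ≡ just p′ ×
                     ∀ {a x} → (a , x) ∈ˡ next P p → (a , f x) ∈ˡ next P′ p′) →
              ∀ {x s t u m n} → Path P x s t m → Path P′ (f nothing) t u n →
              Path P′ (f x) s u (m + n)
      embed f h exit π′ = π′
      embed f h (_∷_ {p = p} (x∈ , l) π) π′ with f (just p) | h p
      ... | _ | p′ , refl , g = (g x∈ , l) ∷ embed f h π π′

    run⇒path : ∀ {P s t n} → Run ⟦_⟧ P s t n → Path P (just (entry P)) s t n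
    run⇒path (atom x) = (here refl , x) ∷ exit
    run⇒path skip = (here refl , refl) ∷ exit
    run⇒path (seq {P} {Q} r r′) =
      embed (along Q) (λ p → _ , refl , ∈-map⁺ _) (run⇒path r)
        (subst (Path _ _ _ _) (+-identityʳ _)
          (embed (Maybe.map inj₂) (λ q → _ , refl , ∈-map⁺ _) (run⇒path r′) exit))
    run⇒path (alt false r) = (here refl , refl) ∷
      subst (Path _ _ _ _) (+-identityʳ _)
        (embed (Maybe.map λ p′ → just (inj₁ p′)) (λ p → _ , refl , ∈-map⁺ _) (run⇒path r) exit)
    run⇒path (alt true r) = (there (here refl) , refl) ∷
      subst (Path _ _ _ _) (+-identityʳ _)
        (embed (Maybe.map λ p′ → just (inj₂ p′)) (λ p → _ , refl , ∈-map⁺ _) (run⇒path r) exit)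
    run⇒path stop = (there (here refl) , refl) ∷ exit
    run⇒path (iter {P} r r′) = (here refl , refl) ∷
      embed just (λ p → _ , refl , ∈-map⁺ _) (run⇒path r) (run⇒path r′)

    Runs : Prog A → S → S → Set
    Runs P s t = ∃[ n ] Run ⟦_⟧ P s t n

    -- What remains to be done from a position, as a relation defined on the program. It lets a path
    -- be read back into a run from its end, one transition at a time, although a path may leave and
    -- re-enter loops anywhere.
    Rest : (P : Prog A) → Pos P → S → S → Set
    Rest (‵ a)   _               s u = ⟦ a ⟧ s u
    Rest ε       _               s u = s ≡ u
    Rest (P ∙ Q) (inj₁ p)        s u = ∃[ t ] Rest P p s t × Runs Q t u
    Rest (P ∙ Q) (inj₂ q)        s u = Rest Q q s u
    Rest (⋃ P)   nothing         s u = Runs (⋃ P) s u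
    Rest (⋃ P)   (just (inj₁ p)) s u = Rest (P false) p s u
    Rest (⋃ P)   (just (inj₂ p)) s u = Rest (P true) p s u
    Rest (P *)   nothing         s u = Runs (P *) s u
    Rest (P *)   (just p)        s u = ∃[ t ] Rest P p s t × Runs (P *) t u

    Rest? : (P : Prog A) → Maybe (Pos P) → S → S → Set
    Rest? P nothing  s u = s ≡ u
    Rest? P (just p) s u = Rest P p s u

    rest-entry : ∀ P {s u} → Rest P (entry P) s u → Runs P s u
    rest-entry (‵ a)   r = _ , atom r
    rest-entry ε       refl = _ , skip
    rest-entry (P ∙ Q) (_ , r , _ , r′) = _ , seq (proj₂ (rest-entry P r)) r′
    rest-entry (⋃ P)   r = r
    rest-entry (P *)   r = r

    rest-step : ∀ P p {a x s t u} → (a , x) ∈ˡ next P p → Label a s t → Rest? P x t u → Rest P p s u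
    rest-step (‵ a) p (here refl) l refl = l
    rest-step ε p (here refl) l refl = l
    rest-step (P ∙ Q) (inj₁ p) x∈ l r with ∈-map⁻ _ x∈
    ... | (_ , nothing) , y∈ , refl = _ , rest-step P p y∈ l refl , rest-entry Q r
    ... | (_ , just _)  , y∈ , refl = _ , rest-step P p y∈ l (proj₁ (proj₂ r)) , proj₂ (proj₂ r)
    rest-step (P ∙ Q) (inj₂ q) x∈ l r with ∈-map⁻ _ x∈
    ... | (_ , nothing) , y∈ , refl = rest-step Q q y∈ l r
    ... | (_ , just _)  , y∈ , refl = rest-step Q q y∈ l r
    rest-step (⋃ P) nothing (here refl) refl r = _ , alt false (proj₂ (rest-entry (P false) r))
    rest-step (⋃ P) nothing (there (here refl)) refl r = _ , alt true (proj₂ (rest-entry (P true) r))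
    rest-step (⋃ P) (just (inj₁ p)) x∈ l r with ∈-map⁻ _ x∈
    ... | (_ , nothing) , y∈ , refl = rest-step (P false) p y∈ l r
    ... | (_ , just _)  , y∈ , refl = rest-step (P false) p y∈ l r
    rest-step (⋃ P) (just (inj₂ p)) x∈ l r with ∈-map⁻ _ x∈
    ... | (_ , nothing) , y∈ , refl = rest-step (P true) p y∈ l r
    ... | (_ , just _)  , y∈ , refl = rest-step (P true) p y∈ l r
    rest-step (P *) nothing (here refl) refl (_ , r , _ , r′) = _ , iter (proj₂ (rest-entry P r)) r′
    rest-step (P *) nothing (there (here refl)) refl refl = _ , stop
    rest-step (P *) (just p) x∈ l r with ∈-map⁻ _ x∈
    ... | (_ , nothing) , y∈ , refl = _ , rest-step P p y∈ l refl , r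
    ... | (_ , just _)  , y∈ , refl = _ , rest-step P p y∈ l (proj₁ (proj₂ r)) , proj₂ (proj₂ r)

    path⇒rest : ∀ {P x s u n} → Path P x s u n → Rest? P x s u
    path⇒rest exit = refl
    path⇒rest {P} ((x∈ , l) ∷ π) = rest-step P _ x∈ l (path⇒rest π)

    path⇒run : ∀ {P s t n} → Path P (just (entry P)) s t n → Runs P s t
    path⇒run {P} π = rest-entry P (path⇒rest π)

open Programs

-- Machines for stack programs

maybe-↔ : ∀ {A : Set} → Maybe A ↔ (⊤ ⊎ A)
maybe-↔ = mk↔ₛ′ (λ { nothing → inj₁ tt ; (just a) → inj₂ a })
               (λ { (inj₁ _) → nothing ; (inj₂ a) → just a })
               (λ { (inj₁ _) → refl ; (inj₂ _) → refl })
               (λ { nothing → refl ; (just _) → refl })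

⊤-finite : IsFinite ⊤
⊤-finite = 1 , ↔-sym 1↔⊤

⊎-finite : ∀ {A B} → IsFinite A → IsFinite B → IsFinite (A ⊎ B)
⊎-finite (m , f) (n , g) = m + n , ↔-sym +↔⊎ ↔-∘ (f ⊎-↔ g)

maybe-finite : ∀ {A} → IsFinite A → IsFinite (Maybe A)
maybe-finite f with ⊎-finite ⊤-finite f
... | n , g = n , g ↔-∘ maybe-↔

pos-finite : ∀ {A} (P : Prog A) → IsFinite (Pos P)
pos-finite (‵ a)   = ⊤-finite
pos-finite ε       = ⊤-finite
pos-finite (P ∙ Q) = ⊎-finite (pos-finite P) (pos-finite Q)
pos-finite (⋃ P)   = maybe-finite (⊎-finite (pos-finite (P false)) (pos-finite (P true)))
pos-finite (P *)   = maybe-finite (pos-finite P)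

module _ {A B : Set} (f : A → Maybe B) where

  ∈-mapMaybe⁺ : ∀ {x y xs} → x ∈ˡ xs → f x ≡ just y → y ∈ˡ mapMaybe f xs
  ∈-mapMaybe⁺ {x} (here refl) eq with f x | eq
  ... | just _ | refl = here refl
  ∈-mapMaybe⁺ {xs = z ∷ _} (there x∈) eq with f z
  ... | just _  = there (∈-mapMaybe⁺ x∈ eq)
  ... | nothing = ∈-mapMaybe⁺ x∈ eq

  ∈-mapMaybe⁻ : ∀ {y} xs → y ∈ˡ mapMaybe f xs → ∃[ x ] x ∈ˡ xs × f x ≡ just y
  ∈-mapMaybe⁻ (x ∷ xs) y∈ with f x in eq
  ∈-mapMaybe⁻ (x ∷ xs) y∈ | nothing with ∈-mapMaybe⁻ xs y∈
  ... | _ , x∈ , e = _ , there x∈ , e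
  ∈-mapMaybe⁻ (x ∷ xs) (here refl) | just _ = x , here refl , eq
  ∈-mapMaybe⁻ (x ∷ xs) (there y∈)  | just _ with ∈-mapMaybe⁻ xs y∈
  ... | _ , x∈ , e = _ , there x∈ , e

update² : ∀ {A : Set} {k} (xs : Vec A k) i x y → (xs [ i ]≔ x) [ i ]≔ y ≡ xs [ i ]≔ y
update² xs i x y = []≔-idempotent xs i

data StackOp : Set where
  push pop : Bool → StackOp
  empty    : StackOp

⟦_⟧ˢ : StackOp → List Bool → List Bool → Set
⟦ push b ⟧ˢ l l′ = l′ ≡ b ∷ l
⟦ pop b ⟧ˢ  l l′ = l ≡ b ∷ l′
⟦ empty ⟧ˢ  l l′ = l ≡ [] × l′ ≡ []

StackAtom : ℕ → Set
StackAtom k = Fin k × StackOp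

Stacks : ∀ k → Semantics (StackAtom k) (Vec (List Bool) k)
Stacks k (i , o) σ σ′ = ∃[ l ] ⟦ o ⟧ˢ (lookup σ i) l × σ′ ≡ σ [ i ]≔ l

-- The blank, two bits, the leaf of the clock, and its digits from 0 to `B`.
Symbol : ℕ → Set
Symbol B = Fin (5 + B)

pattern ␣       = zero
pattern bitˢ₀   = suc zero
pattern bitˢ₁   = suc (suc zero)
pattern leaf    = suc (suc (suc zero))
pattern digit d = suc (suc (suc (suc d)))

-- The clock makes its head walk over all paths of the full B-ary tree whose
-- depth is the number of cells: a digit is the number of subtrees still to
-- be visited below a cell.  It stops when it leaves the tape to the left.
module Clock (B : ℕ) where

  Full : Fin (suc B)
  Full = fromℕ B

  clock : Symbol B → Maybe (Symbol B × Move)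
  clock ␣               = nothing
  clock bitˢ₀           = nothing
  clock bitˢ₁           = nothing
  clock leaf            = just (leaf , left)
  clock (digit zero)    = just (digit Full , left)
  clock (digit (suc d)) = just (digit (inject₁ d) , right)

  -- Steps from entering a subtree until leaving it: each of the `B` excursions takes one step down
  -- and a visit below, and a last step restores the digit.
  visit : ℕ → ℕ
  visit zero    = 1
  visit (suc m) = suc (B * suc (visit m))

  -- Steps until the head falls off the tape. The list holds the digit under the head and those to
  -- its left, nearest first; `m` digits lie between the head and the leaf.
  above : ℕ → List (Fin (suc B)) → ℕ
  above m []       = 0
  above m (d ∷ ds) = suc (toℕ d * suc (visit m)) + above (suc m) ds

  total : ℕ → ℕ
  total n = suc (above 0 (replicate n Full))

  B^n≤visit : ∀ n → B ^ n ≤ visit n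
  B^n≤visit zero    = ≤-refl
  B^n≤visit (suc n) = m≤n⇒m≤1+n (*-monoʳ-≤ B (m≤n⇒m≤1+n (B^n≤visit n)))

  above-suc : ∀ m n → above m (replicate (suc n) Full) ≡ visit (suc m) + above (suc m) (replicate n Full)
  above-suc m n = cong (λ d → suc (d * suc (visit m)) + above (suc m) (replicate n Full)) (toℕ-fromℕ B)

  -- The walk starts at the leaf while all digits are still `Full`, so the descent that led there
  -- has not been charged. Starting at the bottom therefore loses nothing against a visit of the
  -- whole tree.
  visit≤above : ∀ m n → visit (m + n) ≤ above m (replicate n Full) + visit m
  visit≤above m zero    = ≤-reflexive (cong visit (+-identityʳ m))
  visit≤above m (suc n) = begin
    visit (m + suc n)                                    ≡⟨ cong visit (+-suc m n) ⟩
    visit (suc m + n)                                    ≤⟨ visit≤above (suc m) n ⟩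
    above (suc m) (replicate n Full) + visit (suc m)     ≡⟨ +-comm _ (visit (suc m)) ⟩
    visit (suc m) + above (suc m) (replicate n Full)     ≡⟨ above-suc m n ⟨
    above m (replicate (suc n) Full)                     ≤⟨ m≤m+n _ _ ⟩
    above m (replicate (suc n) Full) + visit m           ∎
    where open ≤-Reasoning

  B^n≤total : ∀ n → B ^ n ≤ total n
  B^n≤total n = ≤-trans (B^n≤visit n) (≤-trans (visit≤above 0 n) (≤-reflexive (+-comm _ 1)))

  -- With `v = suc (visit m)` the next visit takes `1 + B * v` steps, and
  -- `3 + 2 * B * v ≤ v * (4 + 2 * B)`. This is the source of the base `4 + 2 * B`.
  above≤ : ∀ m n → above m (replicate n Full) ≤ suc (visit m) * (4 + 2 * B) ^ n
  above≤ m zero    = z≤n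
  above≤ m (suc n) = begin
    above m (replicate (suc n) Full)                     ≡⟨ above-suc m n ⟩
    visit (suc m) + above (suc m) (replicate n Full)     ≤⟨ +-monoʳ-≤ (visit (suc m)) (above≤ (suc m) n) ⟩
    visit (suc m) + suc (visit (suc m)) * E
        ≤⟨ +-monoˡ-≤ _ (m≤m*n (visit (suc m)) E {{m^n≢0 (4 + 2 * B) n}}) ⟩
    visit (suc m) * E + suc (visit (suc m)) * E          ≡⟨ *-distribʳ-+ E (visit (suc m)) _ ⟨
    (visit (suc m) + suc (visit (suc m))) * E            ≤⟨ *-monoˡ-≤ E lemma ⟩
    (suc (visit m) * (4 + 2 * B)) * E                    ≡⟨ *-assoc (suc (visit m)) (4 + 2 * B) E ⟩
    suc (visit m) * ((4 + 2 * B) * E)                    ∎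
    where
    open ≤-Reasoning
    E = (4 + 2 * B) ^ n
    v = suc (visit m)
    lemma : suc (B * v) + suc (suc (B * v)) ≤ v * (4 + 2 * B)
    lemma = begin
      suc (B * v) + suc (suc (B * v)) ≡⟨ solve 2 (λ B v →
          (con 1 :+ B :* v) :+ (con 2 :+ B :* v) := con 3 :+ v :* (con 2 :* B)) refl B v ⟩
      3 + v * (2 * B)                 ≤⟨ +-monoˡ-≤ (v * (2 * B)) (≤-trans (n≤1+n 3) (m≤n*m 4 v)) ⟩
      v * 4 + v * (2 * B)             ≡⟨ *-distribˡ-+ v 4 _ ⟨
      v * (4 + 2 * B)                 ∎

  total≤ : ∀ n → total n ≤ suc (2 * (4 + 2 * B) ^ n)
  total≤ n = s≤s (above≤ 0 n)

-- After booting every transition also moves the clock, so that no run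
-- outlives it.
module Machine (B k : ℕ) (P : Prog (StackAtom (suc k))) where

  open Clock B

  bitˢ : Bool → Symbol B
  bitˢ false = bitˢ₀
  bitˢ true  = bitˢ₁

  bit? : Symbol B → Maybe Bool
  bit? ␣         = nothing
  bit? bitˢ₀     = just false
  bit? bitˢ₁     = just true
  bit? leaf      = nothing
  bit? (digit _) = nothing

  Action : Set
  Action = Symbol B → Maybe (Symbol B × Move)

  -- An action writes before it moves, whereas a push has to move before it writes; so it takes two
  -- actions. The cell entered may contain the remnant of a popped bit, which `write` replaces.
  walk write : Bool → Action
  walk  b s = just (s , right)
  write b s = just (bitˢ b , stay)

  expect : Bool → Action
  expect b s with bit? s
  ... | nothing = nothing
  ... | just b′ with b Bool.≟ b′
  ...   | yes _ = just (s , left)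
  ...   | no _  = nothing

  expectNone : Action
  expectNone s with bit? s
  ... | nothing = just (s , stay)
  ... | just _  = nothing

  TapeAtom : Set
  TapeAtom = Fin (suc k) × Action

  implement : StackAtom (suc k) → Prog TapeAtom
  implement (i , push b) = ‵ (i , walk b) ∙ ‵ (i , write b)
  implement (i , pop b)  = ‵ (i , expect b)
  implement (i , empty)  = ‵ (i , expectNone)

  P′ : Prog TapeAtom
  P′ = refine implement P

  Cells : Set
  Cells = Vec (Symbol B) (suc k)

  Acts : ℕ → Set
  Acts k = Vec (Symbol B × Move) k

  idle : ∀ {k} → Vec (Symbol B) k → Acts k
  idle = Vec.map (_, stay)

  perform : Maybe TapeAtom → Cells → Maybe (Acts (suc k))
  perform nothing        hs = just (idle hs)
  perform (just (i , f)) hs = Maybe.map (idle hs [ i ]≔_) (f (lookup hs i))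

  Control : Set
  Control = Maybe (Maybe (Pos P′))

  pattern boot   = nothing
  pattern main x = just x

  option : Symbol B × Move → Cells → Maybe TapeAtom × Maybe (Pos P′) → Maybe (Control × Acts (suc (suc k)))
  option c hs (a , x) = Maybe.map (λ as → main x , c ∷ as) (perform a hs)

  -- Booting moves the input to the first stack and replaces it by the
  -- cells of the clock.
  δ : Control → Vec (Symbol B) (suc (suc k)) → List (Control × Acts (suc (suc k)))
  δ boot (s ∷ h ∷ hs) with bit? s
  ... | just b  = (boot , (digit Full , right) ∷ (bitˢ b , right) ∷ idle hs) ∷ []
  ... | nothing = (main (just (entry P′)) , (leaf , stay) ∷ (h , left) ∷ idle hs) ∷ []
  δ (main nothing)  _        = []
  δ (main (just p)) (s ∷ hs) with clock s
  -- An expired clock leaves a configuration that is halted but not accepting, so running out of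
  -- time means rejection.
  ... | nothing = []
  ... | just c  = mapMaybe (option c hs) (next P′ p)

  accepting : Control → Bool
  accepting (main nothing) = true
  accepting _              = false

  M : NTM
  M = record
    { workTapes    = suc k
    ; State        = Control
    ; Symbol       = Symbol B
    ; finiteState  = maybe-finite (maybe-finite (pos-finite P′))
    ; finiteSymbol = _ , ↔-id _
    ; blank        = ␣
    ; bit          = bitˢ
    ; bit-distinct = λ ()
    ; bit-nonblank = λ { false () ; true () }
    ; start        = boot
    ; accepting    = accepting
    ; δ            = δ
    }

  open Computation M

  head : Tape → Symbol B
  head = Tape.head

  Tapes : Semantics TapeAtom (Vec Tape (suc k))
  Tapes (i , f) ts ts′ = ∃[ a ] f (head (lookup ts i)) ≡ just a × ts′ ≡ ts [ i ]≔ act a (lookup ts i)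

  bits : List (Symbol B) → List Bool
  bits []       = []
  bits (s ∷ ss) with bit? s
  ... | just b  = b ∷ bits ss
  ... | nothing = []

  -- The stack consists of the bits from the head leftwards up to the first other symbol. Cells to
  -- the right of the head are ignored, so a pop only moves.
  contents : Tape → List Bool
  contents (tape ls s rs) = bits (s ∷ ls)

  contents-left : ∀ t → contents (move left t) ≡ bits (Tape.before t)
  contents-left (tape []       s rs) = refl
  contents-left (tape (l ∷ ls) s rs) = refl

  before-right : ∀ t → Tape.before (move right t) ≡ Tape.head t ∷ Tape.before t
  before-right (tape ls s [])       = refl
  before-right (tape ls s (r ∷ rs)) = refl

  contents-write : ∀ b t → contents (act (bitˢ b , stay) t) ≡ b ∷ bits (Tape.before t)
  contents-write false t = refl
  contents-write true  t = refl

  contents-push : ∀ b t → contents (act (bitˢ b , stay) (act (head t , right) t)) ≡ b ∷ contents t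
  contents-push b t = trans (contents-write b (move right t)) (cong (λ ss → b ∷ bits ss) (before-right t))

  Stored : Vec (List Bool) (suc k) → Vec Tape (suc k) → Set
  Stored σ ts = σ ≡ Vec.map contents ts

  stored-lookup : ∀ {σ ts} i → Stored σ ts → lookup σ i ≡ contents (lookup ts i)
  stored-lookup {ts = ts} i refl = lookup-map i contents ts

  stored-update : ∀ {σ ts} i {l t} → Stored σ ts → l ≡ contents t → Stored (σ [ i ]≔ l) (ts [ i ]≔ t)
  stored-update {ts = ts} i refl refl = sym (map-[]≔ contents ts i)

  contents-none : ∀ t → bit? (head t) ≡ nothing → contents t ≡ []
  contents-none t eq with bit? (head t)
  contents-none t refl | nothing = refl

  expect-pop : ∀ b {a} t → expect b (head t) ≡ just a → contents t ≡ b ∷ contents (act a t)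
  expect-pop b t eq with bit? (head t)
  ... | just b′ with b Bool.≟ b′ | eq
  ...   | yes refl | refl = cong (b ∷_) (sym (contents-left t))

  expect-empty : ∀ {a} t → expectNone (head t) ≡ just a → contents t ≡ [] × contents (act a t) ≡ []
  expect-empty t eq with bit? (head t) in eq′ | eq
  ... | nothing | refl = refl , contents-none t eq′

  pop-expect : ∀ b {l} t → contents t ≡ b ∷ l →
               ∃[ a ] expect b (head t) ≡ just a × contents (act a t) ≡ l
  pop-expect b t eq with bit? (head t) | eq
  ... | just b′ | refl with b Bool.≟ b′
  ...   | yes _ = _ , refl , contents-left t
  ...   | no ¬p = ⊥-elim (¬p refl)

  empty-expect : ∀ t → contents t ≡ [] →
                 ∃[ a ] expectNone (head t) ≡ just a × contents (act a t) ≡ []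
  empty-expect t eq with bit? (head t) in eq′ | eq
  ... | nothing | refl = _ , refl , contents-none t eq′

  implement-sound : ∀ a {σ ts ts′ n} → Stored σ ts → Run Tapes (implement a) ts ts′ n →
                    ∃[ σ′ ] Stacks (suc k) a σ σ′ × Stored σ′ ts′
  implement-sound (i , push b) {ts = ts} st (seq (atom (_ , refl , refl)) (atom (_ , refl , refl)))
    rewrite lookup∘update i ts (act (head (lookup ts i) , right) (lookup ts i))
          | update² ts i (act (head (lookup ts i) , right) (lookup ts i))
                        (act (bitˢ b , stay) (act (head (lookup ts i) , right) (lookup ts i)))
    = _ , (_ , refl , refl) ,
      stored-update i st (trans (cong (b ∷_) (stored-lookup i st)) (sym (contents-push b (lookup ts i))))
  implement-sound (i , pop b) {ts = ts} st (atom (a , eq , refl)) =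
    _ , (_ , trans (stored-lookup i st) (expect-pop b (lookup ts i) eq) , refl) , stored-update i st refl
  implement-sound (i , empty) {ts = ts} st (atom (a , eq , refl)) with expect-empty (lookup ts i) eq
  ... | e , e′ = _ , (_ , (trans (stored-lookup i st) e , e′) , refl) , stored-update i st refl

  implement-complete : ∀ a {σ σ′ ts} → Stored σ ts → Stacks (suc k) a σ σ′ →
                       ∃[ ts′ ] Run≤ Tapes (implement a) ts ts′ 2 × Stored σ′ ts′
  implement-complete (i , push b) {ts = ts} st (_ , refl , refl) =
    _ , (_ , seq (atom (_ , refl , refl)) (atom (_ , refl , refl)) , ≤-refl) , stored
    where
    t = act (head (lookup ts i) , right) (lookup ts i)
    stored : Stored _ ((ts [ i ]≔ t) [ i ]≔ act (bitˢ b , stay) (lookup (ts [ i ]≔ t) i))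
    stored rewrite lookup∘update i ts t | update² ts i t (act (bitˢ b , stay) t) =
      stored-update i st (trans (cong (b ∷_) (stored-lookup i st)) (sym (contents-push b (lookup ts i))))
  implement-complete (i , pop b) {ts = ts} st (_ , eq , refl)
    with pop-expect b (lookup ts i) (trans (sym (stored-lookup i st)) eq)
  ... | a , e , e′ = _ , (_ , atom (_ , e , refl) , s≤s z≤n) , stored-update i st (sym e′)
  implement-complete (i , empty) {ts = ts} st (_ , (eq , refl) , refl)
    with empty-expect (lookup ts i) (trans (sym (stored-lookup i st)) eq)
  ... | a , e , e′ = _ , (_ , atom (_ , e , refl) , s≤s z≤n) , stored-update i st (sym e′)

  idle-act : ∀ {k} (ts : Vec Tape k) → Vec.zipWith act (idle (Vec.map head ts)) ts ≡ ts
  idle-act []       = refl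
  idle-act (t ∷ ts) = cong (t ∷_) (idle-act ts)

  update-act : ∀ {k} (ts : Vec Tape k) i a →
               Vec.zipWith act (idle (Vec.map head ts) [ i ]≔ a) ts ≡ ts [ i ]≔ act a (lookup ts i)
  update-act (t ∷ ts) zero    a = cong (act a t ∷_) (idle-act ts)
  update-act (t ∷ ts) (suc i) a = cong (t ∷_) (update-act ts i a)

  perform-label : ∀ a ts {as} → perform a (Vec.map head ts) ≡ just as →
                  Label Tapes a ts (Vec.zipWith act as ts)
  perform-label nothing        ts refl = sym (idle-act ts)
  perform-label (just (i , f)) ts eq with f (lookup (Vec.map head ts) i) in eq′ | eq
  ... | just a | refl = a , trans (cong f (sym (lookup-map i head ts))) eq′ , update-act ts i a

  label-perform : ∀ a ts {ts′} → Label Tapes a ts ts′ →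
                  ∃[ as ] perform a (Vec.map head ts) ≡ just as × Vec.zipWith act as ts ≡ ts′
  label-perform nothing        ts refl = _ , refl , idle-act ts
  label-perform (just (i , f)) ts (a , eq , refl)
    rewrite lookup-map i head ts | eq = _ , refl , update-act ts i a

  fresh : ℕ → List (Symbol B)
  fresh m = replicate m (digit Full) ++ leaf ∷ []

  digits′ : List (Fin (suc B)) → List (Symbol B)
  digits′ = List.map (λ d → digit d)

  -- Leaving a subtree restores its digits, so the part to the right of the head is always in its
  -- initial state. The digits under and left of the head then determine the position in the walk.
  data Ticks : Tape → ℕ → Set where
    off     : ∀ {rs} → Ticks (tape [] ␣ rs) 0
    atLeaf  : ∀ ds → Ticks (tape (digits′ ds) leaf []) (suc (above 0 ds))
    atDigit : ∀ ds d m → Ticks (tape (digits′ ds) (digit d) (fresh m)) (above m (d ∷ ds))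

  -- Leaving a subtree to the left completes it, and its digit is Full again.
  ascend : ∀ ds m s → s ∷ fresh m ≡ fresh (suc m) →
      Ticks (move left (tape (digits′ ds) s (fresh m))) (above (suc m) ds)
  ascend []       m s eq = off
  ascend (d ∷ ds) m s eq = subst (λ rs → Ticks (tape (digits′ ds) (digit d) rs) (above (suc m) (d ∷ ds))) (sym eq)
      (atDigit ds d (suc m))

  ascend-leaf : ∀ ds → Ticks (move left (tape (digits′ ds) leaf [])) (above 0 ds)
  ascend-leaf []       = off
  ascend-leaf (d ∷ ds) = atDigit ds d 0

  descend : ∀ ds d m → Ticks (move right (tape (digits′ ds) (digit d) (fresh m))) (visit m + above m (d ∷ ds))
  descend ds d zero    = atLeaf (d ∷ ds)
  descend ds d (suc m) =
    subst (λ n → Ticks (tape (digits′ (d ∷ ds)) (digit Full) (fresh m))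
        (suc (n * suc (visit m)) + above (suc m) (d ∷ ds))) (toℕ-fromℕ B) (atDigit (d ∷ ds) Full m)

  tick : ∀ {t r} → Ticks t r → (clock (head t) ≡ nothing × r ≡ 0) ⊎
         (∃₂ λ a r′ → clock (head t) ≡ just a × r ≡ suc r′ × Ticks (act a t) r′)
  tick off                      = inj₁ (refl , refl)
  tick (atLeaf ds)              = inj₂ (_ , _ , refl , refl , ascend-leaf ds)
  tick (atDigit ds zero m)      = inj₂ (_ , _ , refl , refl , ascend ds m _ refl)
  tick (atDigit ds (suc d) m)   = inj₂ (_ , _ , refl , lemma , descend ds (inject₁ d) m)
    where
    lemma : above m (suc d ∷ ds) ≡ suc (visit m + above m (inject₁ d ∷ ds))
    lemma rewrite toℕ-inject₁ d = cong suc (trans (+-assoc (suc (visit m)) (toℕ d * suc (visit m)) _)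
      (sym (+-suc (visit m) _)))

  Working : Maybe (Pos P′) → Tape → Vec Tape (suc k) → Config
  Working x t ts = config (main x) (t ∷ ts)

  -- The exit state accepts without consulting the clock, so a path may use up all the ticks.
  path-complete : ∀ {x ts ts′ m t r} → Path Tapes P′ x ts ts′ m → Ticks t r → m ≤ r →
                  ∃[ t′ ] Working x t ts ⟶[ m ] Working nothing t′ ts′
  path-complete exit _ _ = _ , done
  path-complete {ts = ts} (_∷_ {a = a} (x∈ , l) π) T m≤r with tick T
  path-complete (_ ∷ _) T () | inj₁ (_ , refl)
  path-complete {ts = ts} {t = t} (_∷_ {p = p} {a = a} {x = x} (x∈ , l) π) T (s≤s m≤r)
    | inj₂ (c , r , eq , refl , T′) with label-perform a ts l
  ... | as , e , refl with path-complete π T′ m≤r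
  ...   | t′ , run = t′ , step opt ∷ run
    where
    opt : (main x , c ∷ as) ∈ˡ options (Working (just p) t ts)
    opt rewrite eq = ∈-mapMaybe⁺ (option c (Vec.map head ts)) x∈ (cong (Maybe.map (λ as → main x , c ∷ as)) e)

  work-step : ∀ {p t ts d r} → Ticks t r → Working (just p) t ts ⟶ d →
              ∃₂ λ t′ r′ → ∃₂ λ ts′ x → ∃[ a ] d ≡ Working x t′ ts′ × r ≡ suc r′ × Ticks t′ r′ ×
                (a , x) ∈ˡ next P′ p × Label Tapes a ts ts′
  work-step {p} {t} {ts} T (step opt) with tick T
  ... | inj₁ (eq , _) rewrite eq with opt
  ... | ()
  work-step {p} {t} {ts} T (step opt) | inj₂ (c , r , eq , refl , T′) rewrite eq
    with ∈-mapMaybe⁻ (option c (Vec.map head ts)) (next P′ p) opt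
  ... | (a , x) , x∈ , e with perform a (Vec.map head ts) in e′ | e
  ... | just as | refl = _ , _ , _ , x , a , refl , refl , T′ , x∈ , perform-label a ts e′

  -- Every step spends a tick, silent transitions included. Loops that change nothing are thus cut
  -- off as well.
  work-halts : ∀ {x t ts r n c} → Ticks t r → Working x t ts ⟶[ n ] c → n ≤ r
  work-halts T done = z≤n
  work-halts {nothing} T (step () ∷ _)
  work-halts {just p} T (s ∷ run) with work-step T s
  ... | _ , _ , _ , _ , _ , refl , refl , T′ , _ = s≤s (work-halts T′ run)

  path-sound : ∀ {x t ts r n c} → Ticks t r → Working x t ts ⟶[ n ] c → Accepting c →
               ∃[ ts′ ] Path Tapes P′ x ts ts′ n
  path-sound {nothing} T done _ = _ , exit
  path-sound {nothing} T (step () ∷ _) _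
  path-sound {just p} T done (_ , ())
  path-sound {just p} T (s ∷ run) ok with work-step T s
  ... | _ , _ , _ , _ , _ , refl , refl , T′ , x∈ , l with path-sound T′ run ok
  ... | _ , π = _ , (x∈ , l) ∷ π

  loadAt : List (Symbol B) → List (Symbol B) → Tape
  loadAt ls []       = tape ls ␣ []
  loadAt ls (s ∷ ss) = tape ls s ss

  move-loadAt : ∀ ls s ss → move right (tape ls s ss) ≡ loadAt (s ∷ ls) ss
  move-loadAt ls s []       = refl
  move-loadAt ls s (x ∷ ss) = refl

  Booting : List (Fin (suc B)) → List Bool → List Bool → Vec Tape k → Config
  Booting ds w us ts = config boot
    (loadAt (digits′ ds) (List.map bitˢ w) ∷ tape (List.map bitˢ us) ␣ [] ∷ ts)

  Booted : List (Fin (suc B)) → List Bool → Vec Tape k → Config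
  Booted ds us ts =
    Working (just (entry P′)) (tape (digits′ ds) leaf []) (move left (tape (List.map bitˢ us) ␣ []) ∷ ts)

  boot-options : ∀ ds b w us ts → options (Booting ds (b ∷ w) us ts) ≡
                 (boot , (digit Full , right) ∷ (bitˢ b , right) ∷ idle (Vec.map head ts)) ∷ []
  boot-options ds false w us ts = refl
  boot-options ds true  w us ts = refl

  boot-act : ∀ ds b w us ts → config boot (Vec.zipWith act
      ((digit Full , right) ∷ (bitˢ b , right) ∷ idle (Vec.map head ts))
               (loadAt (digits′ ds) (List.map bitˢ (b ∷ w)) ∷ tape (List.map bitˢ us) ␣ [] ∷ ts)) ≡
             Booting (Full ∷ ds) w (b ∷ us) ts
  boot-act ds b w us ts rewrite idle-act ts | move-loadAt (digits′ ds) (digit Full) (List.map bitˢ w) = refl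

  boot-step : ∀ ds b w us ts → Booting ds (b ∷ w) us ts ⟶ Booting (Full ∷ ds) w (b ∷ us) ts
  boot-step ds b w us ts = subst (Booting ds (b ∷ w) us ts ⟶_) (boot-act ds b w us ts)
    (step (subst (λ os → (boot , (digit Full , right) ∷ (bitˢ b , right) ∷ idle (Vec.map head ts)) ∈ˡ os)
      (sym (boot-options ds b w us ts)) (here refl)))

  boot-end : ∀ ds us ts → Booting ds [] us ts ⟶ Booted ds us ts
  boot-end ds us ts = subst (λ v → Booting ds [] us ts ⟶ Booted ds us v) (idle-act ts) (step (here refl))

  boot-complete : ∀ i w us ts {n c} → Booted (replicate (length w + i) Full) (w ʳ++ us) ts ⟶[ n ] c →
                  Booting (replicate i Full) w us ts ⟶[ suc (length w) + n ] c
  boot-complete i []      us ts run = boot-end (replicate i Full) us ts ∷ run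
  boot-complete i (b ∷ w) us ts {n} {c} run = boot-step (replicate i Full) b w us ts ∷
    boot-complete (suc i) w (b ∷ us) ts
      (subst (λ j → Booted (replicate j Full) (w ʳ++ b ∷ us) ts ⟶[ n ] c) (sym (+-suc (length w) i)) run)

  boot-sound : ∀ i w us ts {n c} → Booting (replicate i Full) w us ts ⟶[ n ] c →
               (n ≤ length w × Config.state c ≡ boot) ⊎
               (∃[ m ] n ≡ suc (length w) + m × Booted (replicate (length w + i) Full) (w ʳ++ us) ts ⟶[ m ] c)
  boot-sound i w       us ts done = inj₁ (z≤n , refl)
  boot-sound i []      us ts (step (here refl) ∷ run) rewrite idle-act ts = inj₂ (_ , refl , run)
  boot-sound i (b ∷ w) us ts {c = c} (step opt ∷ run) with subst (λ os → _ ∈ˡ os)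
      (boot-options (replicate i Full) b w us ts) opt
  ... | here refl rewrite boot-act (replicate i Full) b w us ts with boot-sound (suc i) w (b ∷ us) ts run
  ... | inj₁ (p , e) = inj₁ (s≤s p , e)
  ... | inj₂ (m , e , run′) = inj₂ (m , cong suc e ,
    subst (λ j → Booted (replicate j Full) (w ʳ++ b ∷ us) ts ⟶[ m ] c) (+-suc (length w) i) run′)

  -- The input is pushed in reading order, which reverses it.
  initial-stacks : List Bool → Vec (List Bool) (suc k)
  initial-stacks w = reverse w ∷ Vec.replicate k []

  bits-bitˢ : ∀ bs → bits (List.map bitˢ bs) ≡ bs
  bits-bitˢ []           = refl
  bits-bitˢ (false ∷ bs) = cong (false ∷_) (bits-bitˢ bs)
  bits-bitˢ (true ∷ bs)  = cong (true ∷_) (bits-bitˢ bs)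

  booted : List Bool → Vec Tape (suc k)
  booted w = move left (tape (List.map bitˢ (reverse w)) ␣ []) ∷ Vec.replicate k (load [])

  booted-stacks : ∀ w → Stored (initial-stacks w) (booted w)
  booted-stacks w = cong₂ _∷_
    (sym (trans (contents-left (tape (List.map bitˢ (reverse w)) ␣ [])) (bits-bitˢ (reverse w))))
    (sym (map-replicate contents (load []) k))

  initial-booting : ∀ w → initial w ≡ Booting [] w [] (Vec.replicate k (load []))
  initial-booting []      = refl
  initial-booting (b ∷ w) = refl

  halts : ∀ w → HaltsWithin w (suc (length w) + total (length w))
  halts w {n} {c} run with boot-sound 0 w [] (Vec.replicate k (load [])) (subst (_⟶[ n ] c) (initial-booting w) run)
  ... | inj₁ (p , _) = ≤-trans p (≤-trans (n≤1+n _) (m≤m+n _ _))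
  ... | inj₂ (m , refl , run′) rewrite +-identityʳ (length w) =
    +-monoʳ-≤ (suc (length w)) (work-halts (atLeaf (replicate (length w) Full)) run′)

  machine-sound : ∀ w → Accepts w → ∃[ σ ] Runs (Stacks (suc k)) P (initial-stacks w) σ
  machine-sound w (n , c , run , ok)
    with boot-sound 0 w [] (Vec.replicate k (load [])) (subst (_⟶[ n ] c) (initial-booting w) run)
  ... | inj₁ (_ , refl) = ⊥-elim (proj₂ ok)
  ... | inj₂ (m , _ , run′) with path-sound (atLeaf (replicate (length w + 0) Full)) run′ ok
  ... | _ , π with path⇒run Tapes π
  ... | _ , r with refine-sound implement Stored implement-sound P (booted-stacks w) r
  ... | _ , _ , r′ , _ = _ , _ , r′

  -- The factor 2 is the cost of a push in tape actions; the clock grants at least `B ^ length w`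
  -- ticks.
  machine-complete : ∀ w {σ n} → Run (Stacks (suc k)) P (initial-stacks w) σ n → n * 2 ≤ B ^ length w → Accepts w
  machine-complete w r p with refine-complete implement Stored 2 (s≤s z≤n) implement-complete (booted-stacks w) r
  ... | ts , (m , r′ , q) , _
    with path-complete (run⇒path Tapes r′) (atLeaf (replicate (length w) Full))
        (≤-trans q (≤-trans p (B^n≤total (length w))))
  ... | t , run = suc (length w) + m , Working nothing t ts ,
    subst (λ c → c ⟶[ suc (length w) + m ] Working nothing t ts) (sym (initial-booting w))
      (boot-complete 0 w [] (Vec.replicate k (load []))
        (subst (λ j → Booted (replicate j Full) (reverse w) (Vec.replicate k (load [])) ⟶[ m ] Working nothing t ts)
          (sym (+-identityʳ (length w))) run)) ,
    refl , tt

m*n≤m*m+n*n : ∀ m n → m * n ≤ m * m + n * n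
m*n≤m*m+n*n m n with ≤-total m n
... | inj₁ m≤n = ≤-trans (*-monoˡ-≤ n m≤n) (m≤n+m (n * n) (m * m))
... | inj₂ n≤m = ≤-trans (*-monoʳ-≤ m n≤m) (m≤m+n (m * m) (n * n))

module _ (B : ℕ) where

  open Clock B

  private
    e = 4 + 2 * B

  -- The walk takes `O(e ^ n)` steps, and `e ^ n ≤ 2 ^ (e * n) ≤ 2 ^ (e * e + n * n)` turns the base
  -- into a constant factor.
  clock-bound : ∃[ c ] ∀ n → suc n + total n ≤ c * 2 ^ (n ^ 2)
  clock-bound = 2 + 2 * 2 ^ (e * e) , λ n → bound n
    where
    bound : ∀ n → suc n + total n ≤ (2 + 2 * 2 ^ (e * e)) * 2 ^ (n ^ 2)
    bound n = begin
      suc n + total n                                 ≤⟨ +-mono-≤ 1+n≤E (total≤ n) ⟩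
      E + suc (2 * e ^ n)
          ≤⟨ +-monoʳ-≤ E (+-mono-≤ (m^n>0 2 (n ^ 2)) (*-monoʳ-≤ 2 e^n≤)) ⟩
      E + (E + 2 * (K * E))
          ≡⟨ solve 2 (λ E K → E :+ (E :+ con 2 :* (K :* E)) := (con 2 :+ con 2 :* K) :* E) refl E K ⟩
      (2 + 2 * K) * E                                 ∎
      where
      open ≤-Reasoning
      E = 2 ^ (n ^ 2)
      K = 2 ^ (e * e)
      n²≡ : n ^ 2 ≡ n * n
      n²≡ = cong (n *_) (*-identityʳ n)
      n≤n² : ∀ n → n ≤ n * n
      n≤n² zero    = z≤n
      n≤n² (suc n) = m≤m+n (suc n) _
      1+n≤E : suc n ≤ E
      1+n≤E = ≤-trans (n<2^n n) (^-monoʳ-≤ 2 (≤-trans (n≤n² n) (≤-reflexive (sym n²≡))))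
      e^n≤ : e ^ n ≤ K * E
      e^n≤ = begin
        e ^ n                ≤⟨ ^-monoˡ-≤ n (<⇒≤ (n<2^n e)) ⟩
        (2 ^ e) ^ n          ≡⟨ ^-*-assoc 2 e n ⟩
        2 ^ (e * n)          ≤⟨ ^-monoʳ-≤ 2 (m*n≤m*m+n*n e n) ⟩
        2 ^ (e * e + n * n)  ≡⟨ cong (λ j → 2 ^ (e * e + j)) n²≡ ⟨
        2 ^ (e * e + n ^ 2)  ≡⟨ ^-distribˡ-+-* 2 (e * e) (n ^ 2) ⟩
        K * E                ∎

-- The clock supplies halting. So the program owes one short run for each word of the language,
-- while its other runs may be arbitrarily long.
NEXP-by-program : ∀ (B k : ℕ) (P : Prog (StackAtom (suc k))) {L : Language} →
  (∀ w {σ n} → Run (Stacks (suc k)) P (reverse w ∷ Vec.replicate k []) σ n → L w) →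
  (∀ w → L w → ∃₂ λ σ n → Run (Stacks (suc k)) P (reverse w ∷ Vec.replicate k []) σ n × n * 2 ≤ B ^ length w) →
  NEXP L
NEXP-by-program B k P sound complete =
  2 , M , (λ w → mk⇔ (λ w∈L → let _ , _ , r , p = complete w w∈L in machine-complete w r p)
                     (λ ok → let _ , _ , r = machine-sound w ok in sound w r)) ,
  proj₁ (clock-bound B) , λ w run → ≤-trans (halts w run) (proj₂ (clock-bound B) (length w))
  where open Machine B k P

-- Arithmetic on stacks

module Routines where

  private variable
    k n : ℕ
    σ σ′ τ : Vec (List Bool) k
    u v : List Bool

  SRun : ∀ {k} → Prog (StackAtom k) → Vec (List Bool) k → Vec (List Bool) k → ℕ → Set
  SRun = Run (Stacks _)

  SRun≤ : ∀ {k} → Prog (StackAtom k) → Vec (List Bool) k → Vec (List Bool) k → ℕ → Set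
  SRun≤ = Run≤ (Stacks _)

  from : ∀ {P : Prog (StackAtom k)} → σ ≡ τ → SRun P σ σ′ n → SRun P τ σ′ n
  from refl r = r

  cast : ∀ {P : Prog (StackAtom k)} {σ₁ σ₂ τ₁ τ₂} → σ₁ ≡ σ₂ → τ₁ ≡ τ₂ → SRun≤ P σ₁ τ₁ n → SRun≤ P σ₂ τ₂ n
  cast refl refl r = r

  infix 9 _↓_ _↑_ _↓∅
  _↓_ _↑_ : Fin k → Bool → Prog (StackAtom k)
  i ↓ b = ‵ (i , push b)
  i ↑ b = ‵ (i , pop b)

  _↓∅ : Fin k → Prog (StackAtom k)
  i ↓∅ = ‵ (i , empty)

  empty-sound : ∀ {i : Fin k} → SRun (i ↓∅) σ σ′ n → lookup σ i ≡ [] × σ′ ≡ σ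
  empty-sound {σ = σ} {i = i} (atom (_ , (eq , refl) , refl)) =
    eq , trans (cong (σ [ i ]≔_) (sym eq)) ([]≔-lookup σ i)

  empty-complete : ∀ (i : Fin k) σ → lookup σ i ≡ [] → SRun≤ (i ↓∅) σ σ 1
  empty-complete i σ eq = atom≤ ([] , (eq , refl) , sym (trans (cong (σ [ i ]≔_) (sym eq)) ([]≔-lookup σ i)))

  write : Fin k → List Bool → Prog (StackAtom k)
  write i []       = ε
  write i (b ∷ bs) = write i bs ∙ i ↓ b

  write-sound : ∀ {i : Fin k} bs → SRun (write i bs) σ σ′ n → σ′ ≡ σ [ i ]≔ (bs ++ lookup σ i)
  write-sound {σ = σ} {i = i} [] skip = sym ([]≔-lookup σ i)
  write-sound {σ = σ} {i = i} (b ∷ bs) (seq r (atom (_ , refl , refl))) with write-sound bs r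
  ... | refl rewrite lookup∘update i σ (bs ++ lookup σ i) = update² σ i (bs ++ lookup σ i) (b ∷ bs ++ lookup σ i)

  write-complete : ∀ (i : Fin k) bs σ → SRun≤ (write i bs) σ (σ [ i ]≔ (bs ++ lookup σ i)) (suc (length bs))
  write-complete i [] σ = cast refl (sym ([]≔-lookup σ i)) skip≤
  write-complete i (b ∷ bs) σ = weaken (≤-reflexive (+-comm _ 1))
    (write-complete i bs σ ⨾ atom≤ (_ , refl ,
      sym (trans (cong (λ l → (σ [ i ]≔ (bs ++ lookup σ i)) [ i ]≔ (b ∷ l)) (lookup∘update i σ (bs ++ lookup σ i)))
          (update² σ i _ _))))

  -- States are displayed as a base state updated at two distinct stacks, so that a routine verified
  -- by the update laws serves every such pair.
  put : Fin k → Fin k → List Bool → List Bool → Vec (List Bool) k → Vec (List Bool) k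
  put i j x y σ = (σ [ i ]≔ x) [ j ]≔ y

  module _ {i j : Fin k} (i≢j : i ≢ j) where

    put-first : ∀ {x y} σ → lookup (put i j x y σ) i ≡ x
    put-first {x} {y} σ = trans (lookup∘update′ i≢j (σ [ i ]≔ x) y) (lookup∘update i σ x)

    put-second : ∀ {x y} σ → lookup (put i j x y σ) j ≡ y
    put-second {x} {y} σ = lookup∘update j (σ [ i ]≔ x) y

    put-update₁ : ∀ {x y x′} σ → put i j x y σ [ i ]≔ x′ ≡ put i j x′ y σ
    put-update₁ {x} {y} {x′} σ = trans ([]≔-commutes (σ [ i ]≔ x) j i (≢-sym i≢j))
        (cong (_[ j ]≔ y) (update² σ i x x′))

    put-update₂ : ∀ {x y y′} σ → put i j x y σ [ j ]≔ y′ ≡ put i j x y′ σ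
    put-update₂ {x} {y} {y′} σ = update² (σ [ i ]≔ x) j y y′

  -- A loop may stop at any moment; the test for emptiness after it discards the runs that stop too
  -- early. Pouring single bits reverses their order.
  pourLoop pour : Fin k → Fin k → (Bool → List Bool) → Prog (StackAtom k)
  pourLoop i j f = ⋃ (λ b → i ↑ b ∙ write j (f b)) *
  pour i j f = pourLoop i j f ∙ i ↓∅

  move : Fin k → Fin k → Prog (StackAtom k)
  move i j = pour i j (_∷ [])

  poured : (Bool → List Bool) → List Bool → List Bool → List Bool
  poured f []       l = l
  poured f (b ∷ bs) l = poured f bs (f b ++ l)

  poured-move : ∀ bs {l} → poured (_∷ []) bs l ≡ bs ʳ++ l
  poured-move []       = refl
  poured-move (b ∷ bs) = poured-move bs

  module _ {i j : Fin k} (i≢j : i ≢ j) (f : Bool → List Bool) where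

    private
      body-sound : ∀ {x y b} σ → SRun (i ↑ b ∙ write j (f b)) (put i j x y σ) σ′ n →
                   ∃[ bs ] x ≡ b ∷ bs × σ′ ≡ put i j bs (f b ++ y) σ
      body-sound {x = x} {y} {b} σ (seq (atom (bs , eq , refl)) r) = bs , trans (sym (put-first i≢j {x} {y} σ)) eq ,
        trans (write-sound (f b) r) (trans (cong₂ (λ σ l → σ [ j ]≔ (f b ++ l)) (put-update₁ i≢j σ)
            (trans (cong (λ σ → lookup σ j) (put-update₁ i≢j σ)) (put-second i≢j σ))) (put-update₂ i≢j σ))

      body-complete : ∀ {y} b bs σ → SRun≤ (i ↑ b ∙ write j (f b)) (put i j (b ∷ bs) y σ) (put i j bs (f b ++ y) σ)
          (2 + length (f b))
      body-complete {y} b bs σ = atom≤ (bs , put-first i≢j σ , sym (put-update₁ i≢j σ)) ⨾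
        cast refl (trans (cong (λ l → put i j bs y σ [ j ]≔ (f b ++ l)) (put-second i≢j σ)) (put-update₂ i≢j σ))
          (write-complete j (f b) (put i j bs y σ))

    pour-sound : ∀ {x y} σ → SRun (pour i j f) (put i j x y σ) σ′ n → σ′ ≡ put i j [] (poured f x y) σ
    pour-sound {x = x} {y} σ (seq stop e) with empty-sound e
    ... | eq , refl with trans (sym (put-first i≢j {x} {y} σ)) eq
    ... | refl = refl
    pour-sound σ (seq (iter (alt b r) r′) e) with body-sound σ r
    ... | bs , refl , refl = pour-sound σ (seq r′ e)

    pour-complete : (∀ b → length (f b) ≤ 2) → ∀ x {y} σ →
        SRun≤ (pour i j f) (put i j x y σ) (put i j [] (poured f x y) σ) (2 + length x * 6)
    pour-complete f≤2 x σ = weaken (≤-reflexive (+-comm _ 1)) (loop x σ ⨾ empty-complete i _ (put-first i≢j σ))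
      where
      loop : ∀ x {y} σ → SRun≤ (pourLoop i j f) (put i j x y σ) (put i j [] (poured f x y) σ) (1 + length x * 6)
      loop []       σ = stop≤
      loop (b ∷ bs) σ = weaken (s≤s (≤-trans (+-monoˡ-≤ _ (s≤s (+-monoʳ-≤ 2 (f≤2 b)))) (≤-reflexive (+-suc 5 _))))
        (iter≤ (alt≤ b (body-complete b bs σ)) (loop bs σ))

  move-sound : ∀ {i j : Fin k} (i≢j : i ≢ j) {x y} σ → SRun (move i j) (put i j x y σ) σ′ n →
      σ′ ≡ put i j [] (x ʳ++ y) σ
  move-sound {i = i} {j} i≢j {x} σ r = trans (pour-sound i≢j (_∷ []) σ r)
      (cong (λ l → put i j [] l σ) (poured-move x))

  move-complete : ∀ {i j : Fin k} (i≢j : i ≢ j) x {y} σ →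
      SRun≤ (move i j) (put i j x y σ) (put i j [] (x ʳ++ y) σ) (2 + length x * 6)
  move-complete {i = i} {j} i≢j x {y} σ = cast refl (cong (λ l → put i j [] l σ) (poured-move x))
    (pour-complete i≢j (_∷ []) (λ _ → s≤s z≤n) x σ)

  -- The routines below use the first two stacks, u and v, as work space.
  pattern U = zero
  pattern V = suc zero
  pattern at i = suc (suc i)

  -- Reading a stack destroys it, so copying has two targets: `V` receives the copy, and `U` serves
  -- to rebuild the source. The copy is reversed, and its users pour it once more.
  dupLoop dup : Fin k → Prog (StackAtom (2 + k))
  dupLoop q = ⋃ (λ b → at q ↑ b ∙ U ↓ b ∙ V ↓ b) *
  dup q = dupLoop q ∙ at q ↓∅ ∙ move U (at q)

  dupLoop-sound : ∀ {q : Fin k} l {τ} → SRun (dupLoop q) (u ∷ v ∷ (τ [ q ]≔ l)) σ′ n →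
                  ∃₂ λ l₁ l₂ → l ≡ l₁ ++ l₂ × σ′ ≡ (l₁ ʳ++ u) ∷ (l₁ ʳ++ v) ∷ (τ [ q ]≔ l₂)
  dupLoop-sound l stop = [] , l , refl , refl
  dupLoop-sound {q = q} l {τ} (iter (alt b (seq (atom (bs , eq , refl))
      (seq (atom (_ , refl , refl)) (atom (_ , refl , refl))))) r′)
    with trans (sym (lookup∘update q τ l)) eq
  ... | refl rewrite update² τ q (b ∷ bs) bs with dupLoop-sound bs {τ} r′
  ... | l₁ , l₂ , refl , refl = b ∷ l₁ , l₂ , refl , refl

  dup-sound : ∀ {q : Fin k} {τ} → SRun (dup q) ([] ∷ v ∷ τ) σ′ n → σ′ ≡ [] ∷ (lookup τ q ʳ++ v) ∷ τ
  dup-sound {v = v} {σ′ = σ′} {q = q} {τ} (seq r (seq e r′))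
    with dupLoop-sound (lookup τ q) {τ} (from (cong (λ τ → [] ∷ v ∷ τ) (sym ([]≔-lookup τ q))) r)
  ... | l₁ , l₂ , eq , refl with empty-sound e
  ... | eq′ , refl with trans (sym (lookup∘update q τ l₂)) eq′
  ... | refl rewrite ++-identityʳ l₁ = trans
    (move-sound {i = U} {j = at q} (λ ()) {reverse l₁} {[]} (reverse l₁ ∷ (l₁ ʳ++ v) ∷ τ) r′)
    (cong₂ (λ l τ → [] ∷ l ∷ τ) (cong (_ʳ++ v) (sym eq))
      (trans (cong (τ [ q ]≔_) (trans (reverse-involutive l₁) (sym eq))) ([]≔-lookup τ q)))

  dup-complete : ∀ (q : Fin k) v τ → SRun≤ (dup q) ([] ∷ v ∷ τ) ([] ∷ (lookup τ q ʳ++ v) ∷ τ)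
      (4 + length (lookup τ q) * 11)
  dup-complete q v τ = weaken (≤-reflexive cost)
    (cast (cong (λ τ → [] ∷ v ∷ τ) ([]≔-lookup τ q)) refl (loop l) ⨾
     empty-complete (at q) _ (lookup∘update q τ []) ⨾
     cast refl (cong (λ τ → [] ∷ (l ʳ++ v) ∷ τ) (trans (cong (τ [ q ]≔_) (reverse-involutive l)) ([]≔-lookup τ q)))
       (move-complete {i = U} {j = at q} (λ ()) (reverse l) (reverse l ∷ (l ʳ++ v) ∷ τ)))
    where
    l = lookup τ q
    cost : 1 + length l * 5 + (1 + (2 + length (reverse l) * 6)) ≡ 4 + length l * 11
    cost = trans (cong (λ n → 1 + length l * 5 + (1 + (2 + n * 6))) (length-reverse l))
      (solve 1 (λ n → con 1 :+ n :* con 5 :+ (con 3 :+ n :* con 6) := con 4 :+ n :* con 11) refl (length l))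
    loop : ∀ l {u v} → SRun≤ (dupLoop q) (u ∷ v ∷ (τ [ q ]≔ l)) ((l ʳ++ u) ∷ (l ʳ++ v) ∷ (τ [ q ]≔ []))
        (1 + length l * 5)
    loop []       = stop≤
    loop (b ∷ bs) {u} {v} = iter≤ (alt≤ b
      (atom≤ (bs , lookup∘update q τ (b ∷ bs) , cong (λ τ → u ∷ v ∷ τ) (sym (update² τ q (b ∷ bs) bs))) ⨾
       atom≤ (_ , refl , refl) ⨾ atom≤ (_ , refl , refl))) (loop bs)

  clear : Fin k → Prog (StackAtom k)
  clear i = ⋃ (λ b → i ↑ b) * ∙ i ↓∅

  clear-sound : ∀ {i : Fin k} {σ σ′ n} → SRun (clear i) σ σ′ n → σ′ ≡ σ [ i ]≔ []
  clear-sound {i = i} {σ} (seq stop (atom (_ , (_ , refl) , refl))) = refl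
  clear-sound {i = i} {σ} (seq (iter (alt b (atom (bs , _ , refl))) r) e) =
    trans (clear-sound (seq r e)) (update² σ i bs [])

  clear-complete : ∀ (i : Fin k) σ → SRun≤ (clear i) σ (σ [ i ]≔ []) (2 + length (lookup σ i) * 3)
  clear-complete i σ = weaken (≤-reflexive (+-comm _ 1)) (cast ([]≔-lookup σ i) refl (loop (lookup σ i)) ⨾
    empty-complete i _ (lookup∘update i σ []))
    where
    loop : ∀ l → SRun≤ (⋃ (λ b → i ↑ b) *) (σ [ i ]≔ l) (σ [ i ]≔ []) (1 + length l * 3)
    loop []       = stop≤
    loop (b ∷ bs) = iter≤ (alt≤ b (atom≤ (bs , lookup∘update i σ (b ∷ bs) , sym (update² σ i (b ∷ bs) bs))))
        (loop bs)

  -- The numeral on `U` is reversed and has its most significant digit on top. Otherwise numerals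
  -- with leading zeros would be accepted as codes.
  tidy : Prog (StackAtom (suc k))
  tidy = U ↓∅ ∪ (U ↑ true ∙ U ↓ true)

  tidy-sound : ∀ {σ : Vec (List Bool) k} → SRun tidy (u ∷ σ) σ′ n → Canonical (reverse u) × σ′ ≡ u ∷ σ
  tidy-sound (alt false (atom (_ , (refl , refl) , refl))) = none , refl
  tidy-sound (alt true (seq (atom (us , refl , refl)) (atom (_ , refl , refl)))) =
    subst Canonical (sym (unfold-reverse true us)) (ends (reverse us)) , refl

  tidy-complete : ∀ {bs} (σ : Vec (List Bool) k) → Canonical bs → SRun≤ tidy (reverse bs ∷ σ) (reverse bs ∷ σ) 3
  tidy-complete σ none = weaken (s≤s (s≤s z≤n)) (alt≤ false (atom≤ ([] , (refl , refl) , refl)))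
  tidy-complete σ (ends bs) rewrite ++-ʳ++ bs {true ∷ []} {[]} =
    alt≤ true (atom≤ (_ , refl , refl) ⨾ atom≤ (_ , refl , refl))

  finish : Fin k → Prog (StackAtom (2 + k))
  finish q = tidy ∙ clear (at q) ∙ move U (at q)

  finish-sound : ∀ {q : Fin k} {τ} → SRun (finish q) (u ∷ v ∷ τ) σ′ n →
                 ∃[ m ] reverse u ≡ digits m × σ′ ≡ [] ∷ v ∷ (τ [ q ]≔ digits m)
  finish-sound {u = u} {v = v} {q = q} {τ} (seq r (seq c e)) with tidy-sound r
  ... | can , refl with clear-sound {i = at q} c
  ... | refl = val (reverse u) , sym (digits-val can) ,
    trans (move-sound {i = U} {j = at q} (λ ()) {u} {[]} (u ∷ v ∷ τ) e)
          (cong (λ l → [] ∷ v ∷ (τ [ q ]≔ l)) (sym (digits-val can)))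

  finish-complete : ∀ (q : Fin k) m v τ → SRun≤ (finish q) (reverse (digits m) ∷ v ∷ τ)
      ([] ∷ v ∷ (τ [ q ]≔ digits m))
                    (7 + length (lookup τ q) * 3 + length (digits m) * 6)
  finish-complete q m v τ = weaken (≤-reflexive cost)
    (tidy-complete (v ∷ τ) (digits-canonical m) ⨾ clear-complete (at q) _ ⨾
     cast refl (cong (λ l → [] ∷ v ∷ (τ [ q ]≔ l)) (reverse-involutive (digits m)))
       (move-complete {i = U} {j = at q} (λ ()) (reverse (digits m)) {[]} ([] ∷ v ∷ τ)))
    where
    a = length (lookup τ q)
    cost : 3 + (2 + a * 3 + (2 + length (reverse (digits m)) * 6)) ≡ 7 + a * 3 + length (digits m) * 6
    cost = trans (cong (λ n → 3 + (2 + a * 3 + (2 + n * 6))) (length-reverse (digits m)))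
      (solve 2 (λ a n → con 3 :+ (con 2 :+ a :+ (con 2 :+ n)) := con 7 :+ a :+ n) refl (a * 3)
          (length (digits m) * 6))

  scribble : Prog (StackAtom (suc k))
  scribble = ⋃ (λ b → U ↓ b) *

  scribble-sound : ∀ {σ : Vec (List Bool) k} → SRun scribble (u ∷ σ) σ′ n → ∃[ u′ ] σ′ ≡ u′ ∷ σ
  scribble-sound stop = _ , refl
  scribble-sound (iter (alt b (atom (_ , refl , refl))) r) = scribble-sound r

  scribble-complete : ∀ bs {u} (σ : Vec (List Bool) k) → SRun≤ scribble (u ∷ σ) ((bs ʳ++ u) ∷ σ) (1 + length bs * 3)
  scribble-complete []       σ = stop≤
  scribble-complete (b ∷ bs) σ = iter≤ (alt≤ b (atom≤ (_ , refl , refl))) (scribble-complete bs σ)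

  decode : Fin k → Prog (StackAtom (2 + k))
  decode p = (at p ↑ true ∙ ⋃ (λ b → at p ↑ b ∙ U ↓ b)) * ∙ at p ↑ false

  decode-sound : ∀ {p : Fin k} {τ} → SRun (decode p) (u ∷ v ∷ τ) σ′ n →
                 ∃₂ λ bs l → lookup τ p ≡ frame bs ++ l × σ′ ≡ (bs ʳ++ u) ∷ v ∷ (τ [ p ]≔ l)
  decode-sound {p = p} (seq r e) = loop r e
    where
    loop : ∀ {u v τ σ σ′ m n} → SRun ((at p ↑ true ∙ ⋃ (λ b → at p ↑ b ∙ U ↓ b)) *) (u ∷ v ∷ τ) σ m →
        SRun (at p ↑ false) σ σ′ n →
           ∃₂ λ bs l → lookup τ p ≡ frame bs ++ l × σ′ ≡ (bs ʳ++ u) ∷ v ∷ (τ [ p ]≔ l)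
    loop stop (atom (l , eq , refl)) = [] , l , eq , refl
    loop {τ = τ} (iter (seq (atom (l₁ , eq₁ , refl))
        (alt b (seq (atom (l₂ , eq₂ , refl)) (atom (_ , refl , refl))))) r) e
      with trans (sym (lookup∘update p τ l₁)) eq₂ | loop r e
    ... | refl | bs , l , eq , refl
      with trans (sym (trans (cong (λ τ → lookup τ p) (update² τ p l₁ l₂)) (lookup∘update p τ l₂))) eq
    ... | refl = b ∷ bs , l , eq₁ , cong (λ τ → (bs ʳ++ b ∷ _) ∷ _ ∷ τ)
      (trans (cong (_[ p ]≔ l) (update² τ p l₁ l₂)) (update² τ p l₂ l))

  decode-complete : ∀ (p : Fin k) bs {l u} v τ → lookup τ p ≡ frame bs ++ l →
                    SRun≤ (decode p) (u ∷ v ∷ τ) ((bs ʳ++ u) ∷ v ∷ (τ [ p ]≔ l)) (2 + length bs * 5)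
  decode-complete p bs {l} {u} v τ eq = weaken (≤-reflexive (+-comm _ 1))
    (cast (cong (λ τ → u ∷ v ∷ τ) (trans (cong (τ [ p ]≔_) (sym eq)) ([]≔-lookup τ p))) refl (loop bs) ⨾
     atom≤ (l , lookup∘update p τ (false ∷ l) , cong (λ τ → (bs ʳ++ u) ∷ v ∷ τ) (sym (update² τ p (false ∷ l) l))))
    where
    loop : ∀ bs {u} → SRun≤ ((at p ↑ true ∙ ⋃ (λ b → at p ↑ b ∙ U ↓ b)) *)
             (u ∷ v ∷ (τ [ p ]≔ (frame bs ++ l))) ((bs ʳ++ u) ∷ v ∷ (τ [ p ]≔ (false ∷ l))) (1 + length bs * 5)
    loop []           = stop≤
    loop (b ∷ bs) {u} = iter≤
      (atom≤ (b ∷ frame bs ++ l , lookup∘update p τ _ , refl) ⨾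
       alt≤ b (atom≤ (frame bs ++ l , trans (cong (λ τ → lookup τ p) (update² τ p _ (b ∷ frame bs ++ l)))
           (lookup∘update p τ _) ,
                      cong (λ τ → u ∷ v ∷ τ) (sym (trans (cong (_[ p ]≔ (frame bs ++ l))
                          (update² τ p _ (b ∷ frame bs ++ l))) (update² τ p (b ∷ frame bs ++ l) _)))) ⨾
                atom≤ (_ , refl , refl)))
      (loop bs)

  zeros-ʳ++ : ∀ k l → zeros k ʳ++ l ≡ zeros k ++ l
  zeros-ʳ++ zero    l = refl
  zeros-ʳ++ (suc k) l = trans (zeros-ʳ++ k (false ∷ l)) (shift k)
    where
    shift : ∀ k → zeros k ++ false ∷ l ≡ false ∷ zeros k ++ l
    shift zero    = refl
    shift (suc k) = cong (false ∷_) (shift k)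

  padded : ∀ k l {m} → (zeros k ++ (l ʳ++ [])) ʳ++ m ≡ l ++ (zeros k ++ m)
  padded k l {m} = begin
    (zeros k ++ (l ʳ++ [])) ʳ++ m  ≡⟨ ++-ʳ++ (zeros k) ⟩
    (l ʳ++ []) ʳ++ (zeros k ʳ++ m) ≡⟨ ʳ++-ʳ++ l ⟩
    l ++ (zeros k ʳ++ m)           ≡⟨ cong (l ++_) (zeros-ʳ++ k m) ⟩
    l ++ (zeros k ++ m)            ∎
    where open ≡-Reasoning

  -- Padding preserves the value, so any number of zeros is harmless for soundness; for completeness
  -- the number is guessed that gives the operands the lengths which the arithmetic demands.
  pad : Prog (StackAtom (2 + k))
  pad = (V ↓ false) *

  pad-sound : ∀ {τ : Vec (List Bool) k} → SRun pad (u ∷ v ∷ τ) σ′ n → ∃[ k ] σ′ ≡ u ∷ (zeros k ++ v) ∷ τ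
  pad-sound stop = 0 , refl
  pad-sound {v = v} (iter (atom (_ , refl , refl)) r) with pad-sound r
  ... | k , refl = suc k , cong (λ l → _ ∷ l ∷ _) (trans (sym (zeros-ʳ++ k (false ∷ v))) (zeros-ʳ++ (suc k) v))

  pad-complete : ∀ j u {v} (τ : Vec (List Bool) k) → SRun≤ pad (u ∷ v ∷ τ) (u ∷ (zeros j ++ v) ∷ τ) (1 + j * 2)
  pad-complete zero    u τ = stop≤
  pad-complete (suc j) u {v} τ = cast refl (cong (λ l → u ∷ l ∷ τ)
      (trans (sym (zeros-ʳ++ j (false ∷ v))) (zeros-ʳ++ (suc j) v)))
    (iter≤ (atom≤ (_ , refl , refl)) (pad-complete j u τ))

  load : Fin k → Fin k → Prog (StackAtom (2 + k))
  load q p = dup q ∙ pad ∙ move V (at p)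

  load-sound : ∀ {q p : Fin k} {τ} → SRun (load q p) ([] ∷ [] ∷ τ) σ′ n →
               ∃[ j ] σ′ ≡ [] ∷ [] ∷ (τ [ p ]≔ (lookup τ q ++ (zeros j ++ lookup τ p)))
  load-sound {q = q} {p} {τ} (seq d (seq r m)) with dup-sound d
  ... | refl with pad-sound r
  ... | j , refl = j , trans
    (move-sound {i = V} {j = at p} (λ ()) {zeros j ++ (lookup τ q ʳ++ [])} {lookup τ p}
        ([] ∷ (zeros j ++ (lookup τ q ʳ++ [])) ∷ τ)
      (from (cong (λ τ → [] ∷ _ ∷ τ) (sym ([]≔-lookup τ p))) m))
    (cong (λ l → [] ∷ [] ∷ (τ [ p ]≔ l)) (padded j (lookup τ q)))

  load-complete : ∀ j (q p : Fin k) τ → SRun≤ (load q p) ([] ∷ [] ∷ τ)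
                  ([] ∷ [] ∷ (τ [ p ]≔ (lookup τ q ++ (zeros j ++ lookup τ p))))
                      (7 + length (lookup τ q) * 17 + j * 8)
  load-complete j q p τ = weaken (≤-reflexive cost)
    (dup-complete q [] τ ⨾ pad-complete j [] τ ⨾
     cast (cong (λ τ → [] ∷ w ∷ τ) ([]≔-lookup τ p)) (cong (λ l → [] ∷ [] ∷ (τ [ p ]≔ l)) (padded j (lookup τ q)))
       (move-complete {i = V} {j = at p} (λ ()) w {lookup τ p} ([] ∷ w ∷ τ)))
    where
    w = zeros j ++ (lookup τ q ʳ++ [])
    a = length (lookup τ q)
    cost : 4 + a * 11 + (1 + j * 2 + (2 + length w * 6)) ≡ 7 + a * 17 + j * 8
    cost = trans (cong (λ n → 4 + a * 11 + (1 + j * 2 + (2 + n * 6)))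
        (trans (length-++ (zeros j)) (cong₂ _+_ (length-replicate j)
            (trans (length-ʳ++ (lookup τ q)) (+-identityʳ a)))))
      (solve 2 (λ a j → con 4 :+ a :* con 11 :+ (con 1 :+ j :* con 2 :+ (con 2 :+ (j :+ a) :* con 6)) := con 7 :+ a
          :* con 17 :+ j :* con 8) refl a j)

  poured-ʳ++ : ∀ f l {m s} → poured f (l ʳ++ m) s ≡ poured f m (concatMap f l ++ s)
  poured-ʳ++ f []      = refl
  poured-ʳ++ f (b ∷ l) {m} {s} = trans (poured-ʳ++ f l) (cong (poured f m) (sym (++-assoc (f b) (concatMap f l) s)))

  -- A code is built from its end: first the closing 0, then the digits from the most significant
  -- one on, in the order in which `dup` leaves them.
  emitℕ : Fin k → Fin k → Prog (StackAtom (2 + k))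
  emitℕ q p = dup q ∙ at p ↓ false ∙ pour V (at p) (λ b → true ∷ b ∷ [])

  emitted : ∀ l {s} → poured (λ b → true ∷ b ∷ []) (l ʳ++ []) (false ∷ s) ≡ frame l ++ s
  emitted l {s} = trans (poured-ʳ++ _ l) (sym (++-assoc (concatMap (λ b → true ∷ b ∷ []) l) (false ∷ []) s))

  emitℕ-sound : ∀ {q p : Fin k} {τ} → SRun (emitℕ q p) ([] ∷ [] ∷ τ) σ′ n →
                σ′ ≡ [] ∷ [] ∷ (τ [ p ]≔ (frame (lookup τ q) ++ lookup τ p))
  emitℕ-sound {q = q} {p} {τ} (seq d (seq (atom (_ , refl , refl)) r)) with dup-sound d
  ... | refl = trans
    (pour-sound {i = V} {j = at p} (λ ()) (λ b → true ∷ b ∷ []) {x = lookup τ q ʳ++ []} {y = false ∷ lookup τ p}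
        ([] ∷ (lookup τ q ʳ++ []) ∷ τ) r)
    (cong (λ l → [] ∷ [] ∷ (τ [ p ]≔ l)) (emitted (lookup τ q)))

  emitℕ-complete : ∀ (q p : Fin k) τ → SRun≤ (emitℕ q p) ([] ∷ [] ∷ τ)
                   ([] ∷ [] ∷ (τ [ p ]≔ (frame (lookup τ q) ++ lookup τ p))) (7 + length (lookup τ q) * 17)
  emitℕ-complete q p τ = weaken (≤-reflexive cost)
    (dup-complete q [] τ ⨾ atom≤ (_ , refl , refl) ⨾
     cast refl (cong (λ l → [] ∷ [] ∷ (τ [ p ]≔ l)) (emitted l))
       (pour-complete {i = V} {j = at p} (λ ()) (λ b → true ∷ b ∷ []) (λ _ → ≤-refl) (l ʳ++ [])
           {false ∷ lookup τ p} ([] ∷ (l ʳ++ []) ∷ τ)))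
    where
    l = lookup τ q
    a = length l
    cost : 4 + a * 11 + (1 + (2 + length (l ʳ++ []) * 6)) ≡ 7 + a * 17
    cost = trans (cong (λ n → 4 + a * 11 + (1 + (2 + n * 6))) (trans (length-ʳ++ l) (+-identityʳ a)))
      (solve 1 (λ a → con 4 :+ a :* con 11 :+ (con 3 :+ a :* con 6) := con 7 :+ a :* con 17) refl a)

  pattern W = suc (suc zero)
  pattern X = suc (suc (suc zero))
  pattern Y = suc (suc (suc (suc zero)))
  pattern Z = suc (suc (suc (suc (suc zero))))
  pattern T′ = suc (suc (suc (suc (suc (suc zero)))))

  private variable
    w x y z t : List Bool

  addStep : Bool → Bool → Bool → Bool → Prog (StackAtom (6 + k))
  addStep d a b c = Y ↑ a ∙ Z ↑ b ∙ W ↑ c ∙ V ↓ a ∙ W ↓ (c xor ((d ∧ a) xor b)) ∙ W ↓ maj c (d ∧ a) b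

  -- The emptiness tests force operands of equal length. `y` is saved on `V` and restored, as it is
  -- the multiplicand of all rounds.
  addLoop addition : Bool → Prog (StackAtom (6 + k))
  addLoop d = ⋃ (λ a → ⋃ λ b → ⋃ λ c → addStep d a b c) *
  addition d = W ↓ false ∙ addLoop d ∙ Y ↓∅ ∙ Z ↓∅ ∙ move V Y ∙ move W Z

  -- The current carry is on top of the digits of the sum produced so far.
  addLoop-sound : ∀ d c {τ : Vec (List Bool) k} {σ₁ σ₂ l m n} →
    SRun (addLoop d) (u ∷ v ∷ (c ∷ w) ∷ x ∷ y ∷ z ∷ τ) σ₁ l → SRun (Y ↓∅) σ₁ σ₂ m → SRun (Z ↓∅) σ₂ σ′ n →
    length y ≡ length z × σ′ ≡ u ∷ (y ʳ++ v) ∷ (add d c y z ʳ++ w) ∷ x ∷ [] ∷ [] ∷ τ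
  addLoop-sound d c stop (atom (_ , (refl , refl) , refl)) (atom (_ , (refl , refl) , refl)) = refl , refl
  addLoop-sound d c (iter (alt a (alt b (alt _ (seq (atom (_ , refl , refl))
      (seq (atom (_ , refl , refl)) (seq (atom (_ , refl , refl))
    (seq (atom (_ , refl , refl)) (seq (atom (_ , refl , refl)) (atom (_ , refl , refl)))))))))) r) e e′
    with addLoop-sound d _ r e e′
  ... | eq , refl = cong suc eq , refl

  addLoop-complete : ∀ d c v w y z → length y ≡ length z → ∀ {τ : Vec (List Bool) k} →
    SRun≤ (addLoop d) (u ∷ v ∷ (c ∷ w) ∷ x ∷ y ∷ z ∷ τ) (u ∷ (y ʳ++ v) ∷ (add d c y z ʳ++ w) ∷ x ∷ [] ∷ [] ∷ τ)
        (1 + length y * 10)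
  addLoop-complete d c v w []      []      _  = stop≤
  addLoop-complete d c v w (a ∷ y) (b ∷ z) eq = iter≤
    (alt≤ a (alt≤ b (alt≤ c (atom≤ (_ , refl , refl) ⨾ atom≤ (_ , refl , refl) ⨾ atom≤ (_ , refl , refl) ⨾
      atom≤ (_ , refl , refl) ⨾ atom≤ (_ , refl , refl) ⨾ atom≤ (_ , refl , refl)))))
    (addLoop-complete d _ _ _ y z (suc-injective eq))

  addition-sound : ∀ d {τ : Vec (List Bool) k} →
    SRun (addition d) (u ∷ [] ∷ [] ∷ x ∷ y ∷ z ∷ τ) σ′ n →
    length y ≡ length z × σ′ ≡ u ∷ [] ∷ [] ∷ x ∷ y ∷ add d false y z ∷ τ
  addition-sound {u = u} {x = x} {y = y} {z = z} d {τ}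
      (seq (atom (_ , refl , refl)) (seq r (seq e (seq e′ (seq m m′)))))
    with addLoop-sound d false r e e′
  ... | eq , refl with move-sound {i = V} {j = Y} (λ ()) {reverse y} {[]}
      (u ∷ reverse y ∷ reverse (add d false y z) ∷ x ∷ [] ∷ [] ∷ τ) m
  ... | refl with move-sound {i = W} {j = Z} (λ ()) {reverse (add d false y z)} {[]}
      (u ∷ [] ∷ reverse (add d false y z) ∷ x ∷ (reverse y ʳ++ []) ∷ [] ∷ τ) m′
  ... | refl = eq , cong₂ (λ y z → u ∷ [] ∷ [] ∷ x ∷ y ∷ z ∷ τ) (reverse-involutive y)
      (reverse-involutive (add d false y z))

  addition-complete : ∀ d y z → length y ≡ length z → ∀ {τ : Vec (List Bool) k} →
    SRun≤ (addition d) (u ∷ [] ∷ [] ∷ x ∷ y ∷ z ∷ τ) (u ∷ [] ∷ [] ∷ x ∷ y ∷ add d false y z ∷ τ)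
        (14 + length y * 22)
  addition-complete {u = u} {x = x} d y z eq {τ} = weaken (≤-reflexive cost)
    (atom≤ (_ , refl , refl) ⨾ addLoop-complete d false [] [] y z eq ⨾
     empty-complete Y _ refl ⨾ empty-complete Z _ refl ⨾
     move-complete {i = V} {j = Y} (λ ()) (reverse y) {[]} (u ∷ reverse y ∷ reverse s ∷ x ∷ [] ∷ [] ∷ τ) ⨾
     cast refl (cong₂ (λ y z → u ∷ [] ∷ [] ∷ x ∷ y ∷ z ∷ τ) (reverse-involutive y) (reverse-involutive s))
       (move-complete {i = W} {j = Z} (λ ()) (reverse s) {[]}
           (u ∷ [] ∷ reverse s ∷ x ∷ (reverse y ʳ++ []) ∷ [] ∷ τ)))
    where
    s = add d false y z
    a = length y
    cost : 1 + (1 + a * 10 + (1 + (1 + (2 + length (reverse y) * 6 + (2 + length (reverse s) * 6))))) ≡ 14 + a * 22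
    cost = trans (cong₂ (λ m n → 1 + (1 + a * 10 + (1 + (1 + (2 + m * 6 + (2 + n * 6))))))
        (length-reverse y) (trans (length-reverse s) (trans (length-add d false y z eq) (cong suc (sym eq)))))
      (solve 1 (λ a → con 2 :+ a :* con 10 :+ (con 4 :+ a :* con 6 :+ (con 2 :+ (con 1 :+ a) :* con 6)) := con 14
          :+ a :* con 22) refl a)

  -- x * y + z = t is checked from the least significant digit of x on: with
  -- x = d + 2 x′ the last digits of d * y + z and t have to agree, and they are
  -- dropped together with d.
  fmaStep : Prog (StackAtom (7 + k))
  fmaStep = ⋃ λ d → X ↑ d ∙ addition d ∙ ⋃ λ e → Z ↑ e ∙ T′ ↑ e

  same : Prog (StackAtom (7 + k))
  same = ⋃ (λ b → Z ↑ b ∙ T′ ↑ b) *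

  fma : Prog (StackAtom (7 + k))
  fma = fmaStep * ∙ X ↓∅ ∙ same ∙ Z ↓∅ ∙ T′ ↓∅ ∙ clear Y

  same-sound : ∀ {τ : Vec (List Bool) k} {σ₁ σ₂ l m n} → SRun same (u ∷ v ∷ w ∷ x ∷ y ∷ z ∷ t ∷ τ) σ₁ l →
      SRun (Z ↓∅) σ₁ σ₂ m → SRun (T′ ↓∅) σ₂ σ′ n →
    z ≡ t × σ′ ≡ u ∷ v ∷ w ∷ x ∷ y ∷ [] ∷ [] ∷ τ
  same-sound stop (atom (_ , (refl , refl) , refl)) (atom (_ , (refl , refl) , refl)) = refl , refl
  same-sound (iter (alt b (seq (atom (_ , refl , refl)) (atom (_ , refl , refl)))) r) e e′ with same-sound r e e′
  ... | refl , refl = refl , refl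

  same-complete : ∀ z {τ : Vec (List Bool) k} → SRun≤ same (u ∷ v ∷ w ∷ x ∷ y ∷ z ∷ z ∷ τ)
      (u ∷ v ∷ w ∷ x ∷ y ∷ [] ∷ [] ∷ τ) (1 + length z * 4)
  same-complete []      = stop≤
  same-complete (b ∷ z) = iter≤ (alt≤ b (atom≤ (_ , refl , refl) ⨾ atom≤ (_ , refl , refl))) (same-complete z)

  -- One round of `fma`: the row of the digit `D`, and twice the contribution of the later digits.
  digit-split : ∀ D X Y Z → (D + 2 * X) * Y + Z ≡ (D * Y + Z + 0) + 2 * (X * Y)
  digit-split = solve 4 (λ D X Y Z → (D :+ con 2 :* X) :* Y :+ Z := (D :* Y :+ Z :+ con 0) :+ con 2 :* (X :* Y))
      refl

  digit-join : ∀ e Z P → (e + 2 * Z) + 2 * P ≡ e + 2 * (P + Z)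
  digit-join = solve 3 (λ e Z P → (e :+ con 2 :* Z) :+ con 2 :* P := e :+ con 2 :* (P :+ Z)) refl

  fma-sound : ∀ {τ : Vec (List Bool) k} → SRun fma ([] ∷ [] ∷ [] ∷ x ∷ y ∷ z ∷ t ∷ τ) σ′ n →
              val x * val y + val z ≡ val t × σ′ ≡ [] ∷ [] ∷ [] ∷ [] ∷ [] ∷ [] ∷ [] ∷ τ
  fma-sound {k} {σ′ = σ′} (seq l f) = loop l f
    where
    loop : ∀ {τ : Vec (List Bool) k} {x y z t σ m n} → SRun (fmaStep *) ([] ∷ [] ∷ [] ∷ x ∷ y ∷ z ∷ t ∷ τ) σ m →
           SRun (X ↓∅ ∙ same ∙ Z ↓∅ ∙ T′ ↓∅ ∙ clear Y) σ σ′ n →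
           val x * val y + val z ≡ val t × σ′ ≡ [] ∷ [] ∷ [] ∷ [] ∷ [] ∷ [] ∷ [] ∷ τ
    loop stop (seq (atom (_ , (refl , refl) , refl)) (seq s (seq e (seq e′ c)))) with same-sound s e e′
    ... | refl , refl = refl , clear-sound {i = Y} c
    loop {x = .d ∷ x} {y} {z} {t} (iter (alt d (seq (atom (_ , refl , refl)) (seq r (alt e s)))) l) f
        with addition-sound d r
    loop {x = .d ∷ x} {y} {z} {.e ∷ t} (iter (alt d
        (seq (atom (_ , refl , refl)) (seq r (alt e (seq (atom (z′ , eq , refl)) (atom (_ , refl , refl))))))) l) f
      | len , refl with loop l f
    ... | ih , refl = (begin
      (bitℕ d + 2 * val x) * val y + val z               ≡⟨ digit-split (bitℕ d) (val x) (val y) (val z) ⟩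
      (bitℕ d * val y + val z + 0) + 2 * (val x * val y)
          ≡⟨ cong (_+ 2 * (val x * val y)) (val-add d false y z len) ⟨
      val (add d false y z) + 2 * (val x * val y)        ≡⟨ cong (λ l → val l + 2 * (val x * val y)) eq ⟩
      (bitℕ e + 2 * val z′) + 2 * (val x * val y)        ≡⟨ digit-join (bitℕ e) (val z′) (val x * val y) ⟩
      bitℕ e + 2 * (val x * val y + val z′)              ≡⟨ cong (λ n → bitℕ e + 2 * n) ih ⟩
      bitℕ e + 2 * val t                                 ∎) , refl
      where open ≡-Reasoning

  -- Before each round `z` has `L` digits; a row yields `L + 1`, and dropping the last one restores
  -- `L`. In the end `z` and the remaining `L` digits of `t` have the same length and value, so they
  -- agree as strings, which is what `same` tests.
  fma-complete : ∀ L x y z t → length y ≡ L → length z ≡ L → length t ≡ length x + L →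
                 val x * val y + val z ≡ val t → ∀ {τ : Vec (List Bool) k} →
                 SRun≤ fma ([] ∷ [] ∷ [] ∷ x ∷ y ∷ z ∷ t ∷ τ) ([] ∷ [] ∷ [] ∷ [] ∷ [] ∷ [] ∷ [] ∷ τ)
                   (length x * (20 + L * 22) + (7 + L * 7))
  fma-complete {k} L x y z t refl lz lt eq {τ} with loop x z t lz lt eq
    where
    loop : ∀ x z t → length z ≡ length y → length t ≡ length x + length y → val x * val y + val z ≡ val t →
           ∃[ z′ ] length z′ ≡ length y × SRun≤ (fmaStep *) ([] ∷ [] ∷ [] ∷ x ∷ y ∷ z ∷ t ∷ τ)
               ([] ∷ [] ∷ [] ∷ [] ∷ y ∷ z′ ∷ z′ ∷ τ)
             (1 + length x * (20 + length y * 22))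
    loop [] z t lz lt eq with val-injective z t (trans lz (sym lt)) eq
    ... | refl = z , lz , stop≤
    loop (d ∷ x) z (e′ ∷ t) lz lt eq
      with add d false y z in eqa | length-add d false y z (sym lz) | val-add d false y z (sym lz)
    ... | e ∷ z₁ | ls | vs with bitℕ-injective e e′ (begin
        bitℕ e + 2 * (val x * val y + val z₁)              ≡⟨ digit-join (bitℕ e) (val z₁) (val x * val y) ⟨
        (bitℕ e + 2 * val z₁) + 2 * (val x * val y)        ≡⟨ cong (_+ 2 * (val x * val y)) vs ⟩
        (bitℕ d * val y + val z + 0) + 2 * (val x * val y) ≡⟨ digit-split (bitℕ d) (val x) (val y) (val z) ⟨
        (bitℕ d + 2 * val x) * val y + val z               ≡⟨ eq ⟩
        bitℕ e′ + 2 * val t                                ∎)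
      where open ≡-Reasoning
    ... | refl , eq′ with loop x z₁ t (trans (suc-injective ls) lz) (suc-injective lt) eq′
    ... | z′ , lz′ , r = z′ , lz′ , weaken (≤-reflexive
        (cong suc (cost′ (length y * 22) (length x * (20 + length y * 22)))))
      (iter≤ (alt≤ d (atom≤ (_ , refl , refl) ⨾ cast refl (cong (λ s → [] ∷ [] ∷ [] ∷ x ∷ y ∷ s ∷ (e ∷ t) ∷ τ) eqa)
          (addition-complete d y z (sym lz)) ⨾
        alt≤ e (atom≤ (_ , refl , refl) ⨾ atom≤ (_ , refl , refl)))) r)
      where
      cost′ : ∀ a b → suc (1 + (14 + a + 3)) + (1 + b) ≡ 20 + a + b
      cost′ = solve 2 (λ a b → con 2 :+ (con 14 :+ a :+ con 3) :+ (con 1 :+ b) := con 20 :+ a :+ b) refl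
  ... | z′ , lz′ , r = weaken (≤-reflexive cost)
    (r ⨾ empty-complete X _ refl ⨾ same-complete z′ ⨾ empty-complete Z _ refl ⨾ empty-complete T′ _ refl ⨾
     clear-complete Y _)
    where
    cost : 1 + length x * (20 + length y * 22) + (1 + (1 + length z′ * 4 + (1 + (1 + (2 + length y * 3))))) ≡
        length x * (20 + length y * 22) + (7 + length y * 7)
    cost rewrite lz′ = solve 2 (λ a l → con 1 :+ a :+ (con 2 :+ l :* con 4 :+ (con 4 :+ l :* con 3)) := a :+
        (con 7 :+ l :* con 7)) refl (length x * (20 + length y * 22)) (length y)

open Routines

-- Number registers and items

data Kind : Set where
  value exists forbidden : Kind

Item : Set
Item = Kind × ℕ × ℕ

kind₁ kind₂ : Kind → Bool
kind₁ value     = false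
kind₁ exists    = false
kind₁ forbidden = true
kind₂ value     = false
kind₂ exists    = true
kind₂ forbidden = true

kind-injective : ∀ k l → kind₁ k ≡ kind₁ l → kind₂ k ≡ kind₂ l → k ≡ l
kind-injective value     value     _ _ = refl
kind-injective exists    exists    _ _ = refl
kind-injective forbidden forbidden _ _ = refl
kind-injective value     exists    _ ()
kind-injective value     forbidden ()
kind-injective exists    value     _ ()
kind-injective exists    forbidden ()
kind-injective forbidden value     ()
kind-injective forbidden exists    ()

serialise : List Item → List Bool
serialise []                = []
serialise ((k , g , n) ∷ s) = kind₁ k ∷ kind₂ k ∷ encodeℕ g ++ encodeℕ n ++ serialise s

-- `check` is the only arithmetic test: with guessed numbers it covers sums, products, exact
-- quotients, equality, order and, by way of `nonzero`, inequality.
data Command (m : ℕ) : Set where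
  lit         : Bool → Command m
  eof swap    : Command m
  read guess  : Fin m → Command m
  nonzero     : Fin m → Command m
  check       : (a b c d : Fin m) → Command m
  emit fetch  : Kind → (g n : Fin m) → Command m

-- The registers, the unread input, and the items of the current and of the
-- next pass.
State : ℕ → Set
State m = Vec ℕ m × List Bool × List Item × List Item

module _ {m : ℕ} (Small Few : ℕ → Set) where

  -- The size conditions are parameters because soundness takes them to be trivial, whereas the cost
  -- of a command is bounded only under `n < 2 ^ L` and `_≤ M`.
  data Effect : Semantics (Command m) (State m) where
    lit     : ∀ {ns b i s s′} → Effect (lit b) (ns , b ∷ i , s , s′) (ns , i , s , s′)
    eof     : ∀ {ns s s′} → Effect eof (ns , [] , s , s′) (ns , [] , s , s′)
    swap    : ∀ {ns i s′} → Few (length s′) → Effect swap (ns , i , [] , s′) (ns , i , s′ , [])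
    read    : ∀ {ns r i i′ s s′} n → Small n → i ≡ encodeℕ n ++ i′ →
              Effect (read r) (ns , i , s , s′) (ns [ r ]≔ n , i′ , s , s′)
    guess   : ∀ {ns r i s s′} n → Small n → Effect (guess r) (ns , i , s , s′) (ns [ r ]≔ n , i , s , s′)
    nonzero : ∀ {ns r i s s′} → lookup ns r ≢ 0 → Effect (nonzero r) (ns , i , s , s′) (ns , i , s , s′)
    check   : ∀ {ns a b c d i s s′} → lookup ns a * lookup ns b + lookup ns c ≡ lookup ns d →
              Effect (check a b c d) (ns , i , s , s′) (ns , i , s , s′)
    emit    : ∀ {ns k p q i s s′} → Effect (emit k p q) (ns , i , s , s′)
        (ns , i , s , (k , lookup ns p , lookup ns q) ∷ s′)
    fetch   : ∀ {ns k p q g n i s s′} → Effect (fetch k p q) (ns , i , (k , g , n) ∷ s , s′)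
        ((ns [ p ]≔ g) [ q ]≔ n , i , s , s′)

pattern I  = suc (suc (suc (suc (suc zero))))
pattern S  = suc (suc (suc (suc (suc (suc zero)))))
pattern S′ = suc (suc (suc (suc (suc (suc (suc zero))))))
pattern reg r = suc (suc (suc (suc (suc (suc (suc (suc r)))))))

finish-decoded : ∀ {k} l {v} {τ : Vec (List Bool) k} {q σ′ n} → SRun (finish q) ((l ʳ++ []) ∷ v ∷ τ) σ′ n →
                 ∃[ x ] l ≡ digits x × σ′ ≡ [] ∷ v ∷ (τ [ q ]≔ digits x)
finish-decoded l r with finish-sound r
... | x , eq , e = x , trans (sym (reverse-involutive l)) eq , e

module _ {m : ℕ} where

  realise : Command m → Prog (StackAtom (10 + m))
  realise (lit b)         = at I ↑ b
  realise eof             = at I ↓∅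
  -- Each move reverses, so two of them keep the codes readable.
  realise swap            = at S ↓∅ ∙ move (at S′) U ∙ move U (at S)
  realise (read r)        = decode I ∙ finish (reg r)
  realise (guess r)       = scribble ∙ finish (reg r)
  -- Registers hold canonical numerals, so a number is nonzero exactly when there is a digit to pop.
  realise (nonzero r)     = ⋃ λ b → at (reg r) ↑ b ∙ at (reg r) ↓ b
  realise (check a b c d) =
    load (reg a) (suc zero) ∙ load (reg b) (suc (suc zero)) ∙ load (reg c) (suc (suc (suc zero))) ∙
    load (reg d) (suc (suc (suc (suc zero)))) ∙ fma
  realise (emit k p q)    = emitℕ (reg q) S′ ∙ emitℕ (reg p) S′ ∙ write (at S′) (kind₁ k ∷ kind₂ k ∷ [])
  realise (fetch k p q)   = at S ↑ kind₁ k ∙ at S ↑ kind₂ k ∙ decode S ∙ finish (reg p) ∙ decode S ∙ finish (reg q)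

  layout : List Bool → List Bool → List Bool → Vec (List Bool) m → Vec (List Bool) (10 + m)
  layout i s s′ rs = [] ∷ [] ∷ [] ∷ [] ∷ [] ∷ [] ∷ [] ∷ i ∷ s ∷ s′ ∷ rs

  represent : State m → Vec (List Bool) (10 + m)
  represent (ns , i , s , s′) = layout i (serialise s) (serialise s′) (Vec.map digits ns)

  val-loaded : ∀ (ns : Vec ℕ m) r j → val (lookup (Vec.map digits ns) r ++ zeros j ++ []) ≡ lookup ns r
  val-loaded ns r j = begin
    val (lookup (Vec.map digits ns) r ++ zeros j ++ [])
        ≡⟨ cong₂ (λ l l′ → val (l ++ l′)) (lookup-map r digits ns) (++-identityʳ (zeros j)) ⟩
    val (digits (lookup ns r) ++ zeros j)               ≡⟨ val-zeros (digits (lookup ns r)) j ⟩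
    val (digits (lookup ns r))                          ≡⟨ val-digits (lookup ns r) ⟩
    lookup ns r                                         ∎
    where open ≡-Reasoning

  module _ {Small Few : ℕ → Set} (small : ∀ n → Small n) (few : ∀ n → Few n) where

    realise-sound : ∀ c {h σ n} → SRun (realise c) (represent h) σ n →
                    ∃[ h′ ] Effect Small Few c h h′ × σ ≡ represent h′
    realise-sound (lit b) (atom (i , refl , refl)) = _ , lit , refl
    realise-sound eof (atom (_ , (refl , refl) , refl)) = _ , eof , refl
    realise-sound swap {ns , i , [] , s′} (seq (atom (_ , (refl , refl) , refl)) (seq r r′))
      with move-sound {i = at S′} {j = U} (λ ()) {serialise s′} {[]} (represent (ns , i , [] , s′)) r
    ... | refl with move-sound {i = U} {j = at S} (λ ()) {reverse (serialise s′)} {[]}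
      (reverse (serialise s′) ∷ [] ∷ [] ∷ [] ∷ [] ∷ [] ∷ [] ∷ i ∷ [] ∷ [] ∷ Vec.map digits ns) r′
    ... | refl = _ , swap (few _) , cong (λ l → layout i l [] (Vec.map digits ns))
        (reverse-involutive (serialise s′))
    realise-sound swap {ns , i , _ ∷ _ , s′} (seq (atom (_ , (() , _) , _)) _)
    realise-sound (read r) {ns , _ , s , s′} (seq d e) with decode-sound d
    ... | bs , i , eq , refl with finish-decoded bs e
    ... | n , refl , refl = _ , read n (small n) eq , cong (layout i _ _) (sym (map-[]≔ digits ns r))
    realise-sound (guess r) {ns , _ , s , s′} (seq d e) with scribble-sound d
    ... | _ , refl with finish-sound e
    ... | n , _ , refl = _ , guess n (small n) , cong (layout _ _ _) (sym (map-[]≔ digits ns r))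
    realise-sound (nonzero r) {ns , i , s , s′} (alt b (seq (atom (l , eq , refl)) (atom (_ , refl , refl)))) =
      _ , nonzero (λ eq′ → case (trans (sym (trans (lookup-map r digits ns) (cong digits eq′))) eq)) ,
      cong (layout _ _ _) (trans (cong (λ l′ → (rs [ r ]≔ l) [ r ]≔ (b ∷ l′)) (lookup∘update r rs l))
        (trans (update² rs r l (b ∷ l)) (trans (cong (rs [ r ]≔_) (sym eq)) ([]≔-lookup rs r))))
      where
      rs = Vec.map digits ns
      case : [] ≡ b ∷ l → ⊥
      case ()
    realise-sound (check a b c d) {ns , _} (seq la (seq lb (seq lc (seq ld f)))) with load-sound {p = suc zero} la
    ... | ja , refl with load-sound {p = suc (suc zero)} lb
    ... | jb , refl with load-sound {p = suc (suc (suc zero))} lc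
    ... | jc , refl with load-sound {p = suc (suc (suc (suc zero)))} ld
    ... | jd , refl with fma-sound f
    ... | eq , refl = _ , check (trans (sym (cong₂ _+_ (cong₂ _*_ (val-loaded ns a ja) (val-loaded ns b jb))
        (val-loaded ns c jc)))
                                  (trans eq (val-loaded ns d jd))) , refl
    realise-sound (emit k p q) {ns , i , s , s′} (seq e (seq e′ w)) with emitℕ-sound e
    ... | refl with emitℕ-sound e′
    ... | refl with write-sound (kind₁ k ∷ kind₂ k ∷ []) w
    ... | refl = _ , emit , cong (λ l → layout _ _ (kind₁ k ∷ kind₂ k ∷ l) _)
      (cong₂ (λ g n → frame g ++ frame n ++ serialise s′) (lookup-map p digits ns) (lookup-map q digits ns))
    realise-sound (fetch k p q) {ns , i , [] , s′} (seq (atom (_ , () , _)) _)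
    realise-sound (fetch k p q) {ns , i , (k′ , g , x) ∷ s , s′}
      (seq (atom (_ , eq , refl)) (seq (atom (_ , eq′ , refl)) (seq d (seq f (seq d′ f′))))) with ∷-injective eq
    ... | k₁ , refl with ∷-injective eq′
    ... | k₂ , refl with kind-injective k′ k k₁ k₂
    ... | refl with decode-sound {p = S} d
    ... | bs , l , e , refl with frame-injective (digits g) bs e
    ... | refl , refl with finish-decoded (digits g) f
    ... | g′ , e₁ , refl with digits-injective {g} {g′} e₁
    ... | refl with decode-sound {p = S} d′
    ... | bs′ , l′ , e′ , refl with frame-injective (digits x) bs′ e′
    ... | refl , refl with finish-decoded (digits x) f′
    ... | x′ , e₂ , refl with digits-injective {x} {x′} e₂
    ... | refl = _ , fetch , cong (layout _ _ _) (sym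
        (trans (map-[]≔ digits (ns [ p ]≔ g) q) (cong (_[ q ]≔ digits x) (map-[]≔ digits ns p))))

  module _ (L M : ℕ) where

    Short : ℕ → Set
    Short n = n < 2 ^ L

    ShortItem : Item → Set
    ShortItem (_ , g , n) = Short g × Short n

    Fits : State m → Set
    Fits (ns , _ , s , s′) = (∀ r → Short (lookup ns r)) × All ShortItem s × All ShortItem s′

    Represents : State m → Vec (List Bool) (10 + m) → Set
    Represents h σ = σ ≡ represent h × Fits h

    -- The first three terms are the cost of `check`, quadratic because of the multiplication. The
    -- last one is due to `swap`, which moves up to `M` items of at most `4 + L * 4` bits twice, at
    -- 6 transitions per bit.
    effort : ℕ
    effort = 35 + L * 127 + L * L * 22 + M * (1 + L) * 48

    private
      short-update : ∀ (ns : Vec ℕ m) r {n} → (∀ q → Short (lookup ns q)) → Short n → ∀ q →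
          Short (lookup (ns [ r ]≔ n) q)
      short-update ns r {n} hs h q with r Fin.≟ q
      ... | yes refl = subst Short (sym (lookup∘update r ns n)) h
      ... | no r≢q   = subst Short (sym (lookup∘update′ (≢-sym r≢q) ns n)) (hs q)

      digits≤ : ∀ {n} → Short n → length (digits n) ≤ L
      digits≤ {n} = length-digits n L

      reg≤ : ∀ (ns : Vec ℕ m) r → (∀ q → Short (lookup ns q)) → length (lookup (Vec.map digits ns) r) ≤ L
      reg≤ ns r hs = subst (λ l → length l ≤ L) (sym (lookup-map r digits ns)) (digits≤ (hs r))

      digits-reg≤ : ∀ (ns : Vec ℕ m) r q {n} → (∀ q → Short (lookup ns q)) → Short n →
                    length (lookup (Vec.map digits ns [ r ]≔ digits n) q) ≤ L
      digits-reg≤ ns r q {n} hs h = subst (λ l → length (lookup l q) ≤ L) (map-[]≔ digits ns r)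
          (reg≤ (ns [ r ]≔ n) q (short-update ns r hs h))

      linear : ∀ a b {a≤35 : Bool.T (a ≤ᵇ 35)} {b≤127 : Bool.T (b ≤ᵇ 127)} → a + L * b ≤ effort
      linear a b {p} {q} = ≤-trans (+-mono-≤ (≤ᵇ⇒≤ a 35 p) (*-monoʳ-≤ L (≤ᵇ⇒≤ b 127 q)))
        (≤-trans (m≤m+n _ (L * L * 22)) (m≤m+n _ (M * (1 + L) * 48)))

      constant : ∀ a {a≤35 : Bool.T (a ≤ᵇ 35)} → a ≤ effort
      constant a {p} = ≤-trans (m≤m+n a (L * 0)) (linear a 0 {p})

      length-serialise : ∀ s → All ShortItem s → length (serialise s) ≤ length s * (4 + L * 4)
      length-serialise [] _ = z≤n
      length-serialise ((k , g , n) ∷ s) ((hg , hn) ∷ hs) = begin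
        2 + length (encodeℕ g ++ encodeℕ n ++ serialise s)
          ≡⟨ cong (2 +_) (trans (length-++ (encodeℕ g)) (cong (length (encodeℕ g) +_) (length-++ (encodeℕ n)))) ⟩
        2 + (length (encodeℕ g) + (length (encodeℕ n) + length (serialise s)))
          ≤⟨ +-monoʳ-≤ 2 (+-mono-≤ (encode≤ hg) (+-mono-≤ (encode≤ hn) (length-serialise s hs))) ⟩
        2 + (1 + L * 2 + (1 + L * 2 + length s * (4 + L * 4)))
          ≡⟨ solve 2 (λ L s → con 2 :+ (con 1 :+ L :* con 2 :+ (con 1 :+ L :* con 2 :+ s)) := con 4 :+ L :* con 4
              :+ s) refl L (length s * (4 + L * 4)) ⟩
        4 + L * 4 + length s * (4 + L * 4) ∎
        where
        open ≤-Reasoning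
        encode≤ : ∀ {n} → Short n → length (encodeℕ n) ≤ 1 + L * 2
        encode≤ {n} h = ≤-trans (≤-reflexive (length-frame (digits n))) (s≤s (*-monoˡ-≤ 2 (digits≤ h)))

      length-loaded : ∀ (ns : Vec ℕ m) r j {a} → length (lookup (Vec.map digits ns) r) ≡ a →
          length (lookup (Vec.map digits ns) r ++ zeros j ++ []) ≡ a + j
      length-loaded ns r j eq = trans (length-++ (lookup (Vec.map digits ns) r))
          (cong₂ _+_ eq (trans (cong length (++-identityʳ (zeros j))) (length-replicate j)))

    realise-complete : ∀ c {h h′ σ} → Represents h σ → Effect Short (_≤ M) c h h′ →
                       ∃[ σ′ ] SRun≤ (realise c) σ σ′ effort × Represents h′ σ′
    realise-complete (lit b) (refl , fits) lit = _ , weaken (constant 1) (atom≤ (_ , refl , refl)) , refl , fits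
    realise-complete eof (refl , fits) eof = _ , weaken (constant 1) (atom≤ (_ , (refl , refl) , refl)) , refl ,
        fits
    realise-complete swap {ns , i , _ , s′} (refl , hs , _ , hs′) (swap few) = _ , weaken cost
      (empty-complete (at S) _ refl ⨾
       move-complete {i = at S′} {j = U} (λ ()) l {[]} (represent (ns , i , [] , s′)) ⨾
       cast refl (cong (λ l → layout i l [] (Vec.map digits ns)) (reverse-involutive l))
         (move-complete {i = U} {j = at S} (λ ()) (reverse l) {[]}
           (reverse l ∷ [] ∷ [] ∷ [] ∷ [] ∷ [] ∷ [] ∷ i ∷ [] ∷ [] ∷ Vec.map digits ns))) , refl , hs , hs′ , []
      where
      l = serialise s′
      l≤ : length l ≤ M * (4 + L * 4)
      l≤ = ≤-trans (length-serialise s′ hs′) (*-monoˡ-≤ (4 + L * 4) few)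
      cost : 1 + (2 + length l * 6 + (2 + length (reverse l) * 6)) ≤ effort
      cost = begin
        1 + (2 + length l * 6 + (2 + length (reverse l) * 6))
            ≡⟨ cong (λ n → 1 + (2 + length l * 6 + (2 + n * 6))) (length-reverse l) ⟩
        1 + (2 + length l * 6 + (2 + length l * 6))
            ≡⟨ solve 1 (λ n → con 1 :+ (con 2 :+ n :* con 6 :+ (con 2 :+ n :* con 6)) := con 5 :+ n :* con 12) refl
            (length l) ⟩
        5 + length l * 12
            ≤⟨ +-mono-≤ {5} (s≤s (s≤s (s≤s (s≤s (s≤s z≤n))))) (*-monoˡ-≤ 12 l≤) ⟩
        35 + M * (4 + L * 4) * 12
            ≡⟨ cong (35 +_) (solve 2 (λ M L → M :* (con 4 :+ L :* con 4) :* con 12 := M :* (con 1 :+ L) :* con 48)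
            refl M L) ⟩
        35 + M * (1 + L) * 48
            ≤⟨ +-monoˡ-≤ (M * (1 + L) * 48) (≤-trans (m≤m+n 35 (L * 127)) (m≤m+n _ (L * L * 22))) ⟩
        effort                                                ∎
        where open ≤-Reasoning
    realise-complete (read r) {ns , _ , s , s′} (refl , hs , ss) (read {i = i} {i′} n h eq) = _ , weaken cost
      (decode-complete I (digits n) {i′} [] ([] ∷ [] ∷ [] ∷ [] ∷ [] ∷ i ∷ serialise s ∷ serialise s′ ∷
          Vec.map digits ns) eq ⨾
       cast refl (cong (layout i′ _ _) (sym (map-[]≔ digits ns r)))
         (finish-complete (reg r) n [] ([] ∷ [] ∷ [] ∷ [] ∷ [] ∷ i′ ∷ serialise s ∷ serialise s′ ∷
             Vec.map digits ns))) ,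
      refl , short-update ns r hs h , ss
      where
      cost : 2 + length (digits n) * 5 + (7 + length (lookup (Vec.map digits ns) r) * 3 + length (digits n) * 6) ≤
          effort
      cost = ≤-trans (+-mono-≤ (+-monoʳ-≤ 2 (*-monoˡ-≤ 5 (digits≤ h)))
          (+-mono-≤ (+-monoʳ-≤ 7 (*-monoˡ-≤ 3 (reg≤ ns r hs))) (*-monoˡ-≤ 6 (digits≤ h))))
        (≤-trans (≤-reflexive (solve 1 (λ L → con 2 :+ L :* con 5 :+ (con 7 :+ L :* con 3 :+ L :* con 6) := con 9
            :+ L :* con 14) refl L)) (linear 9 14))
    realise-complete (guess r) {ns , i , s , s′} (refl , hs , ss) (guess n h) = _ , weaken cost
      (scribble-complete (digits n) {[]} ([] ∷ [] ∷ [] ∷ [] ∷ [] ∷ [] ∷ i ∷ serialise s ∷ serialise s′ ∷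
          Vec.map digits ns) ⨾
       cast refl (cong (layout i _ _) (sym (map-[]≔ digits ns r)))
         (finish-complete (reg r) n [] ([] ∷ [] ∷ [] ∷ [] ∷ [] ∷ i ∷ serialise s ∷ serialise s′ ∷
             Vec.map digits ns))) ,
      refl , short-update ns r hs h , ss
      where
      cost : 1 + length (digits n) * 3 + (7 + length (lookup (Vec.map digits ns) r) * 3 + length (digits n) * 6) ≤
          effort
      cost = ≤-trans (+-mono-≤ (+-monoʳ-≤ 1 (*-monoˡ-≤ 3 (digits≤ h)))
          (+-mono-≤ (+-monoʳ-≤ 7 (*-monoˡ-≤ 3 (reg≤ ns r hs))) (*-monoˡ-≤ 6 (digits≤ h))))
        (≤-trans (≤-reflexive (solve 1 (λ L → con 1 :+ L :* con 3 :+ (con 7 :+ L :* con 3 :+ L :* con 6) := con 8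
            :+ L :* con 12) refl L)) (linear 8 12))
    realise-complete (nonzero r) {ns , i , s , s′} (refl , fits) (nonzero ≢0) with lookup (Vec.map digits ns) r in
        eq
    ... | [] = ⊥-elim (≢0 (digits-injective {n = 0} (trans (sym (lookup-map r digits ns)) eq)))
    ... | b ∷ l = _ , weaken (constant 3) (alt≤ b (atom≤ (l , eq , refl) ⨾ atom≤ (_ , refl , refl))) ,
      cong (layout i _ _) (trans (cong (λ l′ → (rs [ r ]≔ l) [ r ]≔ (b ∷ l′)) (lookup∘update r rs l))
        (trans (update² rs r l (b ∷ l)) (trans (cong (rs [ r ]≔_) (sym eq)) ([]≔-lookup rs r)))) , fits
      where rs = Vec.map digits ns
    realise-complete (check a b c d) {ns , i , s , s′} (refl , fits) (check eq) = _ , weaken cost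
      (load-complete 0 (reg a) (suc zero) τ ⨾
       load-complete jb (reg b) (suc (suc zero)) ([] ∷ x ∷ [] ∷ [] ∷ [] ∷ τ′) ⨾
       load-complete jc (reg c) (suc (suc (suc zero))) ([] ∷ x ∷ y ∷ [] ∷ [] ∷ τ′) ⨾
       load-complete jd (reg d) (suc (suc (suc (suc zero)))) ([] ∷ x ∷ y ∷ z ∷ [] ∷ τ′) ⨾
       fma-complete L x y z t
         (trans (length-loaded ns b jb refl) (m+[n∸m]≡n (reg≤ ns b hs)))
             (trans (length-loaded ns c jc refl) (m+[n∸m]≡n (reg≤ ns c hs)))
         (trans (length-loaded ns d jd refl) (trans (m+[n∸m]≡n (m≤n⇒m≤o+n A (reg≤ ns d hs)))
           (cong (_+ L) (sym (trans (length-loaded ns a 0 refl) (+-identityʳ A))))))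
         (trans (cong₂ _+_ (cong₂ _*_ (val-loaded ns a 0) (val-loaded ns b jb)) (val-loaded ns c jc))
             (trans eq (sym (val-loaded ns d jd))))) ,
      refl , fits
      where
      hs = proj₁ fits
      rs = Vec.map digits ns
      τ′ = i ∷ serialise s ∷ serialise s′ ∷ rs
      τ = [] ∷ [] ∷ [] ∷ [] ∷ [] ∷ τ′
      A = length (lookup rs a)
      -- The guessed padding brings `y` and `z` to `L` digits and `t` to `length x + L`.
      jb = L ∸ length (lookup rs b)
      jc = L ∸ length (lookup rs c)
      jd = A + L ∸ length (lookup rs d)
      x = lookup rs a ++ zeros 0 ++ []
      y = lookup rs b ++ zeros jb ++ []
      z = lookup rs c ++ zeros jc ++ []
      t = lookup rs d ++ zeros jd ++ []
      x≤ : length x ≤ L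
      x≤ = ≤-trans (≤-reflexive (trans (length-loaded ns a 0 refl) (+-identityʳ A))) (reg≤ ns a hs)
      load≤ : ∀ r j {J} → j ≤ J → 7 + length (lookup rs r) * 17 + j * 8 ≤ 7 + L * 17 + J * 8
      load≤ r j j≤ = +-mono-≤ (+-monoʳ-≤ 7 (*-monoˡ-≤ 17 (reg≤ ns r hs))) (*-monoˡ-≤ 8 j≤)
      cost : 7 + A * 17 + 0 * 8 + (7 + length (lookup rs b) * 17 + jb * 8 +
          (7 + length (lookup rs c) * 17 + jc * 8 +
        (7 + length (lookup rs d) * 17 + jd * 8 + (length x * (20 + L * 22) + (7 + L * 7))))) ≤ effort
      cost = begin
        _ ≤⟨ +-mono-≤ (load≤ a 0 {0} z≤n) (+-mono-≤ (load≤ b jb (m∸n≤m L (length (lookup rs b))))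
            (+-mono-≤ (load≤ c jc (m∸n≤m L (length (lookup rs c))))
               (+-mono-≤ (load≤ d jd (≤-trans (m∸n≤m (A + L) (length (lookup rs d))) (+-monoˡ-≤ L (reg≤ ns a hs))))
                 (+-monoˡ-≤ (7 + L * 7) (*-monoˡ-≤ (20 + L * 22) x≤))))) ⟩
        7 + L * 17 + 0 * 8 + (7 + L * 17 + L * 8 +
            (7 + L * 17 + L * 8 + (7 + L * 17 + (L + L) * 8 + (L * (20 + L * 22) + (7 + L * 7)))))
          ≡⟨ solve 1 (λ L → con 7 :+ L :* con 17 :+ con 0 :+
              (con 7 :+ L :* con 17 :+ L :* con 8 :+ (con 7 :+ L :* con 17 :+ L :* con 8 :+
               (con 7 :+ L :* con 17 :+ (L :+ L) :* con 8 :+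
                   (L :* (con 20 :+ L :* con 22) :+ (con 7 :+ L :* con 7))))) :=
               con 35 :+ L :* con 127 :+ L :* L :* con 22) refl L ⟩
        35 + L * 127 + L * L * 22 ≤⟨ m≤m+n _ _ ⟩
        effort ∎
        where open ≤-Reasoning
    realise-complete (emit k p q) {ns , i , s , s′} (refl , hs , ss , ss′) emit = _ , weaken cost
      (emitℕ-complete (reg q) S′ ([] ∷ [] ∷ [] ∷ [] ∷ [] ∷ i ∷ serialise s ∷ serialise s′ ∷ rs) ⨾
       emitℕ-complete (reg p) S′ ([] ∷ [] ∷ [] ∷ [] ∷ [] ∷ i ∷ serialise s ∷
           (frame (lookup rs q) ++ serialise s′) ∷ rs) ⨾
       cast refl (cong (λ l → layout i (serialise s) (kind₁ k ∷ kind₂ k ∷ l) rs)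
           (cong₂ (λ g n → frame g ++ frame n ++ serialise s′) (lookup-map p digits ns) (lookup-map q digits ns)))
         (write-complete (at S′) (kind₁ k ∷ kind₂ k ∷ [])
             (layout i (serialise s) (frame (lookup rs p) ++ (frame (lookup rs q) ++ serialise s′)) rs))) ,
      refl , hs , ss , (hs p , hs q) ∷ ss′
      where
      rs = Vec.map digits ns
      cost : 7 + length (lookup rs q) * 17 + (7 + length (lookup rs p) * 17 + 3) ≤ effort
      cost = ≤-trans (+-mono-≤ (+-monoʳ-≤ 7 (*-monoˡ-≤ 17 (reg≤ ns q hs)))
          (+-monoˡ-≤ 3 (+-monoʳ-≤ 7 (*-monoˡ-≤ 17 (reg≤ ns p hs)))))
        (≤-trans (≤-reflexive (solve 1 (λ L → con 7 :+ L :* con 17 :+ (con 7 :+ L :* con 17 :+ con 3) := con 17 :+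
            L :* con 34) refl L)) (linear 17 34))
    realise-complete (fetch k p q) {ns , i , _ , s′} (refl , hs , (hg , hn) ∷ ss , ss′)
        (fetch {g = g} {n} {s = s}) = _ , weaken cost
      (atom≤ (_ , refl , refl) ⨾ atom≤ (_ , refl , refl) ⨾
       decode-complete S (digits g) [] ([] ∷ [] ∷ [] ∷ [] ∷ [] ∷ i ∷ _ ∷ serialise s′ ∷ rs) refl ⨾
       finish-complete (reg p) g [] ([] ∷ [] ∷ [] ∷ [] ∷ [] ∷ i ∷ (encodeℕ n ++ serialise s) ∷ serialise s′ ∷ rs) ⨾
       decode-complete S (digits n) [] ([] ∷ [] ∷ [] ∷ [] ∷ [] ∷ i ∷ (encodeℕ n ++ serialise s) ∷ serialise s′ ∷
           (rs [ p ]≔ digits g)) refl ⨾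
       cast refl (cong (layout i (serialise s) (serialise s′))
           (sym (trans (map-[]≔ digits (ns [ p ]≔ g) q) (cong (_[ q ]≔ digits n) (map-[]≔ digits ns p)))))
         (finish-complete (reg q) n [] ([] ∷ [] ∷ [] ∷ [] ∷ [] ∷ i ∷ serialise s ∷ serialise s′ ∷
             (rs [ p ]≔ digits g)))) ,
      refl , short-update (ns [ p ]≔ g) q (short-update ns p hs hg) hn , ss , ss′
      where
      rs = Vec.map digits ns
      G = length (digits g)
      N = length (digits n)
      cost : 1 + (1 + (2 + G * 5 + (7 + length (lookup rs p) * 3 + G * 6 +
          (2 + N * 5 + (7 + length (lookup (rs [ p ]≔ digits g) q) * 3 + N * 6))))) ≤ effort
      cost = ≤-trans (+-monoʳ-≤ 2 (+-mono-≤ (+-monoʳ-≤ 2 (*-monoˡ-≤ 5 (digits≤ hg)))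
          (+-mono-≤ (+-mono-≤ (+-monoʳ-≤ 7 (*-monoˡ-≤ 3 (reg≤ ns p hs))) (*-monoˡ-≤ 6 (digits≤ hg)))
            (+-mono-≤ (+-monoʳ-≤ 2 (*-monoˡ-≤ 5 (digits≤ hn)))
              (+-mono-≤ (+-monoʳ-≤ 7 (*-monoˡ-≤ 3 (digits-reg≤ ns p q hs hg))) (*-monoˡ-≤ 6 (digits≤ hn)))))))
        (≤-trans (≤-reflexive (solve 1 (λ L → con 2 :+ (con 2 :+ L :* con 5 :+ (con 7 :+ L :* con 3 :+ L :* con 6 :+
            (con 2 :+ L :* con 5 :+ (con 7 :+ L :* con 3 :+ L :* con 6)))) := con 20 :+ L :* con 28) refl L))
                (linear 20 28))

-- The algorithm

𝒪 : List Operation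
𝒪 = binary union ∷ binary intersection ∷ binary sum ∷ binary product ∷ binary quotient ∷ []

∈𝒪 : ∀ σ → binary σ ∈ˡ 𝒪
∈𝒪 union        = here refl
∈𝒪 intersection = there (here refl)
∈𝒪 sum          = there (there (here refl))
∈𝒪 product      = there (there (there (here refl)))
∈𝒪 quotient     = there (there (there (there (here refl))))

complement∉𝒪 : complement ∉ 𝒪
complement∉𝒪 (there (there (there (there (there ())))))

Zero One Bound Name Left Right Item₁ Item₂ Tmp₁ Tmp₂ : Fin 10
Zero  = # 0
One   = # 1
Bound = # 2
Name  = # 3
Left  = # 4
Right = # 5
Item₁ = # 6
Item₂ = # 7
Tmp₁  = # 8
Tmp₂  = # 9

Algorithm : Set
Algorithm = Prog (Command 10)

equate : Fin 10 → Fin 10 → Algorithm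
equate p q = ‵ check One p Zero q

lits : List Bool → Algorithm
lits []       = ε
lits (b ∷ bs) = ‵ lit b ∙ lits bs

-- The registers Left and Right hold the predecessors of the current gate,
-- or Left holds its value if it is an input gate, and Item₂ holds an element
-- of its result set.
expand : BinaryOp → Algorithm
expand union        = ‵ emit value Left Item₂ ∪ ‵ emit value Right Item₂
expand intersection = ‵ emit value Left Item₂ ∙ ‵ emit value Right Item₂
expand sum          = ‵ guess Tmp₁ ∙ ‵ guess Tmp₂ ∙ ‵ check One Tmp₁ Tmp₂ Item₂ ∙ ‵ emit value Left Tmp₁ ∙ ‵ emit
    value Right Tmp₂
expand product      = ‵ guess Tmp₁ ∙ ‵ guess Tmp₂ ∙ ‵ check Tmp₁ Tmp₂ Zero Item₂ ∙ ‵ emit value Left Tmp₁ ∙ ‵ emit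
    value Right Tmp₂
expand quotient     = ‵ guess Tmp₁ ∙ ‵ guess Tmp₂ ∙ ‵ nonzero Tmp₂ ∙ ‵ check Item₂ Tmp₂ Zero Tmp₁ ∙ ‵ emit value
    Left Tmp₁ ∙ ‵ emit value Right Tmp₂

-- Inequality in existential form: a nonzero difference is guessed and added to the smaller of the
-- two names.
apart : Algorithm
apart = ‵ guess Tmp₁ ∙ ‵ nonzero Tmp₁ ∙ (‵ check One Item₁ Tmp₁ Name ∪ ‵ check One Name Tmp₁ Item₁)

keep : Kind → Algorithm
keep k = ‵ fetch k Item₁ Item₂ ∙ apart ∙ ‵ emit k Item₁ Item₂

discharge : Algorithm
discharge = ‵ fetch exists Item₁ Item₂ ∙ equate Item₁ Name

hit : Algorithm → Algorithm
hit e = ‵ fetch value Item₁ Item₂ ∙ equate Item₁ Name ∙ e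

-- A forbidden item on the current name fits no branch, and the `swap` after the pass insists that
-- no item is left. A repeated name therefore blocks the run.
treat pass : Algorithm → Algorithm
treat e = (keep value ∪ (keep exists ∪ keep forbidden)) ∪ (discharge ∪ hit e)
pass e = treat e *

inputGate : Algorithm
inputGate = lits (false ∷ []) ∙ ‵ read Left ∙ lits (false ∷ []) ∙ pass (equate Left Item₂) ∙ ‵ emit forbidden Name
    Name ∙ ‵ swap

-- `Tmp₁` witnesses that the predecessors are in order. The three last items are emitted even if the
-- gate is never hit, since gates without influence on the output must form a circuit too. They join
-- the list for the next pass and so concern later gates only.
binaryGate : BinaryOp → Algorithm
binaryGate σ = lits (true ∷ encodeOp σ) ∙ lits (true ∷ []) ∙ ‵ read Left ∙ lits (true ∷ []) ∙ ‵ read Right ∙ lits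
    (false ∷ []) ∙
  ‵ guess Tmp₁ ∙ ‵ check One Left Tmp₁ Right ∙ pass (expand σ) ∙
  ‵ emit exists Left Left ∙ ‵ emit exists Right Right ∙ ‵ emit forbidden Name Name ∙ ‵ swap

anyBinaryGate gate gates main : Algorithm
anyBinaryGate = binaryGate union ∪ (binaryGate intersection ∪
    (binaryGate sum ∪ (binaryGate product ∪ binaryGate quotient)))
gate = ‵ read Name ∙ (inputGate ∪ anyBinaryGate)
gates = (‵ lit true ∙ gate) *
-- 1 is the only nonzero solution of x * x = x.
main = ‵ guess One ∙ ‵ nonzero One ∙ ‵ check One One Zero One ∙
  -- The number `b` stands at the end of the input, so it is guessed now and compared after the
  -- gates.
  ‵ read Name ∙ ‵ guess Bound ∙ ‵ emit value Name Bound ∙ ‵ swap ∙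
  gates ∙ ‵ lit false ∙ ‵ read Item₂ ∙ equate Item₂ Bound ∙ ‵ eof ∙
  -- No gate follows, so every prohibition is met; the final `swap` tests that no other obligation
  -- remains.
  ‵ fetch forbidden Item₁ Item₂ * ∙ ‵ swap

-- The items of a state are obligations towards the gates still to be read.
Sat : Gates → Item → Set
Sat gs (value , g , v)     = Den gs g v
Sat gs (exists , g , _)    = g ∈ˡ names gs
Sat gs (forbidden , g , _) = g ∉ names gs

sat-∷ : ∀ k {g v h γ gs} → g ≢ h → Sat gs (k , g , v) → Sat ((h , γ) ∷ gs) (k , g , v)
sat-∷ value     g≢h d  = inj₂ (g≢h , d)
sat-∷ exists    g≢h g∈ = there g∈
sat-∷ forbidden g≢h g∉ = λ { (here g≡h) → g≢h g≡h ; (there g∈) → g∉ g∈ }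

pattern regs b n p q h v a c = 0 ∷ 1 ∷ b ∷ n ∷ p ∷ q ∷ h ∷ v ∷ a ∷ c ∷ []

equal⇒≡ : ∀ {p q} → 1 * p + 0 ≡ q → p ≡ q
equal⇒≡ {p} eq = trans (sym (trans (+-identityʳ _) (*-identityˡ p))) eq

two-code : ∀ p q i → true ∷ encodeℕ p ++ true ∷ encodeℕ q ++ false ∷ i ≡ encodeList encodeℕ (p ∷ q ∷ []) ++ i
two-code p q i = cong (true ∷_) (sym (begin
  ((encodeℕ p ++ (true ∷ encodeℕ q) ++ []) ++ false ∷ []) ++ i
      ≡⟨ ++-assoc (encodeℕ p ++ (true ∷ encodeℕ q) ++ []) (false ∷ []) i ⟩
  (encodeℕ p ++ (true ∷ encodeℕ q) ++ []) ++ false ∷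
      i         ≡⟨ ++-assoc (encodeℕ p) ((true ∷ encodeℕ q) ++ []) (false ∷ i) ⟩
  encodeℕ p ++ ((true ∷ encodeℕ q) ++ []) ++ false ∷
      i         ≡⟨ cong (λ l → encodeℕ p ++ l ++ false ∷ i) (++-identityʳ (true ∷ encodeℕ q)) ⟩
  encodeℕ p ++ true ∷ encodeℕ q ++ false ∷ i                   ∎))
  where open ≡-Reasoning

-- Soundness of the algorithm

module Soundness (Small Few : ℕ → Set) where

  ARun : Algorithm → State 10 → State 10 → ℕ → Set
  ARun = Run (Effect Small Few)

  lits-sound : ∀ bs {ns i s s′ t k} → ARun (lits bs) (ns , i , s , s′) t k → ∃[ i′ ] i ≡ bs ++ i′ ×
      t ≡ (ns , i′ , s , s′)
  lits-sound [] skip = _ , refl , refl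
  lits-sound (b ∷ bs) (seq (atom lit) r) with lits-sound bs r
  ... | i , refl , eq = i , refl , eq

  apart-sound : ∀ {b n p q h v a c i s s′ t k} → ARun apart (regs b n p q h v a c , i , s , s′) t k →
                h ≢ n × ∃[ a′ ] t ≡ (regs b n p q h v a′ c , i , s , s′)
  apart-sound {n = n} {h = h} (seq (atom (guess d _)) (seq (atom (nonzero d≢0)) (alt false (atom (check eq))))) =
    (λ { refl → d≢0 (m+n≡m⇒n≡0 h (trans (cong (_+ d) (sym (*-identityˡ h))) eq)) }) , _ , refl
    where
    m+n≡m⇒n≡0 : ∀ m {n} → m + n ≡ m → n ≡ 0
    m+n≡m⇒n≡0 m e = +-cancelˡ-≡ m _ 0 (trans e (sym (+-identityʳ m)))
  apart-sound {n = n} {h = h} (seq (atom (guess d _)) (seq (atom (nonzero d≢0)) (alt true (atom (check eq))))) =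
    (λ { refl → d≢0 (+-cancelˡ-≡ n _ 0 (trans (trans (cong (_+ d) (sym (*-identityˡ n))) eq)
        (sym (+-identityʳ n)))) }) , _ , refl

  keep-sound : ∀ κ {b n p q h v a c i s s′ t k} → ARun (keep κ) (regs b n p q h v a c , i , s , s′) t k →
               ∃₂ λ h′ v′ → ∃₂ λ a′ s₁ → h′ ≢ n × s ≡ (κ , h′ , v′) ∷ s₁ ×
                   t ≡ (regs b n p q h′ v′ a′ c , i , s₁ , (κ , h′ , v′) ∷ s′)
  keep-sound κ (seq (atom fetch) (seq r (atom e))) with apart-sound r
  keep-sound κ (seq (atom fetch) (seq r (atom emit))) | h≢n , _ , refl = _ , _ , _ , _ , h≢n , refl , refl

  module _ (e : Algorithm) (γ : Gate) {b n p q : ℕ}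
    (sound : ∀ {h v a c i s s′ t k} → ARun e (regs b n p q h v a c , i , s , s′) t k →
       ∃₂ λ a′ c′ → ∃[ s″ ] t ≡ (regs b n p q h v a′ c′ , i , s , s″) ×
         ∀ gs → All (Sat gs) s″ → All (Sat gs) s′ × evaluate γ (λ p _ → Den gs p) v) where

    -- The gates `gs` are still unread, so the specification runs backwards and quantifies over
    -- them: if they meet the obligations passed on, then they meet the earlier ones of the next
    -- pass, and the current gate put in front of them meets the treated item.
    treat-sound : ∀ {h v a c i s s′ t k} → ARun (treat e) (regs b n p q h v a c , i , s , s′) t k →
      ∃₂ λ h′ v′ → ∃₂ λ a′ c′ → ∃₂ λ s₁ s″ → t ≡ (regs b n p q h′ v′ a′ c′ , i , s₁ , s″) ×
         ∀ gs → All (Sat gs) s″ → All (Sat gs) s′ × (All (Sat ((n , γ) ∷ gs)) s₁ → All (Sat ((n , γ) ∷ gs)) s)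
    treat-sound (alt false (alt false r)) with keep-sound value r
    ... | _ , _ , _ , _ , h≢n , refl , refl = _ , _ , _ , _ , _ , _ , refl ,
        λ { gs (x ∷ xs) → xs , λ ys → sat-∷ value {γ = γ} h≢n x ∷ ys }
    treat-sound (alt false (alt true (alt false r))) with keep-sound exists r
    ... | _ , _ , _ , _ , h≢n , refl , refl = _ , _ , _ , _ , _ , _ , refl ,
        λ { gs (x ∷ xs) → xs , λ ys → sat-∷ exists {v = zero} {γ = γ} h≢n x ∷ ys }
    treat-sound (alt false (alt true (alt true r))) with keep-sound forbidden r
    ... | _ , _ , _ , _ , h≢n , refl , refl = _ , _ , _ , _ , _ , _ , refl ,
        λ { gs (x ∷ xs) → xs , λ ys → sat-∷ forbidden {v = zero} {γ = γ} h≢n x ∷ ys }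
    treat-sound (alt true (alt false (seq (atom fetch) (atom (check eq))))) =
      _ , _ , _ , _ , _ , _ , refl , λ gs xs → xs , λ ys → here (equal⇒≡ eq) ∷ ys
    treat-sound (alt true (alt true (seq (atom fetch) (seq (atom (check eq)) r)))) with sound r
    ... | _ , _ , _ , refl , f = _ , _ , _ , _ , _ , _ , refl ,
      λ gs xs → proj₁ (f gs xs) , λ ys → inj₁ (equal⇒≡ eq , proj₂ (f gs xs)) ∷ ys

    pass-sound : ∀ {h v a c i s s′ t k} → ARun (pass e) (regs b n p q h v a c , i , s , s′) t k →
      ∃₂ λ h′ v′ → ∃₂ λ a′ c′ → ∃₂ λ s₁ s″ → t ≡ (regs b n p q h′ v′ a′ c′ , i , s₁ , s″) ×
         ∀ gs → All (Sat gs) s″ → All (Sat gs) s′ × (All (Sat ((n , γ) ∷ gs)) s₁ → All (Sat ((n , γ) ∷ gs)) s)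
    pass-sound stop = _ , _ , _ , _ , _ , _ , refl , λ gs xs → xs , λ ys → ys
    pass-sound (iter r r′) with treat-sound r
    ... | _ , _ , _ , _ , _ , _ , refl , f with pass-sound r′
    ... | _ , _ , _ , _ , _ , _ , refl , f′ = _ , _ , _ , _ , _ , _ , refl , λ gs xs →
      proj₁ (f gs (proj₁ (f′ gs xs))) , proj₂ (f gs (proj₁ (f′ gs xs))) ∘ proj₂ (f′ gs xs)

  expand-sound : ∀ σ {b n p q h v a c i s s′ t k} → ARun (expand σ) (regs b n p q h v a c , i , s , s′) t k →
    ∃₂ λ a′ c′ → ∃[ s″ ] t ≡ (regs b n p q h v a′ c′ , i , s , s″) ×
      ∀ gs → All (Sat gs) s″ → All (Sat gs) s′ × apply σ (Den gs p) (Den gs q) v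
  expand-sound union (alt false (atom emit)) = _ , _ , _ , refl , λ { gs (x ∷ xs) → xs , inj₁ x }
  expand-sound union (alt true (atom emit)) = _ , _ , _ , refl , λ { gs (x ∷ xs) → xs , inj₂ x }
  expand-sound intersection (seq (atom emit) (atom emit)) = _ , _ , _ , refl , λ { gs (y ∷ x ∷ xs) → xs , x , y }
  expand-sound sum (seq (atom (guess a _)) (seq (atom (guess c _))
      (seq (atom (check eq)) (seq (atom emit) (atom emit))))) =
    _ , _ , _ , refl , λ { gs (y ∷ x ∷ xs) → xs , a , c , x , y , trans (sym eq) (cong (_+ c) (*-identityˡ a)) }
  expand-sound product (seq (atom (guess a _)) (seq (atom (guess c _))
      (seq (atom (check eq)) (seq (atom emit) (atom emit))))) =
    _ , _ , _ , refl , λ { gs (y ∷ x ∷ xs) → xs , a , c , x , y , trans (sym eq) (+-identityʳ (a * c)) }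
  expand-sound quotient (seq (atom (guess a _)) (seq (atom (guess c _))
      (seq (atom (nonzero c≢0)) (seq (atom (check eq)) (seq (atom emit) (atom emit)))))) =
    _ , _ , _ , refl , λ { gs (y ∷ x ∷ xs) → xs , a , c , x , y , c≢0 , trans (sym eq) (+-identityʳ _) }

  GateSpec : List Bool → ℕ → Gate → List Item → List Bool → List Item → Set
  GateSpec i g γ s i′ s″ = i ≡ encodeLabel γ ++ encodeList encodeℕ (predecessors γ) ++ i′ × Admissible 𝒪 γ ×
    ∀ gs → All (Sat gs) s″ → All (Sat ((g , γ) ∷ gs)) s × g ∉ names gs ×
        (∀ {p} → p ∈ˡ predecessors γ → p ∈ˡ names gs)

  inputGate-sound : ∀ {b n p q h v a c i s t k} → ARun inputGate (regs b n p q h v a c , i , s , []) t k →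
    ∃[ γ ] ∃₂ λ p′ q′ → ∃₂ λ h′ v′ → ∃₂ λ a′ c′ → ∃₂ λ i′ s″ → t ≡ (regs b n p′ q′ h′ v′ a′ c′ , i′ , s″ , []) ×
        GateSpec i n γ s i′ s″
  inputGate-sound {n = n} (seq l (seq (atom (read x _ refl)) (seq l′ (seq r rest)))) with lits-sound (false ∷ []) l
  ... | i₁ , refl , refl with lits-sound (false ∷ []) l′
  ... | i₂ , refl , refl with pass-sound (equate Left Item₂) (input x)
          (λ { (atom (check eq)) → _ , _ , _ , refl , λ gs xs → xs , equal⇒≡ eq }) r
  ... | _ , _ , _ , _ , _ , _ , refl , f with rest
  ... | seq (atom emit) (atom (swap _)) =
    input x , _ , _ , _ , _ , _ , _ , _ , _ , refl , refl , tt ,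
    λ { gs (x ∷ xs) → proj₂ (f gs xs) [] , x , λ () }

  binaryGate-sound : ∀ σ {b n p q h v a c i s t k} → ARun (binaryGate σ) (regs b n p q h v a c , i , s , []) t k →
    ∃[ γ ] ∃₂ λ p′ q′ → ∃₂ λ h′ v′ → ∃₂ λ a′ c′ → ∃₂ λ i′ s″ → t ≡ (regs b n p′ q′ h′ v′ a′ c′ , i′ , s″ , []) ×
        GateSpec i n γ s i′ s″
  binaryGate-sound σ {n = n} (seq l (seq l₁ (seq (atom (read p _ refl))
      (seq l₂ (seq (atom (read q _ refl)) (seq l₃ (seq (atom (guess d _))
      (seq (atom (check eq)) (seq r rest))))))))) with lits-sound (true ∷ encodeOp σ) l
  ... | i₁ , refl , refl with lits-sound (true ∷ []) l₁
  ... | i₂ , refl , refl with lits-sound (true ∷ []) l₂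
  ... | i₃ , refl , refl with lits-sound (false ∷ []) l₃
  ... | i₄ , refl , refl with pass-sound (expand σ) (binary σ p q) (expand-sound σ) r
  ... | _ , _ , _ , _ , _ , _ , refl , f with rest
  ... | seq (atom emit) (seq (atom emit) (seq (atom emit) (atom (swap _)))) =
    binary σ p q , _ , _ , _ , _ , _ , _ , _ , _ , refl ,
    cong (λ l → true ∷ encodeOp σ ++ l) (two-code p q i₄) , (∈𝒪 σ , p≤q) ,
    λ { gs (x ∷ y ∷ z ∷ xs) → proj₂ (f gs xs) [] , x , λ { (here refl) → z ; (there (here refl)) → y } }
    where
    p≤q : p ≤ q
    p≤q = subst (p ≤_) (trans (cong (_+ d) (sym (*-identityˡ p))) eq) (m≤m+n p d)

  gate-sound : ∀ {b n p q h v a c i s t k} → ARun gate (regs b n p q h v a c , i , s , []) t k →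
    ∃₂ λ g γ → ∃₂ λ p′ q′ → ∃₂ λ h′ v′ → ∃₂ λ a′ c′ → ∃[ i₁ ] ∃₂ λ i′ s″ →
        t ≡ (regs b g p′ q′ h′ v′ a′ c′ , i′ , s″ , []) ×
      i ≡ encodeℕ g ++ i₁ × GateSpec i₁ g γ s i′ s″
  gate-sound (seq (atom (read g _ e)) (alt false r)) with inputGate-sound r
  ... | γ , _ , _ , _ , _ , _ , _ , _ , _ , e′ , spec = g , γ , _ , _ , _ , _ , _ , _ , _ , _ , _ , e′ , e , spec
  gate-sound (seq (atom (read g _ e)) (alt true (alt false r))) with binaryGate-sound union r
  ... | γ , _ , _ , _ , _ , _ , _ , _ , _ , e′ , spec = g , γ , _ , _ , _ , _ , _ , _ , _ , _ , _ , e′ , e , spec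
  gate-sound (seq (atom (read g _ e)) (alt true (alt true (alt false r)))) with binaryGate-sound intersection r
  ... | γ , _ , _ , _ , _ , _ , _ , _ , _ , e′ , spec = g , γ , _ , _ , _ , _ , _ , _ , _ , _ , _ , e′ , e , spec
  gate-sound (seq (atom (read g _ e)) (alt true (alt true (alt true (alt false r))))) with binaryGate-sound sum r
  ... | γ , _ , _ , _ , _ , _ , _ , _ , _ , e′ , spec = g , γ , _ , _ , _ , _ , _ , _ , _ , _ , _ , e′ , e , spec
  gate-sound (seq (atom (read g _ e)) (alt true (alt true (alt true (alt true (alt false r))))))
      with binaryGate-sound product r
  ... | γ , _ , _ , _ , _ , _ , _ , _ , _ , e′ , spec = g , γ , _ , _ , _ , _ , _ , _ , _ , _ , _ , e′ , e , spec
  gate-sound (seq (atom (read g _ e)) (alt true (alt true (alt true (alt true (alt true r))))))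
      with binaryGate-sound quotient r
  ... | γ , _ , _ , _ , _ , _ , _ , _ , _ , e′ , spec = g , γ , _ , _ , _ , _ , _ , _ , _ , _ , _ , e′ , e , spec

  -- Truth of the obligations and validity are both established from the end of the list: what the
  -- last gates satisfy is pulled back through one gate after another.
  gates-sound : ∀ {b n p q h v a c i s t k} → ARun gates (regs b n p q h v a c , i , s , []) t k →
    ∃[ gs ] ∃₂ λ n′ p′ → ∃₂ λ q′ h′ → ∃₂ λ v′ a′ → ∃₂ λ c′ i′ →
        ∃[ s′ ] t ≡ (regs b n′ p′ q′ h′ v′ a′ c′ , i′ , s′ , []) ×
      i ≡ code gs ++ i′ × (All (Sat []) s′ → All (Sat gs) s × Valid 𝒪 gs)
  gates-sound stop = [] , _ , _ , _ , _ , _ , _ , _ , _ , _ , refl , refl , λ xs → xs , []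
  gates-sound (iter (seq (atom lit) r) r′) with gate-sound r
  ... | g , γ , _ , _ , _ , _ , _ , _ , i₁ , _ , _ , refl , refl , refl , adm , f with gates-sound r′
  ... | gs , _ , _ , _ , _ , _ , _ , _ , i′ , _ , refl , refl , f′ =
    (g , γ) ∷ gs , _ , _ , _ , _ , _ , _ , _ , _ , _ , refl ,
    cong (true ∷_) (begin
      encodeℕ g ++ encodeLabel γ ++ ps ++ code gs ++ i′
          ≡⟨ cong (encodeℕ g ++_) (++-assoc (encodeLabel γ) ps (code gs ++ i′)) ⟨
      encodeℕ g ++ (encodeLabel γ ++ ps) ++ code gs ++ i′
          ≡⟨ ++-assoc (encodeℕ g) (encodeLabel γ ++ ps) (code gs ++ i′) ⟨
      encodeGate (g , γ) ++ code gs ++ i′                    ≡⟨ ++-assoc (encodeGate (g , γ)) (code gs) i′ ⟨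
      (encodeGate (g , γ) ++ code gs) ++ i′                  ∎) ,
    λ xs → let ys , valid = f′ xs
               zs , g∉ , cl = f gs ys
           in zs , cons g∉ cl adm valid
    where
    open ≡-Reasoning
    ps = encodeList encodeℕ (predecessors γ)

  forbidden-sound : ∀ {b n p q h v a c i s s′ t k} →
      ARun (‵ fetch forbidden Item₁ Item₂ *) (regs b n p q h v a c , i , s , s′) t k →
    ∃₂ λ h′ v′ → ∃[ s₁ ] t ≡ (regs b n p q h′ v′ a c , i , s₁ , s′) × (All (Sat []) s₁ → All (Sat []) s)
  forbidden-sound stop = _ , _ , _ , refl , λ xs → xs
  forbidden-sound (iter (atom fetch) r) with forbidden-sound r
  ... | _ , _ , _ , refl , f = _ , _ , _ , refl , λ xs → (λ ()) ∷ f xs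

  x*x≡x⇒x≡1 : ∀ x → x ≢ 0 → x * x + 0 ≡ x → x ≡ 1
  x*x≡x⇒x≡1 zero    x≢0 eq = ⊥-elim (x≢0 refl)
  x*x≡x⇒x≡1 (suc x) x≢0 eq = *-cancelˡ-≡ (suc x) 1 (suc x)
      (trans (sym (+-identityʳ _)) (trans eq (sym (*-identityʳ (suc x)))))

  main-sound : ∀ {w t k} → ARun main (Vec.replicate 10 0 , w , [] , []) t k → GateListCode {𝒪} w
  main-sound (seq (atom (guess x _)) (seq (atom (nonzero x≢0)) (seq (atom (check eq)) rest))) with x*x≡x⇒x≡1 x x≢0
      eq
  ... | refl with rest
  ... | seq (atom (read out _ refl)) (seq (atom (guess b _)) (seq (atom emit) (seq (atom (swap _)) (seq r rest′))))
      with gates-sound r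
  ... | gs , _ , _ , _ , _ , _ , _ , _ , _ , _ , refl , refl , f with rest′
  ... | seq (atom lit) (seq (atom (read b′ _ refl)) (seq (atom (check eq′)) (seq (atom eof) (seq r′ rest″))))
      with forbidden-sound r′
  ... | _ , _ , _ , refl , f′ with rest″
  ... | atom (swap _) with equal⇒≡ {b′} eq′ | f (f′ [])
  ... | refl | (d ∷ []) , valid = gs , out , b , valid , d ,
    cong (encodeℕ out ++_) (trans (cong (λ l → code gs ++ false ∷ l) (++-identityʳ (encodeℕ b)))
        (sym (++-assoc (code gs) (false ∷ []) (encodeℕ b))))

-- Completeness of the algorithm and its cost

module Completeness (L M : ℕ) where

  Small : ℕ → Set
  Small n = n < 2 ^ L

  ARun≤ : Algorithm → State 10 → State 10 → ℕ → Set
  ARun≤ = Run≤ (Effect Small (_≤ M))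

  -- Names have to be small because `apart` guesses their differences.
  Good : Gates → Item → Set
  Good gs it = Sat gs it × Small (proj₁ (proj₂ it))

  lits-complete : ∀ bs {ns i s s′} → ARun≤ (lits bs) (ns , bs ++ i , s , s′) (ns , i , s , s′) (1 + length bs)
  lits-complete []       = skip≤
  lits-complete (b ∷ bs) = atom≤ lit ⨾ lits-complete bs

  1*m+n∸m≡n : ∀ {m n} → m ≤ n → 1 * m + (n ∸ m) ≡ n
  1*m+n∸m≡n {m} {n} m≤n = trans (cong (_+ (n ∸ m)) (*-identityˡ m)) (m+[n∸m]≡n m≤n)

  ≡⇒equal : ∀ {p} → 1 * p + 0 ≡ p
  ≡⇒equal {p} = trans (+-identityʳ _) (*-identityˡ p)

  apart-complete : ∀ {b n p q h v a c i s s′} → h ≢ n → Small h → Small n →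
                   ∃[ a′ ] ARun≤ apart (regs b n p q h v a c , i , s , s′) (regs b n p q h v a′ c , i , s , s′) 4
  apart-complete {n = n} {h = h} h≢n sh sn with <-cmp h n
  ... | tri< h<n _ _ = n ∸ h ,
    atom≤ (guess (n ∸ h) (≤-<-trans (m∸n≤m n h) sn)) ⨾ atom≤ (nonzero (m>n⇒m∸n≢0 h<n)) ⨾
        alt≤ false (atom≤ (check (1*m+n∸m≡n (<⇒≤ h<n))))
  ... | tri≈ _ h≡n _ = ⊥-elim (h≢n h≡n)
  ... | tri> _ _ n<h = h ∸ n ,
    atom≤ (guess (h ∸ n) (≤-<-trans (m∸n≤m h n) sh)) ⨾ atom≤ (nonzero (m>n⇒m∸n≢0 n<h)) ⨾
        alt≤ true (atom≤ (check (1*m+n∸m≡n (<⇒≤ n<h))))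

  keep-complete : ∀ κ {b n p q h v a c i s s′ g x} → g ≢ n → Small g → Small n →
                  ∃[ a′ ] ARun≤ (keep κ) (regs b n p q h v a c , i , (κ , g , x) ∷ s , s′)
                      (regs b n p q g x a′ c , i , s , (κ , g , x) ∷ s′) 6
  keep-complete κ g≢n sg sn with apart-complete g≢n sg sn
  ... | a′ , r = a′ , (atom≤ fetch ⨾ r ⨾ atom≤ emit)

  keep-treat : ∀ κ {e s t} → ARun≤ (keep κ) s t 6 → ARun≤ (treat e) s t 10
  keep-treat value     r = weaken (s≤s (s≤s (s≤s (s≤s (s≤s (s≤s (s≤s (s≤s z≤n)))))))) (alt≤ false (alt≤ false r))
  keep-treat exists    r = weaken (s≤s (s≤s (s≤s (s≤s (s≤s (s≤s (s≤s (s≤s (s≤s z≤n)))))))))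
      (alt≤ false (alt≤ true (alt≤ false r)))
  keep-treat forbidden r = weaken (s≤s (s≤s (s≤s (s≤s (s≤s (s≤s (s≤s (s≤s (s≤s z≤n)))))))))
      (alt≤ false (alt≤ true (alt≤ true r)))

  module _ (e : Algorithm) (γ : Gate) (gs : Gates) {b n p q : ℕ} (sn : Small n)
    (complete : ∀ {h v a c i s s′} → evaluate γ (λ p _ → Den gs p) v →
       ∃₂ λ a′ c′ → ∃[ new ] ARun≤ e (regs b n p q h v a c , i , s , s′)
           (regs b n p q h v a′ c′ , i , s , new ++ s′) 6 ×
         All (Good gs) new × length new ≤ 2) where

    private
      Treated : ∀ (h v a c : ℕ) (i : List Bool) (it : Item) (s s′ : List Item) → Set
      Treated h v a c i it s s′ = ∃₂ λ h′ v′ → ∃₂ λ a′ c′ → ∃[ new ]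
        ARun≤ (treat e) (regs b n p q h v a c , i , it ∷ s , s′) (regs b n p q h′ v′ a′ c′ , i , s , new ++ s′) 10 ×
          All (Good gs) new × length new ≤ 2

    kept : ∀ κ {h v a c i s s′ g x} → g ≢ n → Sat gs (κ , g , x) → Small g → Treated h v a c i (κ , g , x) s s′
    kept κ g≢n sat sg with keep-complete κ g≢n sg sn
    ... | a′ , r = _ , _ , a′ , _ , _ ∷ [] , keep-treat κ r , (sat , sg) ∷ [] , s≤s z≤n

    discharged : ∀ {h v a c i s s′ x} → Treated h v a c i (exists , n , x) s s′
    discharged = _ , _ , _ , _ , [] ,
      weaken (s≤s (s≤s (s≤s (s≤s z≤n)))) (alt≤ true (alt≤ false (atom≤ fetch ⨾ atom≤ (check ≡⇒equal)))) , [] , z≤n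

    treat-complete : ∀ {h v a c i s s′} it → Good ((n , γ) ∷ gs) it → Treated h v a c i it s s′
    treat-complete (value , g , x) (inj₁ (refl , ev) , _) with complete ev
    ... | a′ , c′ , new , r , good , len = _ , _ , a′ , c′ , new ,
      alt≤ true (alt≤ true (atom≤ fetch ⨾ atom≤ (check ≡⇒equal) ⨾ r)) , good , len
    treat-complete (value , g , x) (inj₂ (g≢n , d) , sg) = kept value g≢n d sg
    treat-complete (exists , g , x) (here refl , sg) = discharged
    treat-complete (exists , g , x) (there g∈ , sg) with g ≟ n
    ... | yes refl = discharged
    ... | no g≢n   = kept exists g≢n g∈ sg
    treat-complete (forbidden , g , x) (g∉ , sg) = kept forbidden (λ g≡n → g∉ (here g≡n)) (λ g∈ → g∉ (there g∈)) sg

    -- An item gives rise to at most two new ones, for the two operands, and costs 10 transitions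
    -- and one for the loop.
    pass-complete : ∀ s {h v a c i s′} → All (Good ((n , γ) ∷ gs)) s → All (Good gs) s′ →
      ∃₂ λ h′ v′ → ∃₂ λ a′ c′ → ∃[ s″ ]
        ARun≤ (pass e) (regs b n p q h v a c , i , s , s′) (regs b n p q h′ v′ a′ c′ , i , [] , s″)
            (1 + length s * 11) ×
          All (Good gs) s″ × length s″ ≤ length s * 2 + length s′
    pass-complete [] _ good = _ , _ , _ , _ , _ , stop≤ , good , ≤-refl
    pass-complete (it ∷ s) {s′ = s′} (g ∷ gd) good with treat-complete it g
    ... | _ , _ , _ , _ , new , r , good′ , len with pass-complete s gd (++⁺ good′ good)
    ... | _ , _ , _ , _ , s″ , r′ , good″ , len′ = _ , _ , _ , _ , s″ ,
      weaken (≤-reflexive (cong suc (+-suc 10 (length s * 11)))) (iter≤ r r′) , good″ , (begin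
        length s″                                  ≤⟨ len′ ⟩
        length s * 2 + length (new ++ s′)          ≡⟨ cong (length s * 2 +_) (length-++ new) ⟩
        length s * 2 + (length new + length s′)    ≤⟨ +-monoʳ-≤ (length s * 2) (+-monoˡ-≤ (length s′) len) ⟩
        length s * 2 + (2 + length s′)
            ≡⟨ solve 2 (λ s s′ → s :+ (con 2 :+ s′) := con 2 :+ s :+ s′) refl (length s * 2) (length s′) ⟩
        2 + length s * 2 + length s′               ∎)
      where open ≤-Reasoning

  expand-complete : ∀ σ gs {b n p q} → Small p → Small q → (∀ {p v} → Den gs p v → Small v) →
    ∀ {h v a c i s s′} → apply σ (Den gs p) (Den gs q) v →
    ∃₂ λ a′ c′ → ∃[ new ] ARun≤ (expand σ) (regs b n p q h v a c , i , s , s′)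
        (regs b n p q h v a′ c′ , i , s , new ++ s′) 6 ×
      All (Good gs) new × length new ≤ 2
  expand-complete union gs sp sq sv (inj₁ x) = _ , _ , _ ∷ [] , weaken (s≤s (s≤s z≤n)) (alt≤ false (atom≤ emit)) ,
      (x , sp) ∷ [] , s≤s z≤n
  expand-complete union gs sp sq sv (inj₂ x) = _ , _ , _ ∷ [] , weaken (s≤s (s≤s z≤n)) (alt≤ true (atom≤ emit)) ,
      (x , sq) ∷ [] , s≤s z≤n
  expand-complete intersection gs sp sq sv (x , y) = _ , _ , _ ∷ _ ∷ [] ,
    weaken (s≤s (s≤s z≤n)) (atom≤ emit ⨾ atom≤ emit) , (y , sq) ∷ (x , sp) ∷ [] , ≤-refl
  expand-complete sum gs sp sq sv (a , c , x , y , refl) = _ , _ , _ ∷ _ ∷ [] ,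
    weaken (n≤1+n 5) (atom≤ (guess a (sv x)) ⨾ atom≤ (guess c (sv y)) ⨾
        atom≤ (check (cong (_+ c) (*-identityˡ a))) ⨾ atom≤ emit ⨾ atom≤ emit) ,
    (y , sq) ∷ (x , sp) ∷ [] , ≤-refl
  expand-complete product gs sp sq sv (a , c , x , y , refl) = _ , _ , _ ∷ _ ∷ [] ,
    weaken (n≤1+n 5) (atom≤ (guess a (sv x)) ⨾ atom≤ (guess c (sv y)) ⨾ atom≤ (check (+-identityʳ (a * c))) ⨾
        atom≤ emit ⨾ atom≤ emit) ,
    (y , sq) ∷ (x , sp) ∷ [] , ≤-refl
  expand-complete quotient gs sp sq sv (a , c , x , y , c≢0 , refl) = _ , _ , _ ∷ _ ∷ [] ,
    (atom≤ (guess a (sv x)) ⨾ atom≤ (guess c (sv y)) ⨾ atom≤ (nonzero c≢0) ⨾ atom≤ (check (+-identityʳ _)) ⨾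
        atom≤ emit ⨾ atom≤ emit) ,
    (y , sq) ∷ (x , sp) ∷ [] , ≤-refl

  SmallInput : Gate → Set
  SmallInput (input n) = Small n
  SmallInput _         = ⊤

  SmallGate : ℕ × Gate → Set
  SmallGate (g , γ) = Small g × SmallInput γ

  small-name : ∀ {gs} → All SmallGate gs → ∀ {p} → p ∈ˡ names gs → Small p
  small-name sgs p∈ with ∈-map⁻ proj₁ p∈
  ... | _ , g∈ , refl = proj₁ (All.lookup sgs g∈)

  -- The 3 counts the additional items of a binary gate, two of kind `exists` and one of kind
  -- `forbidden`.
  Gated : ℕ → Gates → Algorithm → (b n p q h v a c : ℕ) → List Bool → List Bool → List Item → Set
  Gated k gs P b n p q h v a c i i′ s = ∃₂ λ p′ q′ → ∃₂ λ h′ v′ → ∃₂ λ a′ c′ → ∃[ s″ ]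
    ARun≤ P (regs b n p q h v a c , i , s , []) (regs b n p′ q′ h′ v′ a′ c′ , i′ , s″ , []) (k + length s * 11) ×
    All (Good gs) s″ × length s″ ≤ length s * 2 + 3

  module _ {gs : Gates} {b n p q h v a c : ℕ} {i : List Bool} {s : List Item}
    (sn : Small n) (n∉ : n ∉ names gs) (sgs : All SmallGate gs) (s≤ : length s * 2 + 3 ≤ M) where

    inputGate-complete : ∀ x → Small x → All (Good ((n , input x) ∷ gs)) s →
      Gated 8 gs inputGate b n p q h v a c (false ∷ encodeℕ x ++ false ∷ i) i s
    inputGate-complete x sx good
      with pass-complete (equate Left Item₂) (input x) gs sn
          (λ { refl → _ , _ , [] , weaken (s≤s z≤n) (atom≤ (check ≡⇒equal)) , [] , z≤n }) s good []
    ... | _ , _ , _ , _ , s″ , r , good′ , len = _ , _ , _ , _ , _ , _ , (forbidden , n , n) ∷ s″ ,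
      weaken (≤-reflexive (cong (λ m → 6 + m) (+-comm (length s * 11) 2)))
        (lits-complete (false ∷ []) ⨾ atom≤ (read x sx refl) ⨾ lits-complete (false ∷ []) ⨾ r ⨾ atom≤ emit ⨾
         atom≤ (swap (≤-trans len″ s≤))) , (n∉ , sn) ∷ good′ , len″
      where
      len″ : suc (length s″) ≤ length s * 2 + 3
      len″ = ≤-trans (s≤s len) (≤-trans (≤-reflexive (trans (cong suc (+-identityʳ _)) (+-comm 1 (length s * 2))))
          (+-monoʳ-≤ (length s * 2) (s≤s z≤n)))

    binaryGate-complete : ∀ σ x y → x ∈ˡ names gs → y ∈ˡ names gs → x ≤ y → (∀ {p v} → Den gs p v → Small v) →
      All (Good ((n , binary σ x y) ∷ gs)) s →
      Gated 20 gs (binaryGate σ) b n p q h v a c ((true ∷ encodeOp σ) ++ true ∷ encodeℕ x ++ true ∷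
          encodeℕ y ++ false ∷ i) i s
    binaryGate-complete σ x y x∈ y∈ x≤y sv good
      with pass-complete (expand σ) (binary σ x y) gs sn
          (expand-complete σ gs (small-name sgs x∈) (small-name sgs y∈) sv) s good []
    ... | _ , _ , _ , _ , s″ , r , good′ , len = _ , _ , _ , _ , _ , _ , _ ,
      weaken (cost σ)
        (lits-complete (true ∷ encodeOp σ) ⨾ lits-complete (true ∷ []) ⨾ atom≤ (read x sx refl) ⨾
            lits-complete (true ∷ []) ⨾
         atom≤ (read y sy refl) ⨾ lits-complete (false ∷ []) ⨾ atom≤ (guess (y ∸ x) (≤-<-trans (m∸n≤m y x) sy)) ⨾
         atom≤ (check (1*m+n∸m≡n x≤y)) ⨾ r ⨾ atom≤ emit ⨾ atom≤ emit ⨾ atom≤ emit ⨾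
             atom≤ (swap (≤-trans len″ s≤))) ,
      (n∉ , sn) ∷ (y∈ , sy) ∷ (x∈ , sx) ∷ good′ , len″
      where
      sx = small-name sgs x∈
      sy = small-name sgs y∈
      len″ : 3 + length s″ ≤ length s * 2 + 3
      len″ = ≤-trans (+-monoʳ-≤ 3 len) (≤-reflexive (trans (cong (3 +_) (+-identityʳ _)) (+-comm 3 (length s * 2))))
      cost : ∀ σ → 2 + length (encodeOp σ) + (2 + (1 + (2 + (1 + (2 + (1 + (1 + (1 + length s * 11 + 4)))))))) ≤ 20
          + length s * 11
      cost σ = ≤-trans (≤-reflexive (cong (λ k → 2 + k +
          (2 + (1 + (2 + (1 + (2 + (1 + (1 + (1 + length s * 11 + 4))))))))) (op σ)))
        (≤-reflexive (cong (16 +_) (+-comm (length s * 11) 4)))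
        where
        op : ∀ σ → length (encodeOp σ) ≡ 3
        op union        = refl
        op intersection = refl
        op sum          = refl
        op product      = refl
        op quotient     = refl

  anyGate : ∀ σ {s t k} → ARun≤ (binaryGate σ) s t k → ARun≤ (inputGate ∪ anyBinaryGate) s t (6 + k)
  anyGate union        r = weaken (+-monoˡ-≤ _ (s≤s (s≤s (z≤n {4})))) (alt≤ true (alt≤ false r))
  anyGate intersection r = weaken (+-monoˡ-≤ _ (s≤s (s≤s (s≤s (z≤n {3}))))) (alt≤ true (alt≤ true (alt≤ false r)))
  anyGate sum          r = weaken (+-monoˡ-≤ _ (s≤s (s≤s (s≤s (s≤s (z≤n {2}))))))
      (alt≤ true (alt≤ true (alt≤ true (alt≤ false r))))
  anyGate product      r = weaken (+-monoˡ-≤ _ (s≤s (s≤s (s≤s (s≤s (s≤s (z≤n {1})))))))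
      (alt≤ true (alt≤ true (alt≤ true (alt≤ true (alt≤ false r)))))
  anyGate quotient     r = weaken (n≤1+n _) (alt≤ true (alt≤ true (alt≤ true (alt≤ true (alt≤ true r)))))

  gate-complete : ∀ {gs g γ b n p q h v a c i} s → Valid 𝒪 ((g , γ) ∷ gs) → All SmallGate ((g , γ) ∷ gs) →
    (∀ {p v} → Den gs p v → Small v) → length s * 2 + 3 ≤ M → All (Good ((g , γ) ∷ gs)) s →
    ∃₂ λ p′ q′ → ∃₂ λ h′ v′ → ∃₂ λ a′ c′ → ∃[ s″ ]
      ARun≤ gate (regs b n p q h v a c , encodeGate (g , γ) ++ i , s , [])
          (regs b g p′ q′ h′ v′ a′ c′ , i , s″ , []) (27 + length s * 11) ×
      All (Good gs) s″ × length s″ ≤ length s * 2 + 3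
  gate-complete {γ = complement _} s (cons _ _ c∈ _) _ _ _ _ = ⊥-elim (complement∉𝒪 c∈)
  gate-complete {g = g} {input x} {i = i} s (cons g∉ _ _ _) ((sg , sx) ∷ sgs) sv s≤ good
    with inputGate-complete sg g∉ sgs s≤ x sx good
  ... | _ , _ , _ , _ , _ , _ , _ , r , rest = _ , _ , _ , _ , _ , _ , _ ,
    weaken (+-monoˡ-≤ (length s * 11) {10} {27} (m≤m+n 10 17)) (atom≤ (read g sg (begin
      (encodeℕ g ++ (false ∷ encodeℕ x) ++ false ∷ []) ++ i ≡⟨ ++-assoc (encodeℕ g) _ i ⟩
      encodeℕ g ++ ((false ∷ encodeℕ x) ++ false ∷ []) ++ i
          ≡⟨ cong (encodeℕ g ++_) (++-assoc (false ∷ encodeℕ x) (false ∷ []) i) ⟩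
      encodeℕ g ++ false ∷ encodeℕ x ++ false ∷ i           ∎)) ⨾ alt≤ false r) , rest
    where open ≡-Reasoning
  gate-complete {g = g} {binary σ x y} {i = i} s (cons g∉ cl (_ , x≤y) _) ((sg , _) ∷ sgs) sv s≤ good
    with binaryGate-complete sg g∉ sgs s≤ σ x y (cl (here refl)) (cl (there (here refl))) x≤y sv good
  ... | _ , _ , _ , _ , _ , _ , _ , r , rest = _ , _ , _ , _ , _ , _ , _ ,
    (atom≤ (read g sg (begin
      (encodeℕ g ++ (true ∷ encodeOp σ) ++ encodeList encodeℕ (x ∷ y ∷ [])) ++ i ≡⟨ ++-assoc (encodeℕ g) _ i ⟩
      encodeℕ g ++ ((true ∷ encodeOp σ) ++ encodeList encodeℕ (x ∷ y ∷ [])) ++ i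
          ≡⟨ cong (encodeℕ g ++_) (++-assoc (true ∷ encodeOp σ) (encodeList encodeℕ (x ∷ y ∷ [])) i) ⟩
      encodeℕ g ++ (true ∷ encodeOp σ) ++ encodeList encodeℕ (x ∷ y ∷ []) ++ i
          ≡⟨ cong (λ l → encodeℕ g ++ (true ∷ encodeOp σ) ++ l) (two-code x y i) ⟨
      encodeℕ g ++ (true ∷ encodeOp σ) ++ true ∷ encodeℕ x ++ true ∷ encodeℕ y ++ false ∷ i ∎)) ⨾ anyGate σ r) ,
          rest
    where open ≡-Reasoning

  -- This is `2 ^ m - 1`, the sum of the powers of 2 by which the work grows from gate to gate.
  rounds : ℕ → ℕ
  rounds zero    = 0
  rounds (suc m) = suc (2 * rounds m)

  suc-rounds : ∀ m → suc (rounds m) ≡ 2 ^ m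
  suc-rounds zero    = refl
  suc-rounds (suc m) = trans (sym (*-suc 2 (rounds m))) (cong (2 *_) (suc-rounds m))

  depth-tail : ∀ g gs → depth gs ≤ depth (g ∷ gs)
  depth-tail (_ , input n)      gs = m≤n+m _ _
  depth-tail (_ , complement _) gs = ≤-refl
  depth-tail (_ , binary _ _ _) gs = m≤m+n _ _

  -- The potential `length s + 3` at most doubles at a gate, as `(2 * length s + 3) + 3 = 2 *
  -- (length s + 3)`. It bounds the number of items and, multiplied by 11, the cost of the gate.
  gates-complete : ∀ gs {b n p q h v a c i} s → Valid 𝒪 gs → All SmallGate gs → depth gs ≤ L →
    (length s + 3) * 2 ^ length gs ≤ M → All (Good gs) s →
    ∃₂ λ n′ p′ → ∃₂ λ q′ h′ → ∃₂ λ v′ a′ → ∃₂ λ c′ s′ →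
      ARun≤ gates (regs b n p q h v a c , code gs ++ i , s , []) (regs b n′ p′ q′ h′ v′ a′ c′ , i , s′ , [])
        (1 + (length s + 3) * 11 * rounds (length gs)) ×
      All (Good []) s′ × length s′ ≤ M
  gates-complete [] s _ _ _ s≤ good = _ , _ , _ , _ , _ , _ , _ , s , weaken (s≤s z≤n) stop≤ , good ,
    ≤-trans (m≤m+n (length s) 3) (≤-trans (≤-reflexive (sym (*-identityʳ (length s + 3)))) s≤)
  gates-complete ((g , γ) ∷ gs) {b} {n} {p} {q} {h} {v} {a} {c} {i} s val@(cons _ _ _ valid) (sg ∷ sgs) d≤ s≤ good
    with gate-complete {i = code gs ++ i} s val (sg ∷ sgs)
      (λ d → ≤-trans (Den-bound complement∉𝒪 valid d) (^-monoʳ-≤ 2 (≤-trans (depth-tail (g , γ) gs) d≤))) s₁≤ good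
    where
    s₁≤ : length s * 2 + 3 ≤ M
    s₁≤ = begin
      length s * 2 + 3                      ≤⟨ +-monoʳ-≤ (length s * 2) (m≤m+n 3 3) ⟩
      length s * 2 + 6                      ≡⟨ *-distribʳ-+ 2 (length s) 3 ⟨
      (length s + 3) * 2                    ≤⟨ *-monoʳ-≤ (length s + 3) (*-monoʳ-≤ 2 (m^n>0 2 (length gs))) ⟩
      (length s + 3) * 2 ^ suc (length gs)  ≤⟨ s≤ ⟩
      M                                     ∎
      where open ≤-Reasoning
  ... | _ , _ , _ , _ , _ , _ , s₁ , r , good₁ , len with gates-complete gs s₁ valid sgs
      (≤-trans (depth-tail (g , γ) gs) d≤) (≤-trans s₁≤ s≤) good₁
    where
    s₁≤ : (length s₁ + 3) * 2 ^ length gs ≤ (length s + 3) * 2 ^ suc (length gs)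
    s₁≤ = begin
      (length s₁ + 3) * 2 ^ length gs        ≤⟨ *-monoˡ-≤ (2 ^ length gs) (+-monoˡ-≤ 3 len) ⟩
      (length s * 2 + 3 + 3) * 2 ^ length gs ≡⟨ solve 2
          (λ s t → (s :* con 2 :+ con 3 :+ con 3) :* t := (s :+ con 3) :* (con 2 :* t)) refl (length s)
          (2 ^ length gs) ⟩
      (length s + 3) * 2 ^ suc (length gs)   ∎
      where open ≤-Reasoning
  ... | _ , _ , _ , _ , _ , _ , _ , s′ , r′ , good′ , len′ = _ , _ , _ , _ , _ , _ , _ , s′ ,
    reassociate (weaken cost (iter≤ (atom≤ lit ⨾ r) r′)) , good′ , len′
    where
    reassociate : ∀ {t k} → ARun≤ gates (regs b n p q h v a c , true ∷ encodeGate (g , γ) ++ code gs ++ i , s , [])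
        t k →
           ARun≤ gates (regs b n p q h v a c , code ((g , γ) ∷ gs) ++ i , s , []) t k
    reassociate = subst (λ l → ARun≤ gates (regs b n p q h v a c , true ∷ l , s , []) _ _)
        (sym (++-assoc (encodeGate (g , γ)) (code gs) i))
    cost : suc (1 + (27 + length s * 11) + (1 + (length s₁ + 3) * 11 * rounds (length gs))) ≤
           1 + (length s + 3) * 11 * rounds (suc (length gs))
    cost = begin
      suc (1 + (27 + length s * 11) + (1 + (length s₁ + 3) * 11 * m))
          ≤⟨ +-monoʳ-≤ (29 + length s * 11) (s≤s (*-monoˡ-≤ m (*-monoˡ-≤ 11 (+-monoˡ-≤ 3 len)))) ⟩
      29 + length s * 11 + (1 + (length s * 2 + 3 + 3) * 11 * m)
          ≤⟨ +-monoˡ-≤ _ (+-monoˡ-≤ (length s * 11) (m≤m+n 29 4)) ⟩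
      33 + length s * 11 + (1 + (length s * 2 + 3 + 3) * 11 * m)
          ≡⟨ solve 2 (λ s m → con 33 :+ s :* con 11 :+ (con 1 :+ (s :* con 2 :+ con 3 :+ con 3) :* con 11 :* m) :=
          con 1 :+ (s :+ con 3) :* con 11 :* (con 1 :+ con 2 :* m)) refl (length s) m ⟩
      1 + (length s + 3) * 11 * rounds (suc (length gs))                     ∎
      where
      open ≤-Reasoning
      m = rounds (length gs)

  forbidden-complete : ∀ s {b n p q h v a c i s′} → All (Good []) s →
    ∃₂ λ h′ v′ → ARun≤ (‵ fetch forbidden Item₁ Item₂ *) (regs b n p q h v a c , i , s , s′)
        (regs b n p q h′ v′ a c , i , [] , s′) (1 + length s * 2)
  forbidden-complete [] _ = _ , _ , stop≤
  forbidden-complete ((value , _) ∷ s) ((() , _) ∷ _)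
  forbidden-complete ((exists , _) ∷ s) ((() , _) ∷ _)
  forbidden-complete ((forbidden , _) ∷ s) (_ ∷ good) with forbidden-complete s good
  ... | _ , _ , r = _ , _ , iter≤ (atom≤ fetch) r

  -- The single initial item has potential 4, whence `4 * 2 ^ length gs` and `44 = 4 * 11`. The term
  -- `M * 2` pays for removing the forbidden items at the end.
  main-complete : ∀ {gs out b} → Valid 𝒪 gs → Den gs out b → All SmallGate gs → depth gs ≤ L →
      4 * 2 ^ length gs ≤ M → 1 ≤ L → Small b →
    ∃[ t ] ARun≤ main (Vec.replicate 10 0 , encodeℕ out ++ encodeList encodeGate gs ++ encodeℕ b , [] , []) t
        (14 + 44 * 2 ^ length gs + M * 2)
  main-complete {gs} {out} {b} valid d sgs d≤ s≤ 1≤L sb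
    with gates-complete gs {i = false ∷ encodeℕ b} ((value , out , b) ∷ []) valid sgs d≤ s≤ ((d , so) ∷ [])
    where so = small-name sgs (Den⇒∈ gs d)
  ... | _ , _ , _ , _ , _ , _ , _ , s′ , r , good , len with forbidden-complete s′ good
  ... | _ , _ , r′ = _ , weaken cost
    (atom≤ (guess 1 1<2^L) ⨾ atom≤ (nonzero λ ()) ⨾ atom≤ (check refl) ⨾
     atom≤ (read out so (cong (encodeℕ out ++_) (++-assoc (code gs) (false ∷ []) (encodeℕ b)))) ⨾
         atom≤ (guess b sb) ⨾ atom≤ emit ⨾ atom≤ (swap 1≤M) ⨾
     r ⨾ atom≤ lit ⨾ atom≤ (read b sb (sym (++-identityʳ (encodeℕ b)))) ⨾ atom≤ (check ≡⇒equal) ⨾ atom≤ eof ⨾ r′ ⨾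
         atom≤ (swap z≤n))
    where
    so = small-name sgs (Den⇒∈ gs d)
    1<2^L : 1 < 2 ^ L
    1<2^L = ^-monoʳ-≤ 2 1≤L
    1≤M : 1 ≤ M
    1≤M = ≤-trans (*-mono-≤ {1} {4} (s≤s z≤n) (m^n>0 2 (length gs))) s≤
    cost : 1 + (1 + (1 + (1 + (1 + (1 + (1 + (1 + 44 * rounds (length gs) +
        (1 + (1 + (1 + (1 + (1 + length s′ * 2 + 1)))))))))))) ≤ 14 + 44 * 2 ^ length gs + M * 2
    cost = begin
      8 + 44 * rounds (length gs) + (5 + length s′ * 2 + 1)
          ≡⟨ solve 2 (λ r s → con 8 :+ r :+ (con 5 :+ s :+ con 1) := con 14 :+ r :+ s) refl
          (44 * rounds (length gs)) (length s′ * 2) ⟩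
      14 + 44 * rounds (length gs) + length s′ * 2
          ≤⟨ +-mono-≤ (+-monoʳ-≤ 14 (*-monoʳ-≤ 44 (≤-trans (n≤1+n _) (≤-reflexive (suc-rounds (length gs))))))
          (*-monoˡ-≤ 2 len) ⟩
      14 + 44 * 2 ^ length gs + M * 2                       ∎
      where open ≤-Reasoning

-- Running time

initialState : List Bool → State 10
initialState w = Vec.replicate 10 0 , w , [] , []

-- The input arrives reversed on the first stack; one move puts it in order.
program : Prog (StackAtom 20)
program = move U (at I) ∙ refine realise main

program-sound : ∀ w {σ n} → Run (Stacks 20) program (reverse w ∷ Vec.replicate 19 []) σ n → MC 𝒪 w
program-sound w (seq r r′) with move-sound {i = U} {j = at I} (λ ()) {reverse w} {[]}
    (reverse w ∷ Vec.replicate 19 []) r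
... | refl with refine-sound {⟦_⟧ᵃ = Effect (λ _ → ⊤) (λ _ → ⊤)} realise (λ h σ → σ ≡ represent h)
  (λ { c refl r → realise-sound (λ _ → tt) (λ _ → tt) c r }) main {initialState w}
  (cong (λ l → layout l [] [] (Vec.replicate 10 [])) (reverse-involutive w)) r′
... | _ , _ , r″ , _ = code⇒MC (Soundness.main-sound (λ _ → ⊤) (λ _ → ⊤) r″)

-- With `M = 4 * L` the last term of `effort` is `192 * L + 192 * L * L`, and all coefficients
-- together sum to 568.
effort≤ : ∀ L → 1 ≤ L → effort {10} L (4 * L) ≤ 568 * (L * L)
effort≤ L 1≤L = begin
  35 + L * 127 + L * L * 22 + 4 * L * (1 + L) * 48
      ≡⟨ solve 1 (λ L → con 35 :+ L :* con 127 :+ L :* L :* con 22 :+ con 4 :* L :* (con 1 :+ L) :* con 48 :=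
                                                       con 35 :+ L :* con 319 :+ con 214 :* (L :* L)) refl L ⟩
  35 + L * 319 + 214 * (L * L)
      ≤⟨ +-monoˡ-≤ _ (+-mono-≤ (*-monoʳ-≤ 35 (≤-trans 1≤L L≤L²)) (*-monoˡ-≤ 319 L≤L²)) ⟩
  35 * (L * L) + L * L * 319 + 214 * (L * L)
      ≡⟨ solve 1 (λ l → con 35 :* l :+ l :* con 319 :+ con 214 :* l := con 568 :* l) refl (L * L) ⟩
  568 * (L * L)                                    ∎
  where
  open ≤-Reasoning
  L≤L² : L ≤ L * L
  L≤L² = ≤-trans (≤-reflexive (sym (*-identityʳ L))) (*-monoʳ-≤ L 1≤L)

^-distribʳ-* : ∀ n a b → (a * b) ^ n ≡ a ^ n * b ^ n
^-distribʳ-* zero    a b = refl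
^-distribʳ-* (suc n) a b = trans (cong (a * b *_) (^-distribʳ-* n a b))
    (interchange *-commutativeSemigroup a b (a ^ n) (b ^ n))

module _ (K : ℕ) .{{_ : NonZero K}} where

  -- For `1 ≤ N` the factor `K` is at most `K ^ N`. This gives a pure power, the form in which the
  -- clock grants its ticks.
  cube≤ : ∀ N → 1 ≤ N → K * (2 ^ N * (2 ^ N * 2 ^ N)) ≤ (K * 8) ^ N
  cube≤ N 1≤N = begin
    K * (2 ^ N * (2 ^ N * 2 ^ N)) ≤⟨ *-mono-≤ K≤ (≤-reflexive cube) ⟩
    K ^ N * 8 ^ N                 ≡⟨ ^-distribʳ-* N K 8 ⟨
    (K * 8) ^ N                   ∎
    where
    open ≤-Reasoning
    K≤ : K ≤ K ^ N
    K≤ = ≤-trans (≤-reflexive (sym (^-identityʳ K))) (^-monoʳ-≤ K 1≤N)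
    cube : 2 ^ N * (2 ^ N * 2 ^ N) ≡ 8 ^ N
    cube = trans (cong (λ l → 2 ^ N * (2 ^ N * l)) (sym (*-identityʳ (2 ^ N))))
      (trans (^-*-assoc 2 N 3) (trans (cong (2 ^_) (*-comm N 3)) (sym (^-*-assoc 2 3 N))))

module _ (a b : ℕ) where

  -- The 8 covers the initial move of the input, `a * b` the commands with their costs, and the 2
  -- the passage from stacks to tapes.
  scale : ℕ
  scale = (8 + a * b) * 2

  steps≤ : ∀ N {e} → 1 ≤ N → e ≤ b * (2 ^ N * 2 ^ N) → (2 + N * 6 + (a * 2 ^ N) * e) * 2 ≤ (scale * 8) ^ N
  steps≤ N {e} 1≤N e≤ = begin
    (2 + N * 6 + (a * L) * e) * 2                         ≤⟨ *-monoˡ-≤ 2 (+-mono-≤ short (*-monoʳ-≤ (a * L) e≤)) ⟩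
    (8 * (L * (L * L)) + (a * L) * (b * (L * L))) * 2
        ≡⟨ solve 4 (λ a b L l → (con 8 :* (L :* l) :+ (a :* L) :* (b :* l)) :* con 2 := (con 8 :+ a :* b) :* con 2
        :* (L :* l)) refl a b L (L * L) ⟩
    scale * (L * (L * L))                                 ≤⟨ cube≤ scale N 1≤N ⟩
    (scale * 8) ^ N                                       ∎
    where
    open ≤-Reasoning
    L = 2 ^ N
    1≤L : 1 ≤ L
    1≤L = m^n>0 2 N
    L≤L³ : L ≤ L * (L * L)
    L≤L³ = ≤-trans (≤-reflexive (sym (*-identityʳ L))) (*-monoʳ-≤ L (*-mono-≤ 1≤L 1≤L))
    short : 2 + N * 6 ≤ 8 * (L * (L * L))
    short = begin
      2 + N * 6           ≤⟨ +-mono-≤ (*-monoʳ-≤ 2 1≤L) (*-monoˡ-≤ 6 (<⇒≤ (n<2^n N))) ⟩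
      2 * L + L * 6       ≡⟨ solve 1 (λ L → con 2 :* L :+ L :* con 6 := con 8 :* L) refl L ⟩
      8 * L               ≤⟨ *-monoʳ-≤ 8 L≤L³ ⟩
      8 * (L * (L * L))   ∎

-- Abstract, lest the literal be unfolded to unary.
abstract
  base : ℕ
  base = scale 66 568 * 8

  time≤ : ∀ N → 1 ≤ N → (2 + N * 6 + (66 * 2 ^ N) * effort {10} (2 ^ N) (4 * 2 ^ N)) * 2 ≤ base ^ N
  time≤ N 1≤N = steps≤ 66 568 N 1≤N (effort≤ (2 ^ N) (m^n>0 2 N))

program-run : ∀ w L M {t T} → Run≤ (Effect (λ n → n < 2 ^ L) (_≤ M)) main (initialState w) t T →
              ∃[ σ ] SRun≤ program (reverse w ∷ Vec.replicate 19 []) σ (2 + length w * 6 + T * effort {10} L M)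
program-run w L M {t} {T} (n , r , n≤) =
  let σ , (m , r′ , m≤) , _ = refine-complete {⟦_⟧ᵃ = Effect (λ n → n < 2 ^ L) (_≤ M)} realise (Represents L M)
          (effort {10} L M) (s≤s z≤n) (realise-complete L M) (refl , fits) r
  in σ , weaken (+-monoˡ-≤ (T * effort {10} L M) (≤-reflexive (cong (λ l → 2 + l * 6) (length-reverse w))))
           (cast refl (cong (λ l → layout l [] [] (Vec.replicate 10 [])) (reverse-involutive w))
              (move-complete {i = U} {j = at I} (λ ()) (reverse w) {[]} (reverse w ∷ Vec.replicate 19 [])) ⨾
            (m , r′ , ≤-trans m≤ (*-monoˡ-≤ (effort {10} L M) n≤)))
  where
  fits : Fits L M (initialState w)
  fits = (λ r → subst (_< 2 ^ L) (sym (lookup-replicate r 0)) (m^n>0 2 L)) , [] , []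

module _ {w : List Bool} {gs : Gates} {out b : ℕ}
         (w≡ : w ≡ encodeℕ out ++ encodeList encodeGate gs ++ encodeℕ b) where

  private
    N = length w
    -- One bound serves three purposes: it dominates the depth and thus the digits of all values,
    -- the lengths of the numbers in the input, and the factor `2 ^ length gs` in the number of
    -- items.
    L = 2 ^ N

    N≡ : length (encodeℕ out) + length (encodeList encodeGate gs ++ encodeℕ b) ≡ N
    N≡ = sym (trans (cong length w≡) (length-++ (encodeℕ out)))

    code≤ : length (code gs) ≤ N
    code≤ = begin
      length (code gs)                                      ≤⟨ m≤m+n _ _ ⟩
      length (code gs) + 1                                  ≡⟨ length-++ (code gs) ⟨
      length (encodeList encodeGate gs)                     ≤⟨ m≤m+n _ _ ⟩
      length (encodeList encodeGate gs) + length (encodeℕ b) ≡⟨ length-++ (encodeList encodeGate gs) ⟨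
      length (encodeList encodeGate gs ++ encodeℕ b)        ≤⟨ m≤n+m _ (length (encodeℕ out)) ⟩
      length (encodeℕ out) + length (encodeList encodeGate gs ++ encodeℕ b) ≡⟨ N≡ ⟩
      N                                                     ∎
      where open ≤-Reasoning

    b≤ : length (digits b) ≤ N
    b≤ = begin
      length (digits b)                                     ≤⟨ length-digits≤encodeℕ b ⟩
      length (encodeℕ b)                                    ≤⟨ m≤n+m _ _ ⟩
      length (encodeList encodeGate gs) + length (encodeℕ b) ≡⟨ length-++ (encodeList encodeGate gs) ⟨
      length (encodeList encodeGate gs ++ encodeℕ b)        ≤⟨ m≤n+m _ (length (encodeℕ out)) ⟩
      length (encodeℕ out) + length (encodeList encodeGate gs ++ encodeℕ b) ≡⟨ N≡ ⟩
      N                                                     ∎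
      where open ≤-Reasoning

    1≤N : 1 ≤ N
    1≤N = ≤-trans (≤-trans (s≤s z≤n) (≤-reflexive (sym (length-frame (digits out)))))
      (≤-trans (m≤m+n _ _) (≤-reflexive N≡))

    open Completeness L (4 * L) using (Small; SmallGate; SmallInput; main-complete)

    small : ∀ {n} → length (digits n) ≤ N → Small n
    small {n} n≤ = ≤-trans (<2^length-digits n) (^-monoʳ-≤ 2 (≤-trans n≤ (<⇒≤ (n<2^n N))))

    small-gates : ∀ gs → length (code gs) ≤ N → All SmallGate gs
    small-gates []             _  = []
    small-gates ((g , γ) ∷ gs) c≤ = (small (≤-trans (name≤code g γ) g≤) , small-input γ g≤) ∷
        small-gates gs (≤-trans (≤-trans (m≤n+m _ _) (n≤1+n _)) c≤′)
      where
      c≤′ : suc (length (encodeGate (g , γ)) + length (code gs)) ≤ N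
      c≤′ = ≤-trans (≤-reflexive (sym (code-∷ (g , γ) gs))) c≤
      g≤ : length (encodeGate (g , γ)) ≤ N
      g≤ = ≤-trans (≤-trans (m≤m+n _ _) (n≤1+n _)) c≤′
      small-input : ∀ γ → length (encodeGate (g , γ)) ≤ N → SmallInput γ
      small-input (input n)      le = small (≤-trans (input≤code g n) le)
      small-input (complement _) _  = tt
      small-input (binary _ _ _) _  = tt

    2^len≤ : 2 ^ length gs ≤ L
    2^len≤ = ^-monoʳ-≤ 2 (≤-trans (length≤code gs) code≤)

    main-time : 14 + 44 * 2 ^ length gs + 4 * L * 2 ≤ 66 * L
    main-time = begin
      14 + 44 * 2 ^ length gs + 4 * L * 2 ≤⟨ +-monoˡ-≤ (4 * L * 2)
          (+-mono-≤ (*-monoʳ-≤ 14 (m^n>0 2 N)) (*-monoʳ-≤ 44 2^len≤)) ⟩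
      14 * L + 44 * L + 4 * L * 2         ≡⟨ solve 1
          (λ L → con 14 :* L :+ con 44 :* L :+ con 4 :* L :* con 2 := con 66 :* L) refl L ⟩
      66 * L                              ∎
      where open ≤-Reasoning

  main-run : Valid 𝒪 gs → Den gs out b → ∃[ t ] Run≤ (Effect Small (_≤ 4 * L)) main (initialState w) t (66 * L)
  main-run valid d = subst (λ w → ∃[ t ] Run≤ (Effect Small (_≤ 4 * L)) main (initialState w) t (66 * L)) (sym w≡)
    (let t , r = main-complete valid d (small-gates gs code≤) (≤-trans (depth≤ gs) (^-monoʳ-≤ 2 code≤))
                   (*-monoʳ-≤ 4 2^len≤) (m^n>0 2 N) (small b≤)
     in t , weaken main-time r)

  code-complete : Valid 𝒪 gs → Den gs out b →
    ∃₂ λ σ n → Run (Stacks 20) program (reverse w ∷ Vec.replicate 19 []) σ n × n * 2 ≤ base ^ N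
  code-complete valid d =
    let _ , r          = main-run valid d
        σ , n , r′ , n≤ = program-run w L (4 * L) r
    in σ , n , r′ , ≤-trans (*-monoˡ-≤ 2 n≤) (time≤ N 1≤N)

program-complete : ∀ w → MC 𝒪 w → ∃₂ λ σ n → Run (Stacks 20) program (reverse w ∷ Vec.replicate 19 []) σ n ×
    n * 2 ≤ base ^ length w
program-complete w w∈ =
  let _ , _ , _ , valid , d , w≡ = MC⇒code w∈
  in code-complete w≡ valid d

theorem3 : MC (binary union ∷ binary intersection ∷ binary sum ∷ binary product ∷ binary quotient ∷ []) ∈ NEXP
theorem3 = NEXP-by-program base 19 program program-sound program-complete
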